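{- Let $q$ be a prime power and let $A$ be a finite subset of $\mathbb{F}_q^*$ with the property that $$|A\cap cG|\leq \max\left\{|G|^{1/2},\frac{|A|}{8}\right\}$$ for every subfield $G$ of $\mathbb{F}_q$ and every element $c\in\mathbb{F}_q$. Then either $$|A+A|^7|A:A|^4\gg |A|^{12},$$ or $$|A+A|^6|A:A|^5\gg |A|^{12}.$$ In particular, $$\max\{|A+A|,|A:A|\}\gg |A|^{12/11}.$$ Here the implied constants are absolute (independent of $q$ and $A$).
   Context: $A+A=\{a+b:a,b\in A\}$ is the sum set and $A:A=\{a/b:a,b\in A\}$ is the ratio set. For a subfield $G$ and $c\in\mathbb{F}_q$, $cG=\{cg:g\in G\}$. The notation $U\ll V$ (equivalently $V\gg U$) means $|U|\le cV$ for some absolute constant $c>0$. -}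

module Defs where

open import Level using (0ℓ)
open import Data.Nat using (ℕ)
open import Data.Product using (_×_; _,_; Σ)
open import Data.List using (List; length; filter)
open import Data.List.Relation.Unary.Any using (Any; any?)
open import Data.List.Relation.Unary.All using (All)
open import Data.List.Relation.Unary.AllPairs using (AllPairs)
open import Relation.Nullary using (¬_; Dec; yes; no)
open import Relation.Nullary.Decidable using (_×-dec_)
open import Relation.Unary using (Pred)
open import Relation.Binary using (Decidable)
open import Algebra.Bundles using (CommutativeRing)

record FiniteField : Set₁ where
  field
    commRing : CommutativeRing 0ℓ 0ℓ
  open CommutativeRing commRing public
  field
    _⁻¹         : Carrier → Carrier
    inverseʳ    : ∀ x → ¬ (x ≈ 0#) → x * (x ⁻¹) ≈ 1#
    nontrivial  : ¬ (1# ≈ 0#)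
    _≟_         : Decidable _≈_
    elems       : List Carrier
    complete    : ∀ x → Any (x ≈_) elems
    distinct    : AllPairs (λ x y → ¬ (x ≈ y)) elems

  _/_ : Carrier → Carrier → Carrier
  a / b = a * (b ⁻¹)

  countF : {P : Pred Carrier 0ℓ} → (∀ x → Dec (P x)) → ℕ
  countF P? = length (filter P? elems)

  FinSubset : List Carrier → Set
  FinSubset A = AllPairs (λ x y → ¬ (x ≈ y)) A

  card : List Carrier → ℕ
  card A = length A

  InSumSet : List Carrier → Carrier → Set
  InSumSet A x = Any (λ a → Any (λ b → x ≈ a + b) A) A

  sumSetSize : List Carrier → ℕ
  sumSetSize A = countF (λ x → any? (λ a → any? (λ b → x ≟ (a + b)) A) A)

  InRatioSet : List Carrier → Carrier → Set
  InRatioSet A x = Any (λ a → Any (λ b → x ≈ a / b) A) A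

  ratioSetSize : List Carrier → ℕ
  ratioSetSize A = countF (λ x → any? (λ a → any? (λ b → x ≟ (a / b)) A) A)

  record IsSubfield (G : Pred Carrier 0ℓ) : Set where
    field
      resp   : ∀ {x y} → x ≈ y → G x → G y
      has0   : G 0#
      has1   : G 1#
      +-closed : ∀ {x y} → G x → G y → G (x + y)
      neg-closed : ∀ {x} → G x → G (- x)
      *-closed : ∀ {x y} → G x → G y → G (x * y)
      inv-closed : ∀ {x} → G x → ¬ (x ≈ 0#) → G (x ⁻¹)

  subfieldSize : {G : Pred Carrier 0ℓ} → (∀ x → Dec (G x)) → ℕ
  subfieldSize G? = countF G?

  InDilate : (G : Pred Carrier 0ℓ) → Carrier → Carrier → Set
  InDilate G c x = Any (λ g → G g × (x ≈ c * g)) elems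

  dilateInterSize : {G : Pred Carrier 0ℓ} → (∀ x → Dec (G x)) →
                    Carrier → List Carrier → ℕ
  dilateInterSize G? c A =
    length (filter (λ x → any? (λ g → G? g ×-dec (x ≟ (c * g))) elems) A)

{-# OPTIONS --safe #-}

-- Write n = |A|, S = |A + A|, Q = |A : A|. Petridis' argument gives a subset B of A, of at least half its
-- size, with |B + A + A + A| ≪ S³/n². Most pairs of B lie on lines through 0 carrying ≫ n²/Q points of
-- B × B; pruning the graph of one such pencil leaves a positive proportion W of B and a dilation l such that
-- for every m in l W the set {u ∈ W : m u ∈ B} has ≫ n²/Q elements. Hence m Z, for Z ⊆ A, is half covered
-- by ≪ S Q/n² translates of B or of -B, and on that set of u the dilate lies in B outright.
-- Let R = {(a - b)/(c - d) : a, b, c, d ∈ W}. If r ∉ R, then (x, u) ↦ x + r u is injective on W × W.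
-- Either 1 + s ∉ R for some s ∈ R, or m s ∉ R for some m ∈ l W and s ∈ R, or R is a subfield containing l W.
-- In the last case |W|² ≤ |R|, and some s ∈ R makes x + s u nearly injective. In each case x + s u with
-- s = (a - b)/(c - d) is multiplied by l (c - d), its four terms are covered by translates of ±B, and
-- |B + A + A + A| bounds the number of values.
module Submission where

open import Defs
open import Level using (0ℓ)
open import Algebra.Bundles using (CommutativeRing; RawRing)
open import Algebra.Structures using (IsCommutativeRing)
import Algebra.Properties.AbelianGroup
import Algebra.Properties.Ring
import Algebra.Properties.Semiring.Mult
import Algebra.Solver.Ring
open import Algebra.Solver.Ring.AlmostCommutativeRing using (fromCommutativeRing; _-Raw-AlmostCommutative⟶_)
open import Data.Fin using (Fin) renaming (zero to fzero; suc to fsuc)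
import Data.Fin as Fin
open import Data.List using (List; []; _∷_; _++_; length; lookup; map; filter; cartesianProduct; cartesianProductWith; deduplicate)
open import Data.List.Membership.Propositional using (_∈_; _∉_; find; lose)
open import Data.List.Membership.Propositional.Properties
import Data.List.Membership.DecPropositional as DecMem
open import Data.List.Properties using (length-++; length-filter; length-map)
open import Data.List.Relation.Binary.Permutation.Propositional using (_↭_; ↭-sym; ↭-refl; ↭-trans; prep; ↭⇒↭ₛ)
open import Data.List.Relation.Binary.Permutation.Propositional.Properties using (↭-length; map⁺; ∈-resp-↭; shift)
import Data.List.Relation.Binary.Permutation.Setoid.Properties as ↭ₛ
open import Data.List.Relation.Binary.Subset.Propositional using (_⊆_)
open import Data.List.Relation.Unary.All using (All; _∷_; all?)
import Data.List.Relation.Unary.All as All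
open import Data.List.Relation.Unary.AllPairs using (AllPairs; []; _∷_)
import Data.List.Relation.Unary.AllPairs as AllPairs
import Data.List.Relation.Unary.AllPairs.Properties as AllPairs
open import Data.List.Relation.Unary.Any using (Any; here; there; any?; index)
open import Data.List.Relation.Unary.Any.Properties using (lookup-index)
open import Data.List.Relation.Unary.Unique.Propositional using (Unique)
import Data.List.Relation.Unary.Unique.Propositional.Properties as Unique
import Data.List.Relation.Unary.Unique.DecPropositional.Properties as DecUnique
open import Data.Maybe using (Maybe; just; nothing)
open import Data.Nat as ℕ using (ℕ; zero; suc; _≤_; _<_; z≤n; s≤s; _≤?_; NonZero; >-nonZero)
open import Data.Nat.ListAction using (sum)
open import Data.Nat.ListAction.Properties using (sum-↭)
open import Data.Nat.Properties using (≤-refl; ≤-trans; ≤-reflexive; <-irrefl; ≤-pred; <⇒≤; ≮⇒≥; ≰⇒>; m≤m+n; m≤n+m; +-mono-≤; *-mono-≤; *-cancelˡ-≤; *-cancelʳ-≤; +-cancelʳ-≤; *-monoˡ-≤; *-monoʳ-≤; +-monoˡ-≤; +-monoʳ-≤; module ≤-Reasoning; *-zeroʳ; n≤0⇒n≡0; m*n≢0)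
import Data.Nat.Properties as ℕ
open import Data.Nat.Tactic.RingSolver using (solve-∀)
open import Data.Product using (Σ; ∃; _×_; _,_; proj₁; proj₂)
open import Data.Product.Properties using (≡-dec)
open import Data.Sum using (_⊎_; inj₁; inj₂)
open import Data.Unit using (tt)
open import Function using (_∘_; id)
open import Relation.Binary.Definitions using (DecidableEquality)
open import Relation.Binary.PropositionalEquality
open import Relation.Nullary using (¬_; Dec; yes; no; contradiction)
open import Relation.Nullary.Decidable using (¬?; _×-dec_; decidable-stable)
open import Relation.Unary using (Pred; Decidable)

-- The design is an economy of covers. One cover of a dilate multiplies the upper bound for the
-- number of values of `x + s u` by `S Q / n²`, so treating all four terms this way is expensive.
-- When the outside quotient is `1 + s` or `m s`, one of the four covers is saved by letting its
-- variable run only over the `≫ n²/Q` elements whose dilate is already in `B`; the price is a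
-- smaller range for that variable. When `R` is a subfield both variables stay dense and all four
-- covers are paid. The elements `a`, `b`, `c`, `d` of a quotient are arbitrary members of `W`. A
-- pencil that is rich only on average would therefore not do: every slope in `l W` has to be rich,
-- and rich inside `W` itself, since `x` and `u` must stay in `W` for the injectivity argument. This
-- is what forces the pruning. The pruning must also keep `|W|` above `n / 8`. Otherwise, in the
-- subfield case, the hypothesis on `A` could be met by its alternative `|A| / 8` and would not
-- bound `|W|²` by `|R|`.

module Counting where
  open import Data.Nat using (_+_; _*_; _^_; _<?_)
  open import Data.Nat.Properties

  -- Sums over lists, averaging, fibres and cardinalities

  ∑ : {A : Set} → List A → (A → ℕ) → ℕ
  ∑ xs f = sum (map f xs)

  [_]ᵈ : {P : Set} → Dec P → ℕ
  [ yes _ ]ᵈ = 1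
  [ no _ ]ᵈ = 0

  module _ {A : Set} where

    ∑-mono : ∀ (xs : List A) {f g : A → ℕ} → (∀ {x} → x ∈ xs → f x ≤ g x) → ∑ xs f ≤ ∑ xs g
    ∑-mono []       h = z≤n
    ∑-mono (x ∷ xs) h = +-mono-≤ (h (here refl)) (∑-mono xs (h ∘ there))

    ∑-+ : ∀ (xs : List A) (f g : A → ℕ) → ∑ xs (λ x → f x + g x) ≡ ∑ xs f + ∑ xs g
    ∑-+ []       f g = refl
    ∑-+ (x ∷ xs) f g rewrite ∑-+ xs f g = interchange (f x) (g x) (∑ xs f) (∑ xs g)
      where
      interchange : ∀ a b c d → (a + b) + (c + d) ≡ (a + c) + (b + d)
      interchange = solve-∀

    ∑-const : ∀ (xs : List A) c → ∑ xs (λ _ → c) ≡ length xs * c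
    ∑-const []       c = refl
    ∑-const (x ∷ xs) c = cong (c +_) (∑-const xs c)

    ∑-*ˡ : ∀ (xs : List A) c (f : A → ℕ) → ∑ xs (λ x → c * f x) ≡ c * ∑ xs f
    ∑-*ˡ []       c f = sym (*-zeroʳ c)
    ∑-*ˡ (x ∷ xs) c f = trans (cong (c * f x +_) (∑-*ˡ xs c f)) (sym (*-distribˡ-+ c (f x) (∑ xs f)))

    ∑-↭ : ∀ {xs ys : List A} (f : A → ℕ) → xs ↭ ys → ∑ xs f ≡ ∑ ys f
    ∑-↭ f p = sum-↭ (map⁺ f p)

    length-filter-∑ : {P : Pred A 0ℓ} (P? : Decidable P) (xs : List A) →
                      length (filter P? xs) ≡ ∑ xs (λ x → [ P? x ]ᵈ)
    length-filter-∑ P? []       = refl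
    length-filter-∑ P? (x ∷ xs) with P? x
    ... | yes _ = cong suc (length-filter-∑ P? xs)
    ... | no  _ = length-filter-∑ P? xs

    length-filter-split : {P : Pred A 0ℓ} (P? : Decidable P) (xs : List A) →
                          length (filter P? xs) + length (filter (¬? ∘ P?) xs) ≡ length xs
    length-filter-split P? []       = refl
    length-filter-split P? (x ∷ xs) with P? x
    ... | yes _ = cong suc (length-filter-split P? xs)
    ... | no  _ = trans (+-suc _ _) (cong suc (length-filter-split P? xs))

    ∑-filter-split : {P : Pred A 0ℓ} (P? : Decidable P) (xs : List A) (f : A → ℕ) →
                     ∑ xs f ≡ ∑ (filter P? xs) f + ∑ (filter (¬? ∘ P?) xs) f
    ∑-filter-split P? []       f = refl
    ∑-filter-split P? (x ∷ xs) f with P? x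
    ... | yes _ = trans (cong (f x +_) (∑-filter-split P? xs f)) (sym (+-assoc (f x) _ _))
    ... | no  _ = trans (cong (f x +_) (∑-filter-split P? xs f)) (swap (f x) (∑ (filter P? xs) f) (∑ (filter (¬? ∘ P?) xs) f))
      where
      swap : ∀ a b c → a + (b + c) ≡ b + (a + c)
      swap = solve-∀

    unique-++ʳ : ∀ (xs : List A) {ys} → Unique (xs ++ ys) → Unique ys
    unique-++ʳ []       uniq       = uniq
    unique-++ʳ (x ∷ xs) (_ ∷ uniq) = unique-++ʳ xs uniq

    ∈⇒↭ : ∀ {x} {xs : List A} → x ∈ xs → ∃ λ ys → xs ↭ x ∷ ys
    ∈⇒↭ {x} x∈xs with ∈-∃++ x∈xs
    ... | as , bs , refl = as ++ bs , shift x as bs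

  ∑-swap : {A B : Set} (xs : List A) (ys : List B) (f : A → B → ℕ) →
           ∑ xs (λ x → ∑ ys (f x)) ≡ ∑ ys (λ y → ∑ xs (λ x → f x y))
  ∑-swap []       ys f = sym (trans (∑-const ys 0) (*-zeroʳ (length ys)))
  ∑-swap (x ∷ xs) ys f = trans (cong (∑ ys (f x) +_) (∑-swap xs ys f)) (sym (∑-+ ys (f x) _))

  length-× : {A B : Set} (xs : List A) (ys : List B) →
             length (cartesianProduct xs ys) ≡ length xs * length ys
  length-× []       ys = refl
  length-× (x ∷ xs) ys = trans (length-++ (map (x ,_) ys))
    (cong₂ _+_ (length-map (x ,_) ys) (length-× xs ys))

  module _ {A : Set} where

    max-≥-average : ∀ {y₀} (ys : List A) (g : A → ℕ) → y₀ ∈ ys →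
                    ∃ λ y → y ∈ ys × ∑ ys g ≤ length ys * g y
    max-≥-average ys g y₀∈ with any? (λ y → ∑ ys g ≤? length ys * g y) ys
    ... | yes p = find p
    ... | no ¬p = contradiction ∑<∑ (<-irrefl refl)
      where
      -- Each value misses the average by at least 1 after multiplication by `length ys`, and the
      -- shortfalls add up. The induction runs over `zs` while `ys` stays fixed in the average.
      gap : ∀ zs → (∀ {z} → z ∈ zs → length ys * g z < ∑ ys g) → ∑ zs (λ z → length ys * g z) + length zs ≤ length zs * ∑ ys g
      gap []       h = z≤n
      gap (z ∷ zs) h = begin
        (length ys * g z + t) + suc (length zs)  ≡⟨ shuffle (length ys * g z) t (length zs) ⟩
        suc (length ys * g z) + (t + length zs)  ≤⟨ +-mono-≤ (h (here refl)) (gap zs (h ∘ there)) ⟩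
        ∑ ys g + length zs * ∑ ys g              ∎
        where
        open ≤-Reasoning
        t = ∑ zs (λ z → length ys * g z)
        shuffle : ∀ a b c → (a + b) + suc c ≡ suc a + (b + c)
        shuffle = solve-∀
      ∑<∑ : length ys * ∑ ys g < length ys * ∑ ys g
      ∑<∑ = begin-strict
        length ys * ∑ ys g                              ≡⟨ sym (∑-*ˡ ys (length ys) g) ⟩
        ∑ ys (λ z → length ys * g z)                    <⟨ m<m+n _ (∈-length y₀∈) ⟩
        ∑ ys (λ z → length ys * g z) + length ys        ≤⟨ gap ys (λ z∈ → ≰⇒> (λ le → ¬p (lose z∈ le))) ⟩
        length ys * ∑ ys g                              ∎
        where open ≤-Reasoning

    -- The ratios `f y / g y` are compared by cross-multiplication, which keeps everything in `ℕ`;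
    -- positivity of `g` makes this comparison transitive.
    argmin-ratio : ∀ {y₀} (ys : List A) (f g : A → ℕ) → y₀ ∈ ys → (∀ {y} → y ∈ ys → 0 < g y) →
                   ∃ λ y → y ∈ ys × (∀ {z} → z ∈ ys → f y * g z ≤ f z * g y)
    argmin-ratio (y ∷ []) f g _ pos = y , here refl , λ { (here refl) → ≤-refl }
    argmin-ratio (y ∷ ys@(y′ ∷ _)) f g _ pos
      with argmin-ratio ys f g (here refl) (pos ∘ there)
    ... | m , m∈ , m-min with ≤-total (f y * g m) (f m * g y)
    ...   | inj₁ y≼m = y , here refl , λ { (here refl) → ≤-refl ; (there {z} z∈) → lem _ z∈ }
      where
      lem : ∀ z → z ∈ ys → f y * g z ≤ f z * g y
      lem z z∈ = *-cancelʳ-≤ _ _ (g m) {{>-nonZero (pos (there m∈))}} (begin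
        f y * g z * g m    ≡⟨ swap (f y) (g z) (g m) ⟩
        f y * g m * g z    ≤⟨ *-monoˡ-≤ (g z) y≼m ⟩
        f m * g y * g z    ≡⟨ swap (f m) (g y) (g z) ⟩
        f m * g z * g y    ≤⟨ *-monoˡ-≤ (g y) (m-min z∈) ⟩
        f z * g m * g y    ≡⟨ swap (f z) (g m) (g y) ⟩
        f z * g y * g m    ∎)
        where
        open ≤-Reasoning
        swap : ∀ a b c → a * b * c ≡ a * c * b
        swap = solve-∀
    ...   | inj₂ m≼y = m , there m∈ , λ { (here refl) → m≼y ; (there z∈) → m-min z∈ }

    min-≤-average : ∀ {y₀} (ys : List A) (g : A → ℕ) → y₀ ∈ ys →
                    ∃ λ y → y ∈ ys × length ys * g y ≤ ∑ ys g
    min-≤-average ys g y₀∈ with argmin-ratio ys g (λ _ → 1) y₀∈ (λ _ → s≤s z≤n)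
    ... | y , y∈ , min = y , y∈ , (begin
        length ys * g y         ≡⟨ sym (∑-const ys (g y)) ⟩
        ∑ ys (λ _ → g y)        ≤⟨ ∑-mono ys (λ z∈ → subst₂ _≤_ (*-identityʳ _) (*-identityʳ _) (min z∈)) ⟩
        ∑ ys g                  ∎)
      where open ≤-Reasoning

    -- Turns a minimisation over subsets into a finite search, over a family closed under `filter`.
    sublists : List A → List (List A)
    sublists []       = [] ∷ []
    sublists (x ∷ xs) = sublists xs ++ map (x ∷_) (sublists xs)

    filter∈sublists : {P : Pred A 0ℓ} (P? : Decidable P) (xs : List A) → filter P? xs ∈ sublists xs
    filter∈sublists P? []       = here refl
    filter∈sublists P? (x ∷ xs) with P? x
    ... | yes _ = ∈-++⁺ʳ (sublists xs) (∈-map⁺ (x ∷_) (filter∈sublists P? xs))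
    ... | no  _ = ∈-++⁺ˡ (filter∈sublists P? xs)

    self∈sublists : (xs : List A) → xs ∈ sublists xs
    self∈sublists []       = here refl
    self∈sublists (x ∷ xs) = ∈-++⁺ʳ (sublists xs) (∈-map⁺ (x ∷_) (self∈sublists xs))

    ∈sublists⇒⊆ : (xs : List A) {ys : List A} → ys ∈ sublists xs → ys ⊆ xs
    ∈sublists⇒⊆ []       (here refl) = id
    ∈sublists⇒⊆ (x ∷ xs) ys∈ with ∈-++⁻ (sublists xs) ys∈
    ... | inj₁ p = there ∘ ∈sublists⇒⊆ xs p
    ... | inj₂ p with ∈-map⁻ (x ∷_) p
    ...   | zs , zs∈ , refl = λ { (here refl) → here refl ; (there q) → there (∈sublists⇒⊆ xs zs∈ q) }

    sublists-trans : (xs : List A) {ys zs : List A} → ys ∈ sublists xs → zs ∈ sublists ys → zs ∈ sublists xs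
    sublists-trans []       (here refl) zs∈ = zs∈
    sublists-trans (x ∷ xs) ys∈ zs∈ with ∈-++⁻ (sublists xs) ys∈
    ... | inj₁ p = ∈-++⁺ˡ (sublists-trans xs p zs∈)
    ... | inj₂ p with ∈-map⁻ (x ∷_) p
    ...   | ws , ws∈ , refl with ∈-++⁻ (sublists ws) zs∈
    ...     | inj₁ q = ∈-++⁺ˡ (sublists-trans xs ws∈ q)
    ...     | inj₂ q with ∈-map⁻ (x ∷_) q
    ...       | vs , vs∈ , refl = ∈-++⁺ʳ (sublists xs) (∈-map⁺ (x ∷_) (sublists-trans xs ws∈ vs∈))

  -- The pigeonhole principle: each `f u` uses up one entry of `vs`, and injectivity keeps the later
  -- values away from the entry removed.
  length-inj : {U V : Set} (us : List U) (vs : List V) (f : U → V) → Unique us →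
               (∀ {u} → u ∈ us → f u ∈ vs) →
               (∀ {u v} → u ∈ us → v ∈ us → f u ≡ f v → u ≡ v) →
               length us ≤ length vs
  length-inj []       vs f _ _ _ = z≤n
  length-inj (u ∷ us) vs f (u∉ ∷ uniq) into inj with ∈⇒↭ (into (here refl))
  ... | vs′ , vs↭ = subst (suc (length us) ≤_) (sym (↭-length vs↭))
        (s≤s (length-inj us vs′ f uniq into′ (λ p q → inj (there p) (there q))))
    where
    into′ : ∀ {v} → v ∈ us → f v ∈ vs′
    into′ v∈ with ∈-resp-↭ vs↭ (into (there v∈))
    ... | here eq = contradiction (inj (here refl) (there v∈) (sym eq)) (All.lookup u∉ v∈)
    ... | there p = p

  -- The step of the induction on the number of fibres that proves Cauchy–Schwarz.
  private
    square-step : ∀ k l m c → l * l ≤ m * c → (k + l) * (k + l) ≤ suc m * (k * k + c)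
    square-step k zero    m       c _ = begin
      (k + 0) * (k + 0)        ≡⟨ cong (λ z → z * z) (+-identityʳ k) ⟩
      k * k                    ≤⟨ m≤m+n (k * k) c ⟩
      k * k + c                ≤⟨ m≤m+n _ _ ⟩
      suc m * (k * k + c)      ∎
      where open ≤-Reasoning
    square-step k (suc l) zero    c ()
    square-step k l@(suc _) m@(suc _) c h = begin
      (k + l) * (k + l)                      ≡⟨ expand k l ⟩
      k * k + l * l + 2 * (k * l)            ≤⟨ +-mono-≤ (+-monoʳ-≤ (k * k) h) cross ⟩
      k * k + m * c + (m * (k * k) + c)      ≡⟨ collect k m c ⟩
      suc m * (k * k + c)                    ∎
      where
      open ≤-Reasoning
      expand : ∀ k l → (k + l) * (k + l) ≡ k * k + l * l + 2 * (k * l)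
      expand = solve-∀
      collect : ∀ k m c → k * k + m * c + (m * (k * k) + c) ≡ suc m * (k * k + c)
      collect = solve-∀
      2ab≤a²+b² : ∀ a b → 2 * (a * b) ≤ a * a + b * b
      2ab≤a²+b² a b with ≤-total a b
      ... | inj₁ a≤b with d , refl ← m≤n⇒∃[o]m+o≡n a≤b = subst₂ _≤_ refl (sym (eq a d)) (m≤m+n _ (d * d))
        where
        eq : ∀ a d → a * a + (a + d) * (a + d) ≡ 2 * (a * (a + d)) + d * d
        eq = solve-∀
      ... | inj₂ b≤a with d , refl ← m≤n⇒∃[o]m+o≡n b≤a = subst₂ _≤_ refl (sym (eq b d)) (m≤m+n _ (d * d))
        where
        eq : ∀ b d → (b + d) * (b + d) + b * b ≡ 2 * ((b + d) * b) + d * d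
        eq = solve-∀
      cross : 2 * (k * l) ≤ m * (k * k) + c
      cross = *-cancelˡ-≤ m (begin
        m * (2 * (k * l))               ≡⟨ e₁ m k l ⟩
        2 * ((m * k) * l)               ≤⟨ 2ab≤a²+b² (m * k) l ⟩
        (m * k) * (m * k) + l * l       ≤⟨ +-monoʳ-≤ _ h ⟩
        (m * k) * (m * k) + m * c       ≡⟨ e₂ m k c ⟩
        m * (m * (k * k) + c)           ∎)
        where
        e₁ : ∀ m k l → m * (2 * (k * l)) ≡ 2 * ((m * k) * l)
        e₁ = solve-∀
        e₂ : ∀ m k c → (m * k) * (m * k) + m * c ≡ m * (m * (k * k) + c)
        e₂ = solve-∀

  module Fibres {A B : Set} (_≟_ : DecidableEquality B) (f : A → B) where

    fibre : List A → B → List A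
    fibre xs y = filter (λ x → f x ≟ y) xs

    private
      hits : A → B → ℕ
      hits x y = [ f x ≟ y ]ᵈ

      hits-total : ∀ xs ys → ∑ ys (λ y → length (fibre xs y)) ≡ ∑ xs (λ x → ∑ ys (hits x))
      hits-total xs ys = trans (cong sum (map-cong′ ys)) (∑-swap ys xs (λ y x → hits x y))
        where
        map-cong′ : ∀ ys → map (λ y → length (fibre xs y)) ys ≡ map (λ y → ∑ xs (λ x → hits x y)) ys
        map-cong′ []       = refl
        map-cong′ (y ∷ ys) = cong₂ _∷_ (length-filter-∑ (λ x → f x ≟ y) xs) (map-cong′ ys)

      hits-≥1 : ∀ x ys → f x ∈ ys → 1 ≤ ∑ ys (hits x)
      hits-≥1 x (y ∷ ys) fx∈ with f x ≟ y | fx∈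
      ... | yes _  | _ = s≤s z≤n
      ... | no neq | here eq = contradiction eq neq
      ... | no _   | there p = hits-≥1 x ys p

      hits-0 : ∀ x ys → f x ∉ ys → ∑ ys (hits x) ≡ 0
      hits-0 x []       _ = refl
      hits-0 x (y ∷ ys) fx∉ with f x ≟ y
      ... | yes eq = contradiction (here eq) fx∉
      ... | no _   = hits-0 x ys (fx∉ ∘ there)

      hits-≤1 : ∀ x ys → Unique ys → ∑ ys (hits x) ≤ 1
      hits-≤1 x []       _ = z≤n
      hits-≤1 x (y ∷ ys) (y∉ ∷ uniq) with f x ≟ y
      ... | yes refl = s≤s (≤-reflexive (hits-0 x ys (λ p → All.lookup y∉ p refl)))
      ... | no _     = hits-≤1 x ys uniq

    ∑-fibres-≤ : ∀ xs ys → Unique ys → ∑ ys (λ y → length (fibre xs y)) ≤ length xs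
    ∑-fibres-≤ xs ys uniq = begin
      ∑ ys (λ y → length (fibre xs y))   ≡⟨ hits-total xs ys ⟩
      ∑ xs (λ x → ∑ ys (hits x))         ≤⟨ ∑-mono xs (λ {x} _ → hits-≤1 x ys uniq) ⟩
      ∑ xs (λ _ → 1)                     ≡⟨ trans (∑-const xs 1) (*-identityʳ _) ⟩
      length xs                          ∎
      where open ≤-Reasoning

    ∑-fibres-≥ : ∀ xs ys → (∀ {x} → x ∈ xs → f x ∈ ys) → length xs ≤ ∑ ys (λ y → length (fibre xs y))
    ∑-fibres-≥ xs ys into = begin
      length xs                          ≡⟨ sym (trans (∑-const xs 1) (*-identityʳ _)) ⟩
      ∑ xs (λ _ → 1)                     ≤⟨ ∑-mono xs (λ {x} x∈ → hits-≥1 x ys (into x∈)) ⟩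
      ∑ xs (λ x → ∑ ys (hits x))         ≡⟨ sym (hits-total xs ys) ⟩
      ∑ ys (λ y → length (fibre xs y))   ∎
      where open ≤-Reasoning

    large-fibre : ∀ {y₀} xs ys → y₀ ∈ ys → (∀ {x} → x ∈ xs → f x ∈ ys) →
                  ∃ λ y → y ∈ ys × length xs ≤ length ys * length (fibre xs y)
    large-fibre xs ys y₀∈ into with max-≥-average ys (λ y → length (fibre xs y)) y₀∈
    ... | y , y∈ , h = y , y∈ , ≤-trans (∑-fibres-≥ xs ys into) h

    small-fibre : ∀ {y₀} xs ys → y₀ ∈ ys → Unique ys →
                  ∃ λ y → y ∈ ys × length ys * length (fibre xs y) ≤ length xs
    small-fibre xs ys y₀∈ uniq with min-≤-average ys (λ y → length (fibre xs y)) y₀∈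
    ... | y , y∈ , h = y , y∈ , ≤-trans h (∑-fibres-≤ xs ys uniq)

    fibres-bound : ∀ xs ys c m → (∀ {x} → x ∈ xs → f x ∈ ys) →
                   (∀ {y} → y ∈ ys → c * length (fibre xs y) ≤ m) → c * length xs ≤ length ys * m
    fibres-bound xs ys c m into h = begin
      c * length xs                                ≤⟨ *-monoʳ-≤ c (∑-fibres-≥ xs ys into) ⟩
      c * ∑ ys (λ y → length (fibre xs y))         ≡⟨ sym (∑-*ˡ ys c _) ⟩
      ∑ ys (λ y → c * length (fibre xs y))         ≤⟨ ∑-mono ys h ⟩
      ∑ ys (λ _ → m)                               ≡⟨ ∑-const ys m ⟩
      length ys * m                                ∎
      where open ≤-Reasoning

    Collide : A × A → Set
    Collide (x , y) = f x ≡ f y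

    collide? : Decidable Collide
    collide? (x , y) = f x ≟ f y

    collisions : List A → List (A × A)
    collisions xs = filter collide? (cartesianProduct xs xs)

    -- The fibre over one value `y`, of size `k`, contributes `k * k` collisions, disjoint from the
    -- collisions among the points outside it; the latter are handled by induction on the list of
    -- values.
    cauchy-schwarz : ∀ xs ys → Unique xs → (∀ {x} → x ∈ xs → f x ∈ ys) →
                     length xs * length xs ≤ length ys * length (collisions xs)
    cauchy-schwarz []         []       _    _    = z≤n
    cauchy-schwarz (x ∷ _)    []       _    into with () ← into (here refl)
    cauchy-schwarz xs         (y ∷ ys) uniq into = begin
      length xs * length xs                      ≡⟨ cong (λ z → z * z) (sym (length-filter-split P? xs)) ⟩
      (k + l) * (k + l)                          ≤⟨ square-step k l (length ys) (length (collisions xs′)) IH ⟩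
      suc (length ys) * (k * k + length (collisions xs′))
                                                 ≤⟨ *-monoʳ-≤ (suc (length ys)) count ⟩
      suc (length ys) * length (collisions xs)   ∎
      where
      open ≤-Reasoning
      P? : Decidable (λ x → f x ≡ y)
      P? = λ x → f x ≟ y
      F = filter P? xs
      xs′ = filter (¬? ∘ P?) xs
      k = length F
      l = length xs′
      into′ : ∀ {x} → x ∈ xs′ → f x ∈ ys
      into′ x∈ with ∈-filter⁻ (¬? ∘ P?) {xs = xs} x∈
      ... | x∈xs , ¬p with into x∈xs
      ...   | here p  = contradiction p ¬p
      ...   | there p = p
      IH : l * l ≤ length ys * length (collisions xs′)
      IH = cauchy-schwarz xs′ ys (Unique.filter⁺ (¬? ∘ P?) uniq) into′
      both : List (A × A)
      both = cartesianProduct F F ++ collisions xs′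
      F⁻ : ∀ {x} → x ∈ F → x ∈ xs × f x ≡ y
      F⁻ = ∈-filter⁻ P? {xs = xs}
      xs′⁻ : ∀ {x} → x ∈ xs′ → x ∈ xs × ¬ f x ≡ y
      xs′⁻ = ∈-filter⁻ (¬? ∘ P?) {xs = xs}
      coll⁻ : ∀ {p} → p ∈ collisions xs′ → p ∈ cartesianProduct xs′ xs′ × Collide p
      coll⁻ = ∈-filter⁻ collide? {xs = cartesianProduct xs′ xs′}
      both-unique : Unique both
      both-unique = Unique.++⁺
        (Unique.cartesianProduct⁺ (Unique.filter⁺ P? uniq) (Unique.filter⁺ P? uniq))
        (Unique.filter⁺ collide? (Unique.cartesianProduct⁺ (Unique.filter⁺ (¬? ∘ P?) uniq) (Unique.filter⁺ (¬? ∘ P?) uniq)))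
        (λ { (p , q) → proj₂ (xs′⁻ (proj₁ (∈-cartesianProduct⁻ xs′ xs′ (proj₁ (coll⁻ q)))))
                             (proj₂ (F⁻ (proj₁ (∈-cartesianProduct⁻ F F p)))) })
      both⊆ : ∀ {p} → p ∈ both → p ∈ collisions xs
      both⊆ {u , v} p∈ with ∈-++⁻ (cartesianProduct F F) p∈
      ... | inj₁ p with ∈-cartesianProduct⁻ F F p
      ...   | u∈ , v∈ = ∈-filter⁺ collide? (∈-cartesianProduct⁺ (proj₁ (F⁻ u∈)) (proj₁ (F⁻ v∈)))
                          (trans (proj₂ (F⁻ u∈)) (sym (proj₂ (F⁻ v∈))))
      both⊆ {u , v} p∈ | inj₂ q with coll⁻ q
      ...   | uv∈ , eq with ∈-cartesianProduct⁻ xs′ xs′ uv∈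
      ...     | u∈ , v∈ = ∈-filter⁺ collide? (∈-cartesianProduct⁺ (proj₁ (xs′⁻ u∈)) (proj₁ (xs′⁻ v∈))) eq
      count : k * k + length (collisions xs′) ≤ length (collisions xs)
      count = begin
        k * k + length (collisions xs′)                           ≡⟨ cong (_+ length (collisions xs′)) (sym (length-× F F)) ⟩
        length (cartesianProduct F F) + length (collisions xs′)   ≡⟨ sym (length-++ (cartesianProduct F F)) ⟩
        length both                                               ≤⟨ length-inj both (collisions xs) id both-unique both⊆ (λ _ _ → id) ⟩
        length (collisions xs)                                    ∎

  module Cardinality {A : Set} (_≟_ : DecidableEquality A) where

    open DecMem _≟_ public using (_∈?_)

    opaque
      set : List A → List A
      set = deduplicate _≟_

      set-unique : ∀ xs → Unique (set xs)
      set-unique = DecUnique.deduplicate-! _≟_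

      ∈-set⁺ : ∀ {x xs} → x ∈ xs → x ∈ set xs
      ∈-set⁺ = ∈-deduplicate⁺ _≟_

      ∈-set⁻ : ∀ {x} xs → x ∈ set xs → x ∈ xs
      ∈-set⁻ xs = ∈-deduplicate⁻ _≟_ xs

    -- Lists stand for finite sets: only distinct entries count, so inclusions between lists give
    -- inequalities.
    card : List A → ℕ
    card xs = length (set xs)

    length≤card : {U : Set} (us : List U) (ys : List A) (f : U → A) → Unique us →
                  (∀ {u} → u ∈ us → f u ∈ ys) →
                  (∀ {u v} → u ∈ us → v ∈ us → f u ≡ f v → u ≡ v) → length us ≤ card ys
    length≤card us ys f uniq into inj = length-inj us (set ys) f uniq (∈-set⁺ ∘ into) inj

    card≤length : ∀ xs ys → xs ⊆ ys → card xs ≤ length ys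
    card≤length xs ys xs⊆ys = length-inj (set xs) ys id (set-unique xs) (xs⊆ys ∘ ∈-set⁻ xs) (λ _ _ → id)

    card-unique : ∀ {xs} → Unique xs → card xs ≡ length xs
    card-unique {xs} uniq = ≤-antisym (card≤length xs xs id) (length≤card xs xs id uniq id (λ _ _ → id))

    card-mono : ∀ {xs ys} → xs ⊆ ys → card xs ≤ card ys
    card-mono {xs} {ys} xs⊆ys = card≤length xs (set ys) (∈-set⁺ ∘ xs⊆ys)

    card-++ : ∀ xs ys → card (xs ++ ys) ≤ card xs + card ys
    card-++ xs ys = subst (card (xs ++ ys) ≤_) (length-++ (set xs))
      (card≤length (xs ++ ys) (set xs ++ set ys) sub)
      where
      sub : xs ++ ys ⊆ set xs ++ set ys
      sub z∈ with ∈-++⁻ xs z∈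
      ... | inj₁ p = ∈-++⁺ˡ (∈-set⁺ p)
      ... | inj₂ p = ∈-++⁺ʳ (set xs) (∈-set⁺ p)

    card-disjoint : ∀ xs ys zs → (∀ {z} → z ∈ xs → z ∉ ys) → xs ⊆ zs → ys ⊆ zs → card xs + card ys ≤ card zs
    card-disjoint xs ys zs disj xs⊆ ys⊆ = subst (_≤ card zs) (length-++ (set xs))
      (length≤card (set xs ++ set ys) zs id
        (Unique.++⁺ (set-unique xs) (set-unique ys) (λ { (p , q) → disj (∈-set⁻ xs p) (∈-set⁻ ys q) }))
        sub (λ _ _ → id))
      where
      sub : set xs ++ set ys ⊆ zs
      sub z∈ with ∈-++⁻ (set xs) z∈
      ... | inj₁ p = xs⊆ (∈-set⁻ xs p)
      ... | inj₂ p = ys⊆ (∈-set⁻ ys p)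

    card>0 : ∀ {x xs} → x ∈ xs → 0 < card xs
    card>0 x∈ = ∈-length (∈-set⁺ x∈)

    -- A missed point and the image, which is as large as `xs`, would be disjoint subsets of `xs`.
    surjective-on : ∀ (xs : List A) (f : A → A) → (∀ {x} → x ∈ xs → f x ∈ xs) →
                    (∀ {x y} → f x ≡ f y → x ≡ y) → ∀ {y} → y ∈ xs → ∃ λ x → x ∈ xs × f x ≡ y
    surjective-on xs f into inj {y} y∈ with any? (λ x → f x ≟ y) xs
    ... | yes p = find p
    ... | no ¬p = contradiction
          (≤-trans (+-mono-≤ (card>0 {xs = y ∷ []} (here refl)) (length≤card (set xs) (map f xs) f (set-unique xs) (∈-map⁺ f ∘ ∈-set⁻ xs) (λ _ _ → inj)))
                   (card-disjoint (y ∷ []) (map f xs) xs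
                      (λ { (here refl) q → let (x , x∈ , eq) = ∈-map⁻ f q in ¬p (lose x∈ (sym eq)) })
                      (λ { (here refl) → y∈ })
                      (λ q → let (x , x∈ , eq) = ∈-map⁻ f q in subst (_∈ xs) (sym eq) (into x∈))))
          (<-irrefl refl)

open Counting

-- Subgraphs of large minimum degree

module Pruning where
  open import Data.Nat using (_+_; _*_; _^_; _<?_)
  open import Data.Nat.Properties

  module MinimumDegree {V : Set} (r : V → V → ℕ) (r-sym : ∀ v w → r v w ≡ r w v) (τ : ℕ) where

    deg : List V → V → ℕ
    deg Z w = ∑ Z (r w)

    -- Deleting a vertex v with 4 deg_W v < τ ≤ deg_W v + deg_Z v lowers the number of W–Z edges by at
    -- least τ / 2, so the initial number of such edges bounds the number of deletions.
    prune : ∀ k W Z → length W ≤ k → (∀ {w} → w ∈ W → τ ≤ deg W w + deg Z w) →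
            ∃ λ D → ∃ λ W′ → W ↭ D ++ W′ × (∀ {w} → w ∈ W′ → τ ≤ 4 * deg W′ w) ×
            τ * length D ≤ 2 * ∑ W (deg Z)
    prune k W Z len h with any? (λ w → 4 * deg W w <? τ) W
    ... | no ¬p = [] , W , ↭-refl , (λ w∈ → ≮⇒≥ (λ lt → ¬p (lose w∈ lt))) , ≤-trans (≤-reflexive (*-zeroʳ τ)) z≤n
    ... | yes p with find p
    ...   | v , v∈ , low with ∈⇒↭ v∈
    prune zero    (_ ∷ _) Z () h | yes p | v , v∈ , low | W⁻ , W↭
    prune (suc k) W       Z len h | yes p | v , v∈ , low | W⁻ , W↭
      with prune k W⁻ (v ∷ Z) (≤-pred (subst (_≤ suc k) (↭-length W↭) len)) h⁻
      where
      -- The deleted vertex joins `Z`, so the total degree of every survivor into the two sets is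
      -- unchanged.
      h⁻ : ∀ {w} → w ∈ W⁻ → τ ≤ deg W⁻ w + deg (v ∷ Z) w
      h⁻ {w} w∈ = subst (τ ≤_)
        (trans (cong (_+ deg Z w) (∑-↭ (r w) W↭)) (shuffle (r w v) (deg W⁻ w) (deg Z w)))
        (h (∈-resp-↭ (↭-sym W↭) (there w∈)))
        where
        shuffle : ∀ a b c → (a + b) + c ≡ b + (a + c)
        shuffle = solve-∀
    ... | D , W′ , W⁻↭ , good , few = v ∷ D , W′ , ↭-trans W↭ (prep v W⁻↭) , good , few′
      where
      open ≤-Reasoning
      a = deg W⁻ v
      b = deg W v
      c = deg Z v
      e = ∑ W⁻ (deg Z)
      a≤b : a ≤ b
      a≤b = subst (a ≤_) (sym (∑-↭ (r v) W↭)) (m≤n+m a (r v v))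
      drop : τ + 2 * a ≤ 2 * c
      drop = +-cancelʳ-≤ (2 * b) _ _ (begin
        τ + 2 * a + 2 * b      ≤⟨ +-monoˡ-≤ (2 * b) (+-monoʳ-≤ τ (*-monoʳ-≤ 2 a≤b)) ⟩
        τ + 2 * b + 2 * b      ≡⟨ e₁ τ b ⟩
        τ + 4 * b              ≤⟨ +-monoʳ-≤ τ (<⇒≤ low) ⟩
        τ + τ                  ≡⟨ e₂ τ ⟩
        2 * τ                  ≤⟨ *-monoʳ-≤ 2 (h v∈) ⟩
        2 * (b + c)            ≡⟨ e₃ b c ⟩
        2 * c + 2 * b          ∎)
        where
        e₁ : ∀ τ b → τ + 2 * b + 2 * b ≡ τ + 4 * b
        e₁ = solve-∀
        e₂ : ∀ τ → τ + τ ≡ 2 * τ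
        e₂ = solve-∀
        e₃ : ∀ b c → 2 * (b + c) ≡ 2 * c + 2 * b
        e₃ = solve-∀
      edges : ∑ W⁻ (deg (v ∷ Z)) ≡ a + e
      edges = trans (∑-+ W⁻ (λ w → r w v) (deg Z)) (cong (_+ e) (cong-∑ W⁻))
        where
        cong-∑ : ∀ xs → ∑ xs (λ w → r w v) ≡ ∑ xs (r v)
        cong-∑ []       = refl
        cong-∑ (x ∷ xs) = cong₂ _+_ (r-sym x v) (cong-∑ xs)
      few′ : τ * suc (length D) ≤ 2 * ∑ W (deg Z)
      few′ = begin
        τ * suc (length D)                ≡⟨ *-suc τ (length D) ⟩
        τ + τ * length D                  ≤⟨ +-monoʳ-≤ τ few ⟩
        τ + 2 * ∑ W⁻ (deg (v ∷ Z))        ≡⟨ cong (λ z → τ + 2 * z) edges ⟩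
        τ + 2 * (a + e)                   ≡⟨ e₁ τ a e ⟩
        (τ + 2 * a) + 2 * e               ≤⟨ +-monoˡ-≤ (2 * e) drop ⟩
        2 * c + 2 * e                     ≡⟨ sym (*-distribˡ-+ 2 c e) ⟩
        2 * (c + e)                       ≡⟨ cong (2 *_) (sym (∑-↭ (deg Z) W↭)) ⟩
        2 * ∑ W (deg Z)                   ∎
        where
        e₁ : ∀ τ a e → τ + 2 * (a + e) ≡ (τ + 2 * a) + 2 * e
        e₁ = solve-∀

open Pruning

-- Fields with propositional equality, and a ring solver for them

record DecField : Set₁ where
  infixl 7 _*_
  infixl 6 _+_ _-_
  infix  8 -_
  field
    E                 : Set
    _+_ _*_           : E → E → E
    -_                : E → E
    0# 1#             : E
    isCommutativeRing : IsCommutativeRing _≡_ _+_ _*_ -_ 0# 1#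
    inv               : E → E
    inverse           : ∀ x → ¬ (x ≡ 0#) → x * inv x ≡ 1#
    1≢0               : ¬ (1# ≡ 0#)
    _≟_               : DecidableEquality E

  commutativeRing : CommutativeRing 0ℓ 0ℓ
  commutativeRing = record { isCommutativeRing = isCommutativeRing }

  open CommutativeRing commutativeRing public
    using (ring; semiring; +-abelianGroup; +-identityˡ; +-identityʳ; *-identityˡ; *-identityʳ; zeroˡ; zeroʳ; -‿inverseʳ; distribˡ; distribʳ; +-assoc; +-comm; *-comm; *-assoc)

  _-_ : E → E → E
  x - y = x + - y

-- The coefficient (m , n) stands for m − n.
module DifferenceSolver (F : DecField) where
  open DecField F
  open Algebra.Properties.Ring ring using (-‿distribˡ-*; -‿distribʳ-*; -0#≈0#)
  open Algebra.Properties.AbelianGroup +-abelianGroup using (⁻¹-∙-comm; ⁻¹-involutive)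
  open Algebra.Properties.Semiring.Mult semiring using (×-homo-+; ×1-homo-*) renaming (_×_ to _·_)

  private
    ⟦_⟧ : ℕ × ℕ → E
    ⟦ m , n ⟧ = m · 1# - n · 1#

    interchange : ∀ a b c d → (a + b) + (c + d) ≡ (a + c) + (b + d)
    interchange a b c d = begin
      (a + b) + (c + d)   ≡⟨ +-assoc a b _ ⟩
      a + (b + (c + d))   ≡⟨ cong (a +_) (sym (+-assoc b c d)) ⟩
      a + ((b + c) + d)   ≡⟨ cong (λ z → a + (z + d)) (+-comm b c) ⟩
      a + ((c + b) + d)   ≡⟨ cong (a +_) (+-assoc c b d) ⟩
      a + (c + (b + d))   ≡⟨ sym (+-assoc a c _) ⟩
      (a + c) + (b + d)   ∎
      where open ≡-Reasoning

    diff-+ : ∀ a b c d → (a + c) - (b + d) ≡ (a - b) + (c - d)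
    diff-+ a b c d = trans (cong ((a + c) +_) (sym (⁻¹-∙-comm b d))) (interchange a c (- b) (- d))

    diff-* : ∀ a b c d → (a * c + b * d) - (a * d + b * c) ≡ (a - b) * (c - d)
    diff-* a b c d = begin
      (a * c + b * d) - (a * d + b * c)                 ≡⟨ cong ((a * c + b * d) +_) (sym (⁻¹-∙-comm _ _)) ⟩
      (a * c + b * d) + (- (a * d) + - (b * c))         ≡⟨ interchange _ _ _ _ ⟩
      (a * c + - (a * d)) + (b * d + - (b * c))         ≡⟨ cong₂ _+_ (cong (a * c +_) (-‿distribʳ-* a d)) flip ⟩
      (a * c + a * - d) + (- b * c + - b * - d)         ≡⟨ cong₂ _+_ (sym (distribˡ a c (- d))) (sym (distribˡ (- b) c (- d))) ⟩
      a * (c - d) + - b * (c - d)                       ≡⟨ sym (distribʳ (c - d) a (- b)) ⟩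
      (a - b) * (c - d)                                 ∎
      where
      open ≡-Reasoning
      flip : b * d + - (b * c) ≡ - b * c + - b * - d
      flip = trans (+-comm _ _) (cong₂ _+_ (-‿distribˡ-* b c)
        (trans (sym (⁻¹-involutive (b * d))) (trans (cong -_ (-‿distribˡ-* b d)) (-‿distribʳ-* (- b) d))))

    coeff : RawRing 0ℓ 0ℓ
    coeff = record
      { Carrier = ℕ × ℕ ; _≈_ = _≡_
      ; _+_ = λ { (a , b) (c , d) → a ℕ.+ c , b ℕ.+ d }
      ; _*_ = λ { (a , b) (c , d) → a ℕ.* c ℕ.+ b ℕ.* d , a ℕ.* d ℕ.+ b ℕ.* c }
      ; -_ = λ { (a , b) → b , a }
      ; 0# = 0 , 0 ; 1# = 1 , 0 }

    homo-* : ∀ a b c d → (a ℕ.* c ℕ.+ b ℕ.* d) · 1# ≡ (a · 1#) * (c · 1#) + (b · 1#) * (d · 1#)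
    homo-* a b c d = trans (×-homo-+ 1# (a ℕ.* c) (b ℕ.* d)) (cong₂ _+_ (×1-homo-* a c) (×1-homo-* b d))

    morphism : coeff -Raw-AlmostCommutative⟶ fromCommutativeRing commutativeRing
    morphism = record
      { ⟦_⟧ = ⟦_⟧
      ; +-homo = λ { (a , b) (c , d) → trans (cong₂ _-_ (×-homo-+ 1# a c) (×-homo-+ 1# b d)) (diff-+ _ _ _ _) }
      ; *-homo = λ { (a , b) (c , d) → trans (cong₂ _-_ (homo-* a b c d) (homo-* a b d c)) (diff-* _ _ _ _) }
      ; -‿homo = λ { (a , b) → sym (trans (sym (⁻¹-∙-comm _ _)) (trans (cong (- (a · 1#) +_) (⁻¹-involutive _)) (+-comm _ _))) }
      ; 0-homo = -‿inverseʳ 0#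
      ; 1-homo = trans (cong₂ _+_ (+-identityʳ 1#) -0#≈0#) (+-identityʳ 1#)
      }

    -- Coefficients are compared as integers, by `a + d = c + b`. An equality of integers holds in
    -- every field, whatever its characteristic.
    equal? : (p q : ℕ × ℕ) → Maybe (⟦ p ⟧ ≡ ⟦ q ⟧)
    equal? (a , b) (c , d) with a ℕ.+ d ℕ.≟ c ℕ.+ b
    ... | no _ = nothing
    ... | yes eq = just (begin
      x - y                    ≡⟨ sym (+-identityʳ _) ⟩
      (x - y) + 0#             ≡⟨ cong ((x - y) +_) (sym (-‿inverseʳ w)) ⟩
      (x - y) + (w - w)        ≡⟨ sym (diff-+ x y w w) ⟩
      (x + w) - (y + w)        ≡⟨ cong₂ _-_ (trans (sym (×-homo-+ 1# a d)) (trans (cong (_· 1#) eq) (×-homo-+ 1# c b))) (+-comm y w) ⟩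
      (z + y) - (w + y)        ≡⟨ diff-+ z w y y ⟩
      (z - w) + (y - y)        ≡⟨ cong ((z - w) +_) (-‿inverseʳ y) ⟩
      (z - w) + 0#             ≡⟨ +-identityʳ _ ⟩
      z - w                    ∎)
      where
      open ≡-Reasoning
      x = a · 1#
      y = b · 1#
      z = c · 1#
      w = d · 1#

  open Algebra.Solver.Ring coeff (fromCommutativeRing commutativeRing) morphism equal? public
    using (solve; _:=_; _:+_; _:*_; _:-_; :-_)

-- Sumsets and Plünnecke inequalities

module Sumsets (F : DecField) where
  open DecField F
  open DifferenceSolver F
  open Cardinality _≟_

  inhabited : ∀ L → 0 < card L → ∃ λ z → z ∈ L
  inhabited L pos with set L in eq
  ... | []    with () ← pos
  ... | z ∷ _ = z , ∈-set⁻ L (subst (z ∈_) (sym eq) (here refl))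

  infixl 6 _⊞_
  opaque
    _⊞_ : List E → List E → List E
    _⊞_ = cartesianProductWith _+_

    ⊞⁺ : ∀ {X Y x y} → x ∈ X → y ∈ Y → x + y ∈ X ⊞ Y
    ⊞⁺ = ∈-cartesianProductWith⁺ _+_

    ⊞⁻ : ∀ X Y {z} → z ∈ X ⊞ Y → ∃ λ x → ∃ λ y → x ∈ X × y ∈ Y × z ≡ x + y
    ⊞⁻ X Y = ∈-cartesianProductWith⁻ _+_ X Y

  ⊞-mono : ∀ {X X′ Y Y′} → X ⊆ X′ → Y ⊆ Y′ → X ⊞ Y ⊆ X′ ⊞ Y′
  ⊞-mono {X} {Y = Y} p q z∈ with ⊞⁻ X Y z∈
  ... | x , y , x∈ , y∈ , refl = ⊞⁺ (p x∈) (q y∈)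

  +-injʳ : ∀ c {x y} → x + c ≡ y + c → x ≡ y
  +-injʳ c {x} {y} eq = trans (e x c) (trans (cong (_- c) eq) (sym (e y c)))
    where
    e : ∀ x c → x ≡ (x + c) - c
    e = solve 2 (λ x c → x := (x :+ c) :- c) refl

  +-injˡ : ∀ c {x y} → c + x ≡ c + y → x ≡ y
  +-injˡ c eq = +-injʳ c (trans (+-comm _ c) (trans eq (+-comm c _)))

  card-map : ∀ (f : E → E) xs → card (map f xs) ≤ card xs
  card-map f xs = subst (card (map f xs) ≤_) (length-map f (set xs)) (card≤length (map f xs) (map f (set xs)) sub)
    where
    sub : map f xs ⊆ map f (set xs)
    sub z∈ with ∈-map⁻ f z∈
    ... | x , x∈ , refl = ∈-map⁺ f (∈-set⁺ x∈)

  card-map-inj : ∀ (f : E → E) xs → (∀ {x y} → f x ≡ f y → x ≡ y) → card xs ≤ card (map f xs)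
  card-map-inj f xs inj = length≤card (set xs) (map f xs) f (set-unique xs) (∈-map⁺ f ∘ ∈-set⁻ xs) (λ _ _ → inj)

  -- Petridis: minimising a weighted sum of |Z + B₁| and |Z + B₂| relative to |Z| makes one minimiser serve
  -- two different summands at once.
  module Petridis (t₁ t₂ : ℕ) (B₁ B₂ : List E) where

    μ : List E → ℕ
    μ Z = t₁ ℕ.* card (Z ⊞ B₁) ℕ.+ t₂ ℕ.* card (Z ⊞ B₂)

    -- Minimality of `μ Z / card Z`, cross-multiplied. Subsets appear as filters, the form in which
    -- `growth` meets them.
    Minimal : List E → Set₁
    Minimal X = ∀ {P : Pred E 0ℓ} (P? : Decidable P) → μ X ℕ.* card (filter P? X) ≤ μ (filter P? X) ℕ.* card X

    minimal-subset : ∀ {a} A → a ∈ A →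
                     ∃ λ X → X ⊆ A × 0 < card X × Minimal X × μ X ℕ.* card A ≤ μ A ℕ.* card X
    minimal-subset A a∈ with argmin-ratio candidates μ card A∈ (proj₂ ∘ ∈-filter⁻ pos? {xs = sublists A})
      where
      pos? : Decidable (λ X → 0 < card X)
      pos? X = 0 ℕ.<? card X
      candidates = filter pos? (sublists A)
      A∈ : A ∈ candidates
      A∈ = ∈-filter⁺ pos? (self∈sublists A) (card>0 a∈)
    ... | X , X∈ , min with ∈-filter⁻ (λ X → 0 ℕ.<? card X) {xs = sublists A} X∈
    ...   | X∈A , X>0 = X , ∈sublists⇒⊆ A X∈A , X>0 , X-min , min A∈
      where
      pos? : Decidable (λ X → 0 < card X)
      pos? X = 0 ℕ.<? card X
      A∈ : A ∈ filter pos? (sublists A)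
      A∈ = ∈-filter⁺ pos? (self∈sublists A) (card>0 a∈)
      X-min : Minimal X
      X-min P? with pos? (filter P? X)
      ... | yes p = min (∈-filter⁺ pos? (sublists-trans A X∈A (filter∈sublists P? X)) p)
      -- An empty subset is not among the candidates, but it makes the left side zero.
      ... | no ¬p rewrite n≤0⇒n≡0 (≮⇒≥ ¬p) = ≤-trans (≤-reflexive (*-zeroʳ (μ X))) z≤n

    module _ (X C : List E) (c : E) where
      private
        inside? : Decidable (λ x → x + c ∈ X ⊞ C)
        inside? x = (x + c) ∈? (X ⊞ C)
        Z = filter inside? X
        Z̄ = filter (¬? ∘ inside?) X
        ⊞-there : ∀ {z} → z ∈ X ⊞ C → z ∈ X ⊞ (c ∷ C)
        ⊞-there = ⊞-mono {X} {X} id there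

      -- The points `x + c` with `x` outside `Z` are new and distinct, so the sumset grows by at
      -- least `|X| - |Z|`.
      card-⊞-∷ : card (X ⊞ C) ℕ.+ card X ≤ card (X ⊞ (c ∷ C)) ℕ.+ card Z
      card-⊞-∷ = begin
        card (X ⊞ C) ℕ.+ card X                                ≤⟨ +-monoʳ-≤ (card (X ⊞ C)) (≤-trans (card-mono X⊆) (card-++ Z Z̄)) ⟩
        card (X ⊞ C) ℕ.+ (card Z ℕ.+ card Z̄)                   ≡⟨ shuffle (card (X ⊞ C)) (card Z) (card Z̄) ⟩
        (card (X ⊞ C) ℕ.+ card Z̄) ℕ.+ card Z                   ≤⟨ +-monoˡ-≤ (card Z) (+-monoʳ-≤ (card (X ⊞ C)) (card-map-inj (_+ c) Z̄ (+-injʳ c))) ⟩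
        (card (X ⊞ C) ℕ.+ card (map (_+ c) Z̄)) ℕ.+ card Z      ≤⟨ +-monoˡ-≤ (card Z) (card-disjoint (X ⊞ C) (map (_+ c) Z̄) (X ⊞ (c ∷ C)) disj ⊞-there new) ⟩
        card (X ⊞ (c ∷ C)) ℕ.+ card Z                          ∎
        where
        open ≤-Reasoning
        shuffle : ∀ a b d → a ℕ.+ (b ℕ.+ d) ≡ (a ℕ.+ d) ℕ.+ b
        shuffle = solve-∀
        X⊆ : X ⊆ Z ++ Z̄
        X⊆ {x} x∈ with inside? x
        ... | yes p = ∈-++⁺ˡ (∈-filter⁺ inside? x∈ p)
        ... | no ¬p = ∈-++⁺ʳ Z (∈-filter⁺ (¬? ∘ inside?) x∈ ¬p)
        disj : ∀ {z} → z ∈ X ⊞ C → z ∉ map (_+ c) Z̄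
        disj z∈ q with ∈-map⁻ (_+ c) q
        ... | x , x∈ , refl = proj₂ (∈-filter⁻ (¬? ∘ inside?) {xs = X} x∈) z∈
        new : map (_+ c) Z̄ ⊆ X ⊞ (c ∷ C)
        new q with ∈-map⁻ (_+ c) q
        ... | x , x∈ , refl = ⊞⁺ (proj₁ (∈-filter⁻ (¬? ∘ inside?) {xs = X} x∈)) (here refl)

      -- If `x + b` lies in `Z + B`, say `x + b = z + b'`, then `x + c + b = (z + c) + b'` is
      -- already in `X + C + B`, because `z + c` is in `X + C`. Hence only a translate of `X + B`
      -- without `Z + B` can be new.
      card-⊞-∷-⊞ : ∀ B → card (X ⊞ (c ∷ C) ⊞ B) ℕ.+ card (Z ⊞ B) ≤ card (X ⊞ C ⊞ B) ℕ.+ card (X ⊞ B)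
      card-⊞-∷-⊞ B = begin
        card (X ⊞ (c ∷ C) ⊞ B) ℕ.+ card (Z ⊞ B)                       ≤⟨ +-monoˡ-≤ (card (Z ⊞ B)) (≤-trans (card-mono cover) (card-++ (X ⊞ C ⊞ B) (map (_+ c) D))) ⟩
        (card (X ⊞ C ⊞ B) ℕ.+ card (map (_+ c) D)) ℕ.+ card (Z ⊞ B)   ≤⟨ +-monoˡ-≤ (card (Z ⊞ B)) (+-monoʳ-≤ (card (X ⊞ C ⊞ B)) (card-map (_+ c) D)) ⟩
        (card (X ⊞ C ⊞ B) ℕ.+ card D) ℕ.+ card (Z ⊞ B)                ≡⟨ ℕ.+-assoc (card (X ⊞ C ⊞ B)) (card D) (card (Z ⊞ B)) ⟩
        card (X ⊞ C ⊞ B) ℕ.+ (card D ℕ.+ card (Z ⊞ B))                ≤⟨ +-monoʳ-≤ (card (X ⊞ C ⊞ B)) (card-disjoint D (Z ⊞ B) (X ⊞ B) (proj₂ ∘ D⁻) (proj₁ ∘ D⁻) (⊞-mono {Z} {X} (λ z∈ → proj₁ (∈-filter⁻ inside? {xs = X} z∈)) id)) ⟩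
        card (X ⊞ C ⊞ B) ℕ.+ card (X ⊞ B)                             ∎
        where
        open ≤-Reasoning
        out? : Decidable (λ z → z ∉ Z ⊞ B)
        out? z = ¬? (z ∈? (Z ⊞ B))
        D = filter out? (X ⊞ B)
        D⁻ : ∀ {z} → z ∈ D → z ∈ X ⊞ B × z ∉ Z ⊞ B
        D⁻ = ∈-filter⁻ out? {xs = X ⊞ B}
        swap : ∀ x b c → (x + b) + c ≡ (x + c) + b
        swap = solve 3 (λ x b c → (x :+ b) :+ c := (x :+ c) :+ b) refl
        cover : X ⊞ (c ∷ C) ⊞ B ⊆ (X ⊞ C ⊞ B) ++ map (_+ c) D
        cover z∈ with ⊞⁻ (X ⊞ (c ∷ C)) B z∈
        ... | y , b , y∈ , b∈ , refl with ⊞⁻ X (c ∷ C) y∈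
        ...   | x , d , x∈ , there d∈ , refl = ∈-++⁺ˡ (⊞⁺ (⊞⁺ x∈ d∈) b∈)
        ...   | x , d , x∈ , here refl , refl with (x + b) ∈? (Z ⊞ B)
        ...     | no ¬p = ∈-++⁺ʳ (X ⊞ C ⊞ B) (subst (_∈ map (_+ c) D) (swap x b c) (∈-map⁺ (_+ c) (∈-filter⁺ out? (⊞⁺ x∈ b∈) ¬p)))
        ...     | yes p with ⊞⁻ Z B p
        ...       | z , b′ , z∈ , b′∈ , eq = ∈-++⁺ˡ (subst (_∈ X ⊞ C ⊞ B)
                      (trans (swap z c b′) (trans (cong (_+ c) (sym eq)) (swap x b c)))
                      (⊞⁺ (proj₂ (∈-filter⁻ inside? {xs = X} z∈)) b′∈))

    -- When `c` joins `C`, the left side grows by at most `card X` times `μ X - μ Z`, and the right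
    -- side by at least `μ X` times `card X - card Z`. Minimality of `X` against `Z` says exactly
    -- that the former is at most the latter.
    growth : ∀ X → Minimal X → ∀ C → card X ℕ.* μ (X ⊞ C) ≤ μ X ℕ.* card (X ⊞ C)
    growth X min [] = ≤-trans (≤-reflexive (trans (cong (card X ℕ.*_) μ≡0) (*-zeroʳ (card X)))) z≤n
      where
      empty : ∀ {z} → z ∉ X ⊞ []
      empty z∈ with _ , _ , _ , () , _ ← ⊞⁻ X [] z∈
      none : ∀ B → card (X ⊞ [] ⊞ B) ≡ 0
      none B = n≤0⇒n≡0 (card≤length (X ⊞ [] ⊞ B) [] (λ z∈ → let (_ , _ , y∈ , _) = ⊞⁻ (X ⊞ []) B z∈ in contradiction y∈ empty))
      μ≡0 : μ (X ⊞ []) ≡ 0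
      μ≡0 = cong₂ ℕ._+_ (trans (cong (t₁ ℕ.*_) (none B₁)) (*-zeroʳ t₁)) (trans (cong (t₂ ℕ.*_) (none B₂)) (*-zeroʳ t₂))
    growth X min (c ∷ C) = +-cancelʳ-≤ (card X ℕ.* μ Z) _ _ (begin
      card X ℕ.* μ (X ⊞ (c ∷ C)) ℕ.+ card X ℕ.* μ Z      ≡⟨ sym (ℕ.*-distribˡ-+ (card X) (μ (X ⊞ (c ∷ C))) (μ Z)) ⟩
      card X ℕ.* (μ (X ⊞ (c ∷ C)) ℕ.+ μ Z)               ≤⟨ *-monoʳ-≤ (card X) μ-step ⟩
      card X ℕ.* (μ (X ⊞ C) ℕ.+ μ X)                     ≡⟨ e₁ (card X) (μ (X ⊞ C)) (μ X) ⟩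
      card X ℕ.* μ (X ⊞ C) ℕ.+ μ X ℕ.* card X            ≤⟨ +-monoˡ-≤ (μ X ℕ.* card X) (growth X min C) ⟩
      μ X ℕ.* card (X ⊞ C) ℕ.+ μ X ℕ.* card X            ≡⟨ sym (ℕ.*-distribˡ-+ (μ X) (card (X ⊞ C)) (card X)) ⟩
      μ X ℕ.* (card (X ⊞ C) ℕ.+ card X)                  ≤⟨ *-monoʳ-≤ (μ X) (card-⊞-∷ X C c) ⟩
      μ X ℕ.* (card (X ⊞ (c ∷ C)) ℕ.+ card Z)            ≡⟨ ℕ.*-distribˡ-+ (μ X) (card (X ⊞ (c ∷ C))) (card Z) ⟩
      μ X ℕ.* card (X ⊞ (c ∷ C)) ℕ.+ μ X ℕ.* card Z      ≤⟨ +-monoʳ-≤ (μ X ℕ.* card (X ⊞ (c ∷ C))) (min inside?) ⟩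
      μ X ℕ.* card (X ⊞ (c ∷ C)) ℕ.+ μ Z ℕ.* card X      ≡⟨ cong (μ X ℕ.* card (X ⊞ (c ∷ C)) ℕ.+_) (ℕ.*-comm (μ Z) (card X)) ⟩
      μ X ℕ.* card (X ⊞ (c ∷ C)) ℕ.+ card X ℕ.* μ Z      ∎)
      where
      open ≤-Reasoning
      inside? : Decidable (λ x → x + c ∈ X ⊞ C)
      inside? x = (x + c) ∈? (X ⊞ C)
      Z = filter inside? X
      e₁ : ∀ a b d → a ℕ.* (b ℕ.+ d) ≡ a ℕ.* b ℕ.+ d ℕ.* a
      e₁ = solve-∀
      e₂ : ∀ t₁ t₂ a b c d → (t₁ ℕ.* a ℕ.+ t₂ ℕ.* b) ℕ.+ (t₁ ℕ.* c ℕ.+ t₂ ℕ.* d) ≡ t₁ ℕ.* (a ℕ.+ c) ℕ.+ t₂ ℕ.* (b ℕ.+ d)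
      e₂ = solve-∀
      μ-step : μ (X ⊞ (c ∷ C)) ℕ.+ μ Z ≤ μ (X ⊞ C) ℕ.+ μ X
      μ-step = begin
        μ (X ⊞ (c ∷ C)) ℕ.+ μ Z     ≡⟨ e₂ t₁ t₂ _ _ _ _ ⟩
        _                           ≤⟨ +-mono-≤ (*-monoʳ-≤ t₁ (card-⊞-∷-⊞ X C c B₁)) (*-monoʳ-≤ t₂ (card-⊞-∷-⊞ X C c B₂)) ⟩
        _                           ≡⟨ sym (e₂ t₁ t₂ (card (X ⊞ C ⊞ B₁)) (card (X ⊞ C ⊞ B₂)) _ _) ⟩
        μ (X ⊞ C) ℕ.+ μ X           ∎

  -- The weights are crossed so that both terms of `μ A` equal `|A + B₁||A + B₂|`. The minimiser
  -- then satisfies `|X + Bᵢ| / |X| ≤ 2 |A + Bᵢ| / |A|` for both summands, and `growth` combines the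
  -- two; the constant 4 is the square of this 2.
  plünnecke₂ : ∀ {a b₁ b₂} A B₁ B₂ → a ∈ A → b₁ ∈ B₁ → b₂ ∈ B₂ →
               ∃ λ X → X ⊆ A × 0 < card X ×
               card (X ⊞ B₂ ⊞ B₁) ℕ.* (card A ℕ.* card A) ≤ 4 ℕ.* (card (A ⊞ B₁) ℕ.* card (A ⊞ B₂)) ℕ.* card X
  plünnecke₂ A B₁ B₂ a∈ b₁∈ b₂∈ with Petridis.minimal-subset (card (A ⊞ B₂)) (card (A ⊞ B₁)) B₁ B₂ A a∈
  ... | X , X⊆A , X>0 , min , small = X , X⊆A , X>0 ,
      *-cancelʳ-≤ _ _ (x ℕ.* (u ℕ.* v)) {{m*n≢0 x (u ℕ.* v) {{>-nonZero X>0}} {{m*n≢0 u v {{>-nonZero (card>0 (⊞⁺ a∈ b₁∈))}} {{>-nonZero (card>0 (⊞⁺ a∈ b₂∈))}}}}}} (begin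
      y ℕ.* (a ℕ.* a) ℕ.* (x ℕ.* (u ℕ.* v))           ≡⟨ e₁ y a x u v ⟩
      u ℕ.* (x ℕ.* (v ℕ.* y)) ℕ.* (a ℕ.* a)           ≤⟨ *-monoˡ-≤ (a ℕ.* a) (*-monoʳ-≤ u (≤-trans (*-monoʳ-≤ x (m≤m+n (v ℕ.* y) _)) (growth X min B₂))) ⟩
      u ℕ.* (m ℕ.* w) ℕ.* (a ℕ.* a)                   ≡⟨ e₂ u m w a ⟩
      (m ℕ.* a) ℕ.* ((u ℕ.* w) ℕ.* a)                 ≤⟨ *-monoʳ-≤ (m ℕ.* a) (*-monoˡ-≤ a (m≤n+m (u ℕ.* w) (v ℕ.* card (X ⊞ B₁)))) ⟩
      (m ℕ.* a) ℕ.* (m ℕ.* a)                         ≤⟨ *-mono-≤ small small ⟩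
      (v ℕ.* u ℕ.+ u ℕ.* v) ℕ.* x ℕ.* ((v ℕ.* u ℕ.+ u ℕ.* v) ℕ.* x) ≡⟨ e₃ u v x ⟩
      4 ℕ.* (u ℕ.* v) ℕ.* x ℕ.* (x ℕ.* (u ℕ.* v))     ∎)
    where
    open ≤-Reasoning
    open Petridis (card (A ⊞ B₂)) (card (A ⊞ B₁)) B₁ B₂
    a = card A
    x = card X
    u = card (A ⊞ B₁)
    v = card (A ⊞ B₂)
    w = card (X ⊞ B₂)
    y = card (X ⊞ B₂ ⊞ B₁)
    m = μ X
    e₁ : ∀ y a x u v → y ℕ.* (a ℕ.* a) ℕ.* (x ℕ.* (u ℕ.* v)) ≡ u ℕ.* (x ℕ.* (v ℕ.* y)) ℕ.* (a ℕ.* a)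
    e₁ = solve-∀
    e₂ : ∀ u m w a → u ℕ.* (m ℕ.* w) ℕ.* (a ℕ.* a) ≡ (m ℕ.* a) ℕ.* ((u ℕ.* w) ℕ.* a)
    e₂ = solve-∀
    e₃ : ∀ u v x → (v ℕ.* u ℕ.+ u ℕ.* v) ℕ.* x ℕ.* ((v ℕ.* u ℕ.+ u ℕ.* v) ℕ.* x) ≡ 4 ℕ.* (u ℕ.* v) ℕ.* x ℕ.* (x ℕ.* (u ℕ.* v))
    e₃ = solve-∀

  -- With weights 1 and 0, `μ Z` is `|Z + B|`. Using `growth` with `B + B` and then with `B` gives
  -- three factors `|X + B| / |X|`, each at most `|A + B| / |A|`.
  plünnecke₃ : ∀ {a} A B → a ∈ A →
               ∃ λ X → X ⊆ A × 0 < card X ×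
               card A ℕ.^ 3 ℕ.* card (X ⊞ (B ⊞ B) ⊞ B) ≤ card (A ⊞ B) ℕ.^ 3 ℕ.* card X
  plünnecke₃ A B a∈ with Petridis.minimal-subset 1 0 B B A a∈
  ... | X , X⊆A , X>0 , min , small = X , X⊆A , X>0 ,
      *-cancelʳ-≤ _ _ (x ℕ.* x) {{m*n≢0 x x {{>-nonZero X>0}} {{>-nonZero X>0}}}} (begin
      a ℕ.^ 3 ℕ.* y ℕ.* (x ℕ.* x)      ≡⟨ e₁ a y x ⟩
      a ℕ.^ 3 ℕ.* (x ℕ.* (x ℕ.* y))    ≤⟨ *-monoʳ-≤ (a ℕ.^ 3) (*-monoʳ-≤ x (grow (B ⊞ B))) ⟩
      a ℕ.^ 3 ℕ.* (x ℕ.* (m ℕ.* z))    ≡⟨ e₂ a x m z ⟩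
      a ℕ.^ 3 ℕ.* (m ℕ.* (x ℕ.* z))    ≤⟨ *-monoʳ-≤ (a ℕ.^ 3) (*-monoʳ-≤ m (≤-trans (*-monoʳ-≤ x (card-mono assoc)) (grow B))) ⟩
      a ℕ.^ 3 ℕ.* (m ℕ.* (m ℕ.* m))    ≡⟨ e₃ a m ⟩
      (m ℕ.* a) ℕ.^ 3                  ≤⟨ ℕ.^-monoˡ-≤ 3 (subst₂ (λ p q → p ℕ.* a ≤ q ℕ.* x) (one m) (one s) small) ⟩
      (s ℕ.* x) ℕ.^ 3                  ≡⟨ e₄ s x ⟩
      s ℕ.^ 3 ℕ.* x ℕ.* (x ℕ.* x)      ∎)
    where
    open ≤-Reasoning
    open Petridis 1 0 B B
    a = card A
    x = card X
    m = card (X ⊞ B)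
    s = card (A ⊞ B)
    z = card (X ⊞ (B ⊞ B))
    y = card (X ⊞ (B ⊞ B) ⊞ B)
    one : ∀ k → 1 ℕ.* k ℕ.+ 0 ℕ.* k ≡ k
    one = solve-∀
    grow : ∀ C → x ℕ.* card (X ⊞ C ⊞ B) ≤ m ℕ.* card (X ⊞ C)
    grow C = subst₂ (λ p q → x ℕ.* p ≤ q ℕ.* card (X ⊞ C)) (one (card (X ⊞ C ⊞ B))) (one m) (growth X min C)
    assoc : X ⊞ (B ⊞ B) ⊆ X ⊞ B ⊞ B
    assoc p with ⊞⁻ X (B ⊞ B) p
    ... | x , y , x∈ , y∈ , refl with ⊞⁻ B B y∈
    ...   | b , b′ , b∈ , b′∈ , refl = subst (_∈ X ⊞ B ⊞ B) (+-assoc x b b′) (⊞⁺ (⊞⁺ x∈ b∈) b′∈)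
    e₁ : ∀ a y x → a ℕ.* (a ℕ.* (a ℕ.* 1)) ℕ.* y ℕ.* (x ℕ.* x) ≡ a ℕ.* (a ℕ.* (a ℕ.* 1)) ℕ.* (x ℕ.* (x ℕ.* y))
    e₁ = solve-∀
    e₂ : ∀ a x m z → a ℕ.* (a ℕ.* (a ℕ.* 1)) ℕ.* (x ℕ.* (m ℕ.* z)) ≡ a ℕ.* (a ℕ.* (a ℕ.* 1)) ℕ.* (m ℕ.* (x ℕ.* z))
    e₂ = solve-∀
    e₃ : ∀ a m → a ℕ.* (a ℕ.* (a ℕ.* 1)) ℕ.* (m ℕ.* (m ℕ.* m)) ≡ m ℕ.* a ℕ.* (m ℕ.* a ℕ.* (m ℕ.* a ℕ.* 1))
    e₃ = solve-∀
    e₄ : ∀ s x → s ℕ.* x ℕ.* (s ℕ.* x ℕ.* (s ℕ.* x ℕ.* 1)) ≡ s ℕ.* (s ℕ.* (s ℕ.* 1)) ℕ.* x ℕ.* (x ℕ.* x)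
    e₄ = solve-∀

  -- The parts found in the successive complements are disjoint, so their costs add up to at most d / c
  -- per element.
  exhaust : ∀ A (cost : List E → ℕ) (c d : ℕ) → cost [] ≡ 0 →
            (∀ Y X → cost (Y ++ X) ≤ cost Y ℕ.+ cost X) →
            (∀ {a} A′ → A′ ⊆ A → a ∈ A′ → card A ≤ 2 ℕ.* card A′ →
              ∃ λ X → X ⊆ A′ × 0 < card X × c ℕ.* cost X ≤ d ℕ.* card X) →
            ∃ λ B → B ⊆ A × card A ≤ 2 ℕ.* card B × c ℕ.* cost B ≤ d ℕ.* card B
  exhaust A cost c d cost-[] cost-++ find-part =
    extend n [] (λ ()) (m≤n+m n (card [])) (≤-trans (≤-reflexive (trans (cong (c ℕ.*_) cost-[]) (*-zeroʳ c))) z≤n)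
    where
    n = card A
    Good : List E → Set
    Good B = B ⊆ A × n ≤ 2 ℕ.* card B × c ℕ.* cost B ≤ d ℕ.* card B
    extend : ∀ k Y → Y ⊆ A → n ≤ card Y ℕ.+ k → c ℕ.* cost Y ≤ d ℕ.* card Y → ∃ Good
    extend k Y Y⊆A fuel bound with n ≤? 2 ℕ.* card Y
    ... | yes p = Y , Y⊆A , p , bound
    extend zero Y Y⊆A fuel bound | no ¬p = contradiction (≤-trans fuel (+-monoʳ-≤ (card Y) z≤n)) ¬p
    extend (suc k) Y Y⊆A fuel bound | no ¬p = step
      where
      open ≤-Reasoning
      new? : Decidable (_∉ Y)
      new? z = ¬? (z ∈? Y)
      A′ = filter new? A
      A′⁻ : ∀ {z} → z ∈ A′ → z ∈ A × z ∉ Y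
      A′⁻ = ∈-filter⁻ new? {xs = A}
      A⊆ : A ⊆ Y ++ A′
      A⊆ {z} z∈ with z ∈? Y
      ... | yes q = ∈-++⁺ˡ q
      ... | no ¬q = ∈-++⁺ʳ Y (∈-filter⁺ new? z∈ ¬q)
      n≤ : n ≤ card Y ℕ.+ card A′
      n≤ = ≤-trans (card-mono A⊆) (card-++ Y A′)
      Y<A′ : card Y < card A′
      Y<A′ = ℕ.+-cancelˡ-< (card Y) (card Y) (card A′) (begin-strict
        card Y ℕ.+ card Y            ≡⟨ cong (card Y ℕ.+_) (sym (ℕ.+-identityʳ (card Y))) ⟩
        2 ℕ.* card Y                 <⟨ ≰⇒> ¬p ⟩
        n                            ≤⟨ n≤ ⟩
        card Y ℕ.+ card A′           ∎)
      n≤2A′ : n ≤ 2 ℕ.* card A′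
      n≤2A′ = ≤-trans n≤ (+-mono-≤ (<⇒≤ Y<A′) (m≤m+n (card A′) 0))
      step : ∃ Good
      step with find-part A′ (proj₁ ∘ A′⁻) (proj₂ (inhabited A′ (≤-trans (s≤s z≤n) Y<A′))) n≤2A′
      ... | X , X⊆ , X>0 , X-bound = extend k (Y ++ X) sub fuel′ (begin
        c ℕ.* cost (Y ++ X)                     ≤⟨ *-monoʳ-≤ c (cost-++ Y X) ⟩
        c ℕ.* (cost Y ℕ.+ cost X)               ≡⟨ ℕ.*-distribˡ-+ c (cost Y) (cost X) ⟩
        c ℕ.* cost Y ℕ.+ c ℕ.* cost X           ≤⟨ +-mono-≤ bound X-bound ⟩
        d ℕ.* card Y ℕ.+ d ℕ.* card X           ≡⟨ sym (ℕ.*-distribˡ-+ d (card Y) (card X)) ⟩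
        d ℕ.* (card Y ℕ.+ card X)               ≤⟨ *-monoʳ-≤ d grows ⟩
        d ℕ.* card (Y ++ X)                     ∎)
        where
        grows : card Y ℕ.+ card X ≤ card (Y ++ X)
        grows = card-disjoint Y X (Y ++ X) (λ y∈ x∈ → proj₂ (A′⁻ (X⊆ x∈)) y∈) ∈-++⁺ˡ (∈-++⁺ʳ Y)
        sub : Y ++ X ⊆ A
        sub z∈ with ∈-++⁻ Y z∈
        ... | inj₁ q = Y⊆A q
        ... | inj₂ q = proj₁ (A′⁻ (X⊆ q))
        fuel′ : n ≤ card (Y ++ X) ℕ.+ k
        fuel′ = begin
          n                              ≤⟨ fuel ⟩
          card Y ℕ.+ suc k               ≡⟨ sym (ℕ.+-assoc (card Y) 1 k) ⟩
          (card Y ℕ.+ 1) ℕ.+ k           ≤⟨ +-monoˡ-≤ k (+-monoʳ-≤ (card Y) X>0) ⟩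
          (card Y ℕ.+ card X) ℕ.+ k      ≤⟨ +-monoˡ-≤ k grows ⟩
          card (Y ++ X) ℕ.+ k            ∎

  -- The set given by `plünnecke₃` may be tiny, so it is extracted repeatedly from what is left of
  -- `A`. Each remainder used has at least half the size of `A`, which costs a factor 2 in the ratio
  -- `|A + A| / |A|`, hence the cube of 2 in the bound.
  plünnecke-dense : ∀ A → ∃ λ B → B ⊆ A × card A ≤ 2 ℕ.* card B ×
                    card A ℕ.^ 3 ℕ.* card (B ⊞ (A ⊞ A) ⊞ A) ≤ (2 ℕ.* card (A ⊞ A)) ℕ.^ 3 ℕ.* card B
  plünnecke-dense A = exhaust A 4-fold (card A ℕ.^ 3) ((2 ℕ.* card (A ⊞ A)) ℕ.^ 3) none split part
    where
    4-fold : List E → ℕ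
    4-fold Y = card (Y ⊞ (A ⊞ A) ⊞ A)
    none : 4-fold [] ≡ 0
    none = n≤0⇒n≡0 (card≤length ([] ⊞ (A ⊞ A) ⊞ A) [] empty)
      where
      empty : ∀ {z} → z ∈ [] ⊞ (A ⊞ A) ⊞ A → z ∈ []
      empty z∈ with w , _ , w∈ , _ ← ⊞⁻ ([] ⊞ (A ⊞ A)) A z∈ with _ , _ , () , _ ← ⊞⁻ [] (A ⊞ A) w∈
    split : ∀ Y X → 4-fold (Y ++ X) ≤ 4-fold Y ℕ.+ 4-fold X
    split Y X = ≤-trans (card-mono sub) (card-++ (Y ⊞ (A ⊞ A) ⊞ A) (X ⊞ (A ⊞ A) ⊞ A))
      where
      sub : (Y ++ X) ⊞ (A ⊞ A) ⊞ A ⊆ (Y ⊞ (A ⊞ A) ⊞ A) ++ (X ⊞ (A ⊞ A) ⊞ A)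
      sub z∈ with ⊞⁻ ((Y ++ X) ⊞ (A ⊞ A)) A z∈
      ... | w , a , w∈ , a∈ , refl with ⊞⁻ (Y ++ X) (A ⊞ A) w∈
      ...   | y , t , y∈ , t∈ , refl with ∈-++⁻ Y y∈
      ...     | inj₁ q = ∈-++⁺ˡ (⊞⁺ (⊞⁺ q t∈) a∈)
      ...     | inj₂ q = ∈-++⁺ʳ (Y ⊞ (A ⊞ A) ⊞ A) (⊞⁺ (⊞⁺ q t∈) a∈)
    cube-* : ∀ k a → k ℕ.* a ℕ.* (k ℕ.* a ℕ.* (k ℕ.* a ℕ.* 1)) ≡ k ℕ.* (k ℕ.* (k ℕ.* 1)) ℕ.* (a ℕ.* (a ℕ.* (a ℕ.* 1)))
    cube-* = solve-∀
    cube-scale : ∀ k n a s s′ f x → n ≤ k ℕ.* a → s′ ≤ s → a ℕ.^ 3 ℕ.* f ≤ s′ ℕ.^ 3 ℕ.* x → n ℕ.^ 3 ℕ.* f ≤ (k ℕ.* s) ℕ.^ 3 ℕ.* x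
    cube-scale k n a s s′ f x n≤ s≤ h = begin
      n ℕ.^ 3 ℕ.* f                    ≤⟨ *-monoˡ-≤ f (ℕ.^-monoˡ-≤ 3 n≤) ⟩
      (k ℕ.* a) ℕ.^ 3 ℕ.* f            ≡⟨ trans (cong (ℕ._* f) (cube-* k a)) (ℕ.*-assoc (k ℕ.^ 3) (a ℕ.^ 3) f) ⟩
      k ℕ.^ 3 ℕ.* (a ℕ.^ 3 ℕ.* f)      ≤⟨ *-monoʳ-≤ (k ℕ.^ 3) h ⟩
      k ℕ.^ 3 ℕ.* (s′ ℕ.^ 3 ℕ.* x)     ≤⟨ *-monoʳ-≤ (k ℕ.^ 3) (*-monoˡ-≤ x (ℕ.^-monoˡ-≤ 3 s≤)) ⟩
      k ℕ.^ 3 ℕ.* (s ℕ.^ 3 ℕ.* x)      ≡⟨ sym (trans (cong (ℕ._* x) (cube-* k s)) (ℕ.*-assoc (k ℕ.^ 3) (s ℕ.^ 3) x)) ⟩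
      (k ℕ.* s) ℕ.^ 3 ℕ.* x            ∎
      where open ≤-Reasoning
    part : ∀ {a} A′ → A′ ⊆ A → a ∈ A′ → card A ≤ 2 ℕ.* card A′ →
           ∃ λ X → X ⊆ A′ × 0 < card X × card A ℕ.^ 3 ℕ.* 4-fold X ≤ (2 ℕ.* card (A ⊞ A)) ℕ.^ 3 ℕ.* card X
    part A′ A′⊆ a∈ n≤ =
      let X , X⊆ , X>0 , h = plünnecke₃ A′ A a∈ in
      X , X⊆ , X>0 ,
      cube-scale 2 (card A) (card A′) (card (A ⊞ A)) (card (A′ ⊞ A)) (4-fold X) (card X) n≤
        (card-mono (⊞-mono {A′} {A} {A} {A} A′⊆ id)) h

-- Covering half of a set by few translates

record HalfCovered {E : Set} (Cov : E → E → Set) (X : List E) (k D : ℕ) : Set where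
  field
    part      : List E
    centres   : List E
    part⊆     : part ⊆ X
    unique    : Unique part
    half      : length X ≤ 2 ℕ.* length part
    few       : length centres ℕ.* k ≤ 2 ℕ.* D
    covered   : ∀ {x} → x ∈ part → ∃ λ t → t ∈ centres × Cov t x

-- While less than half of `X` is covered, the remainder has at least `|X| / 2` elements, so the
-- greedy centre covers at least `k |X| / (2 D)` new ones. At most `2 D / k` centres fit. Stopping
-- at half avoids the logarithm that a full greedy cover would bring in.
half-cover : ∀ {E : Set} (Cov : E → E → Set) (Cov? : ∀ t → Decidable (Cov t)) (X : List E) (k D : ℕ) →
             Unique X → 0 < k →
             (∀ {x} R → x ∈ R → R ⊆ X → Unique R → ∃ λ t → length R ℕ.* k ≤ D ℕ.* length (filter (Cov? t) R)) →
             HalfCovered Cov X k D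
half-cover {E} Cov Cov? X k D X! k>0 greedy = start X refl
  where
  finish : ∀ (C T : List E) → 0 < length X → C ⊆ X → Unique C → length X ≤ 2 ℕ.* length C → length C ≤ length X →
           length T ℕ.* (k ℕ.* length X) ≤ 2 ℕ.* D ℕ.* length C →
           (∀ {x} → x ∈ C → ∃ λ t → t ∈ T × Cov t x) → HalfCovered Cov X k D
  finish C T X>0 C⊆ C! half C≤X cost cov = record
    { part = C ; centres = T ; part⊆ = C⊆ ; unique = C! ; half = half ; covered = cov
    ; few = *-cancelʳ-≤ _ _ (length X) {{>-nonZero X>0}} (begin
        length T ℕ.* k ℕ.* length X      ≡⟨ ℕ.*-assoc (length T) k (length X) ⟩
        length T ℕ.* (k ℕ.* length X)    ≤⟨ cost ⟩
        2 ℕ.* D ℕ.* length C             ≤⟨ *-monoʳ-≤ (2 ℕ.* D) C≤X ⟩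
        2 ℕ.* D ℕ.* length X             ∎) }
    where open ≤-Reasoning
  extend : ∀ fuel (C R T : List E) → 0 < length X → C ⊆ X → R ⊆ X → Unique C → Unique R → (∀ {x} → x ∈ C → x ∉ R) →
           length R ≤ fuel → length C ℕ.+ length R ≡ length X →
           length T ℕ.* (k ℕ.* length X) ≤ 2 ℕ.* D ℕ.* length C →
           (∀ {x} → x ∈ C → ∃ λ t → t ∈ T × Cov t x) → HalfCovered Cov X k D
  extend fuel C [] T X>0 C⊆ R⊆ C! R! disj _ total cost cov =
    finish C T X>0 C⊆ C! (subst (_≤ 2 ℕ.* length C) C≡X (m≤m+n (length C) _)) (≤-reflexive C≡X) cost cov
    where
    C≡X : length C ≡ length X
    C≡X = trans (sym (ℕ.+-identityʳ (length C))) total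
  extend zero C (_ ∷ _) T _ _ _ _ _ _ () _ _ _
  extend (suc fuel) C R@(r ∷ _) T X>0 C⊆ R⊆ C! R! disj len total cost cov = decide (length X ≤? 2 ℕ.* length C)
    where
    open ≤-Reasoning
    r∈ : r ∈ R
    r∈ = here refl
    choice = greedy R r∈ R⊆ R!
    t = proj₁ choice
    N = filter (Cov? t) R
    R′ = filter (¬? ∘ Cov? t) R
    split : length N ℕ.+ length R′ ≡ length R
    split = length-filter-split (Cov? t) R
    -- The chosen centre covers something, so the remainder shrinks and the fuel suffices.
    N>0 : 0 < length N
    N>0 = ℕ.n≢0⇒n>0 (λ eq → <-irrefl refl (begin-strict
      0                       <⟨ ℕ.*-mono-< (∈-length r∈) k>0 ⟩
      length R ℕ.* k          ≤⟨ proj₂ choice ⟩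
      D ℕ.* length N          ≡⟨ cong (D ℕ.*_) eq ⟩
      D ℕ.* 0                 ≡⟨ *-zeroʳ D ⟩
      0                       ∎))
    N⁻ : ∀ {x} → x ∈ N → x ∈ R × Cov t x
    N⁻ = ∈-filter⁻ (Cov? t) {xs = R}
    R′⁻ : ∀ {x} → x ∈ R′ → x ∈ R × ¬ Cov t x
    R′⁻ = ∈-filter⁻ (¬? ∘ Cov? t) {xs = R}
    decide : Dec (length X ≤ 2 ℕ.* length C) → HalfCovered Cov X k D
    decide (yes p) = finish C T X>0 C⊆ C! p (≤-trans (m≤m+n (length C) (length R)) (≤-reflexive total)) cost cov
    decide (no ¬p) = extend fuel (N ++ C) R′ (t ∷ T) X>0 sub (R⊆ ∘ proj₁ ∘ R′⁻)
      (Unique.++⁺ (Unique.filter⁺ (Cov? t) R!) C! (λ { (p , q) → disj q (proj₁ (N⁻ p)) }))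
      (Unique.filter⁺ (¬? ∘ Cov? t) R!) disj′ len′ total′ cost′ cov′
      where
      sub : N ++ C ⊆ X
      sub x∈ with ∈-++⁻ N x∈
      ... | inj₁ p = R⊆ (proj₁ (N⁻ p))
      ... | inj₂ p = C⊆ p
      disj′ : ∀ {x} → x ∈ N ++ C → x ∉ R′
      disj′ x∈ q with ∈-++⁻ N x∈
      ... | inj₁ p = proj₂ (R′⁻ q) (proj₂ (N⁻ p))
      ... | inj₂ p = disj p (proj₁ (R′⁻ q))
      len′ : length R′ ≤ fuel
      len′ = ≤-pred (≤-trans (+-monoˡ-≤ (length R′) N>0) (≤-trans (≤-reflexive split) len))
      total′ : length (N ++ C) ℕ.+ length R′ ≡ length X
      total′ = trans (cong (ℕ._+ length R′) (length-++ N))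
        (trans (e (length N) (length C) (length R′)) (trans (cong (length C ℕ.+_) split) total))
        where
        e : ∀ n c r → (n ℕ.+ c) ℕ.+ r ≡ c ℕ.+ (n ℕ.+ r)
        e = solve-∀
      X≤2R : length X ≤ 2 ℕ.* length R
      X≤2R = ℕ.+-cancelˡ-≤ (2 ℕ.* length C) _ _ (begin
        2 ℕ.* length C ℕ.+ length X              ≤⟨ +-monoˡ-≤ (length X) (<⇒≤ (≰⇒> ¬p)) ⟩
        length X ℕ.+ length X                    ≡⟨ cong (λ z → z ℕ.+ z) (sym total) ⟩
        (length C ℕ.+ length R) ℕ.+ (length C ℕ.+ length R) ≡⟨ e (length C) (length R) ⟩
        2 ℕ.* length C ℕ.+ 2 ℕ.* length R        ∎)
        where
        e : ∀ c r → (c ℕ.+ r) ℕ.+ (c ℕ.+ r) ≡ 2 ℕ.* c ℕ.+ 2 ℕ.* r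
        e = solve-∀
      cost′ : suc (length T) ℕ.* (k ℕ.* length X) ≤ 2 ℕ.* D ℕ.* length (N ++ C)
      cost′ = begin
        k ℕ.* length X ℕ.+ length T ℕ.* (k ℕ.* length X)   ≤⟨ +-mono-≤ (*-monoʳ-≤ k X≤2R) cost ⟩
        k ℕ.* (2 ℕ.* length R) ℕ.+ 2 ℕ.* D ℕ.* length C    ≡⟨ cong (ℕ._+ 2 ℕ.* D ℕ.* length C) (e₁ k (length R)) ⟩
        2 ℕ.* (length R ℕ.* k) ℕ.+ 2 ℕ.* D ℕ.* length C    ≤⟨ +-monoˡ-≤ (2 ℕ.* D ℕ.* length C) (*-monoʳ-≤ 2 (proj₂ choice)) ⟩
        2 ℕ.* (D ℕ.* length N) ℕ.+ 2 ℕ.* D ℕ.* length C    ≡⟨ e₂ D (length N) (length C) ⟩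
        2 ℕ.* D ℕ.* (length N ℕ.+ length C)                ≡⟨ cong (2 ℕ.* D ℕ.*_) (sym (length-++ N)) ⟩
        2 ℕ.* D ℕ.* length (N ++ C)                        ∎
        where
        e₁ : ∀ k r → k ℕ.* (2 ℕ.* r) ≡ 2 ℕ.* (r ℕ.* k)
        e₁ = solve-∀
        e₂ : ∀ d n c → 2 ℕ.* (d ℕ.* n) ℕ.+ 2 ℕ.* d ℕ.* c ≡ 2 ℕ.* d ℕ.* (n ℕ.+ c)
        e₂ = solve-∀
      cov′ : ∀ {x} → x ∈ N ++ C → ∃ λ s → s ∈ t ∷ T × Cov s x
      cov′ x∈ with ∈-++⁻ N x∈
      ... | inj₁ p = t , here refl , proj₂ (N⁻ p)
      ... | inj₂ p with cov p
      ...   | s , s∈ , q = s , there s∈ , q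
  -- An empty `X` is treated apart because the bound on the centres comes from cancelling
  -- `length X`.
  start : ∀ Y → Y ≡ X → HalfCovered Cov X k D
  start []      refl = record { part = [] ; centres = [] ; part⊆ = λ () ; unique = [] ; half = z≤n ; few = z≤n ; covered = λ () }
  start (_ ∷ _) refl = extend (length X) [] X [] (s≤s z≤n) (λ ()) id [] X! (λ ()) ≤-refl refl z≤n (λ ())

module Coverings (F : DecField) where
  open DecField F
  open DifferenceSolver F
  open Cardinality _≟_
  open Sumsets F

  private
    add : E × E → E
    add (x , y) = x + y

    open Fibres _≟_ add

  module _ {X Y : List E} {x₀ y₀ : E} (X! : Unique X) (Y! : Unique Y) (x₀∈ : x₀ ∈ X) (y₀∈ : y₀ ∈ Y) where

    private
      pairs = cartesianProduct X Y
      pairs! : Unique pairs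
      pairs! = Unique.cartesianProduct⁺ X! Y!
      add∈ : ∀ {p} → p ∈ pairs → add p ∈ set (X ⊞ Y)
      add∈ {x , y} p∈ = let x∈ , y∈ = ∈-cartesianProduct⁻ X Y p∈ in ∈-set⁺ (⊞⁺ x∈ y∈)

    -- A most popular sum `t` has at least `|X||Y| / |X + Y|` representations `x + y`, and each is
    -- determined by `x`.
    reflected-translate : ∃ λ t → length X ℕ.* length Y ≤ card (X ⊞ Y) ℕ.* length (filter (λ x → (t - x) ∈? Y) X)
    reflected-translate =
      let t , _ , h = large-fibre pairs (set (X ⊞ Y)) (∈-set⁺ (⊞⁺ x₀∈ y₀∈)) add∈ in
      t , ≤-trans (≤-reflexive (sym (length-× X Y))) (≤-trans h (*-monoʳ-≤ (card (X ⊞ Y)) (bound t)))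
      where
      y-of : ∀ x y → (x + y) - x ≡ y
      y-of = solve 2 (λ x y → (x :+ y) :- x := y) refl
      bound : ∀ t → length (fibre pairs t) ≤ length (filter (λ x → (t - x) ∈? Y) X)
      bound t = length-inj (fibre pairs t) _ proj₁ (Unique.filter⁺ (λ p → add p ≟ t) pairs!) into inj
        where
        fib⁻ : ∀ {p} → p ∈ fibre pairs t → p ∈ pairs × add p ≡ t
        fib⁻ = ∈-filter⁻ (λ p → add p ≟ t) {xs = pairs}
        into : ∀ {p} → p ∈ fibre pairs t → proj₁ p ∈ filter (λ x → (t - x) ∈? Y) X
        into {x , y} p∈ with fib⁻ p∈
        ... | p∈′ , refl = let x∈ , y∈ = ∈-cartesianProduct⁻ X Y p∈′ in
              ∈-filter⁺ (λ x′ → ((x + y) - x′) ∈? Y) x∈ (subst (_∈ Y) (sym (y-of x y)) y∈)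
        inj : ∀ {p q} → p ∈ fibre pairs t → q ∈ fibre pairs t → proj₁ p ≡ proj₁ q → p ≡ q
        inj {x , y} {_ , y′} p∈ q∈ refl = cong (x ,_) (+-injˡ x (trans (proj₂ (fib⁻ p∈)) (sym (proj₂ (fib⁻ q∈)))))

    -- By Cauchy–Schwarz X and Y have additive energy at least (|X||Y|)² / |X + Y|, and the energy also
    -- counts the solutions of x' - y = x - y'.
    translate : ∃ λ t → length X ℕ.* length Y ≤ card (X ⊞ Y) ℕ.* length (filter (λ x → (x - t) ∈? Y) X)
    translate =
      let (x , y) , _ , h = G.large-fibre (collisions pairs) pairs (∈-cartesianProduct⁺ x₀∈ y₀∈) outer∈ in
      x - y , subst (_≤ card (X ⊞ Y) ℕ.* length (filter (λ z → (z - (x - y)) ∈? Y) X)) (length-× X Y)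
        (*-cancelʳ-≤ L _ L {{>-nonZero (∈-length (∈-cartesianProduct⁺ x₀∈ y₀∈))}} (begin
          L ℕ.* L                                                      ≤⟨ cauchy-schwarz pairs (set (X ⊞ Y)) pairs! add∈ ⟩
          card (X ⊞ Y) ℕ.* length (collisions pairs)                   ≤⟨ *-monoʳ-≤ (card (X ⊞ Y)) h ⟩
          card (X ⊞ Y) ℕ.* (L ℕ.* length (G.fibre (collisions pairs) (x , y)))
                                                                       ≤⟨ *-monoʳ-≤ (card (X ⊞ Y)) (*-monoʳ-≤ L (bound x y)) ⟩
          card (X ⊞ Y) ℕ.* (L ℕ.* M x y)                               ≡⟨ e (card (X ⊞ Y)) L (M x y) ⟩
          card (X ⊞ Y) ℕ.* M x y ℕ.* L                                 ∎))
      where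
      open ≤-Reasoning
      outer : (E × E) × (E × E) → E × E
      outer ((x , y) , (x′ , y′)) = x , y′
      module G = Fibres (≡-dec _≟_ _≟_) outer
      L = length pairs
      M : E → E → ℕ
      M x y = length (filter (λ z → (z - (x - y)) ∈? Y) X)
      e : ∀ a b c → a ℕ.* (b ℕ.* c) ≡ a ℕ.* c ℕ.* b
      e = solve-∀
      coll⁻ : ∀ {x y x′ y′} → ((x , y) , (x′ , y′)) ∈ collisions pairs →
              ((x ∈ X × y ∈ Y) × (x′ ∈ X × y′ ∈ Y)) × x + y ≡ x′ + y′
      coll⁻ q∈ =
        let p∈ , eq = ∈-filter⁻ collide? {xs = cartesianProduct pairs pairs} q∈
            u∈ , v∈ = ∈-cartesianProduct⁻ pairs pairs p∈
        in (∈-cartesianProduct⁻ X Y u∈ , ∈-cartesianProduct⁻ X Y v∈) , eq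
      outer∈ : ∀ {q} → q ∈ collisions pairs → outer q ∈ pairs
      outer∈ q∈ = let ((x∈ , _) , (_ , y′∈)) , _ = coll⁻ q∈ in ∈-cartesianProduct⁺ x∈ y′∈
      bound : ∀ x y → length (G.fibre (collisions pairs) (x , y)) ≤ M x y
      bound x y = length-inj (G.fibre (collisions pairs) (x , y)) _ (proj₁ ∘ proj₂)
        (Unique.filter⁺ _ (Unique.filter⁺ collide? (Unique.cartesianProduct⁺ pairs! pairs!))) into inj
        where
        fib⁻ : ∀ {q} → q ∈ G.fibre (collisions pairs) (x , y) → q ∈ collisions pairs × outer q ≡ (x , y)
        fib⁻ = ∈-filter⁻ (λ q → ≡-dec _≟_ _≟_ (outer q) (x , y)) {xs = collisions pairs}
        y-of : ∀ x y x′ y′ → x + y ≡ x′ + y′ → x′ - (x - y′) ≡ y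
        y-of x y x′ y′ eq = trans (e₁ x x′ y′) (trans (cong (_- x) (sym eq)) (e₂ x y))
          where
          e₁ : ∀ x x′ y′ → x′ - (x - y′) ≡ (x′ + y′) - x
          e₁ = solve 3 (λ x x′ y′ → x′ :- (x :- y′) := (x′ :+ y′) :- x) refl
          e₂ : ∀ x y → (x + y) - x ≡ y
          e₂ = solve 2 (λ x y → (x :+ y) :- x := y) refl
        into : ∀ {q} → q ∈ G.fibre (collisions pairs) (x , y) → proj₁ (proj₂ q) ∈ filter (λ z → (z - (x - y)) ∈? Y) X
        into {(x₁ , y₁) , (x₂ , y₂)} q∈ with fib⁻ q∈
        ... | q∈′ , refl = let ((_ , y₁∈) , (x₂∈ , _)) , eq = coll⁻ q∈′ in
              ∈-filter⁺ (λ z → (z - (x₁ - y₂)) ∈? Y) x₂∈ (subst (_∈ Y) (sym (y-of x₁ y₁ x₂ y₂ eq)) y₁∈)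
        inj : ∀ {p q} → p ∈ G.fibre (collisions pairs) (x , y) → q ∈ G.fibre (collisions pairs) (x , y) →
              proj₁ (proj₂ p) ≡ proj₁ (proj₂ q) → p ≡ q
        inj {(x₁ , y₁) , (x₂ , y₂)} {(x₃ , y₃) , (_ , y₄)} p∈ q∈ refl with fib⁻ p∈ | fib⁻ q∈
        ... | p∈′ , refl | q∈′ , refl =
              cong (λ z → (x₁ , z) , (x₂ , y₂))
                (+-injˡ x₁ (trans (proj₂ (coll⁻ p∈′)) (sym (proj₂ (coll⁻ q∈′)))))

  module _ {X Y : List E} {y₀ : E} (X! : Unique X) (Y! : Unique Y) (y₀∈ : y₀ ∈ Y) (D : ℕ) (X⊞Y≤D : card (X ⊞ Y) ≤ D) where

    private
      -- A remainder has no larger sumset with `Y` than `X` has, so one bound `D` serves every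
      -- greedy step.
      restrict : ∀ {R} → R ⊆ X → card (R ⊞ Y) ≤ D
      restrict {R} R⊆ = ≤-trans (card-mono (⊞-mono {R} {X} {Y} {Y} R⊆ id)) X⊞Y≤D

    cover-by-reflections : HalfCovered (λ t x → t - x ∈ Y) X (length Y) D
    cover-by-reflections = half-cover _ (λ t x → (t - x) ∈? Y) X (length Y) D X! (∈-length y₀∈)
      (λ R r∈ R⊆ R! → let t , h = reflected-translate R! Y! r∈ y₀∈ in t , ≤-trans h (*-monoˡ-≤ _ (restrict R⊆)))

    cover-by-translates : HalfCovered (λ t x → x - t ∈ Y) X (length Y) D
    cover-by-translates = half-cover _ (λ t x → (x - t) ∈? Y) X (length Y) D X! (∈-length y₀∈)
      (λ R r∈ R⊆ R! → let t , h = translate R! Y! r∈ y₀∈ in t , ≤-trans h (*-monoˡ-≤ _ (restrict R⊆)))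

-- Quotients of differences and the subfields they form

module Quotients (F : DecField) where
  open DecField F
  open DifferenceSolver F
  open Cardinality _≟_
  open Sumsets F

  *-injˡ : ∀ {m} → ¬ m ≡ 0# → ∀ {x y} → m * x ≡ m * y → x ≡ y
  *-injˡ {m} m≢0 {x} {y} eq = trans (e x) (trans (cong (inv m *_) eq) (sym (e y)))
    where
    e : ∀ x → x ≡ inv m * (m * x)
    e x = trans (sym (*-identityˡ x)) (trans (cong (_* x) (trans (sym (inverse m m≢0)) (*-comm m (inv m)))) (*-assoc (inv m) m x))

  divide : ∀ {r δ n} → ¬ δ ≡ 0# → r * δ ≡ n → r ≡ n * inv δ
  divide {r} {δ} δ≢0 refl = sym (trans (*-assoc r δ (inv δ)) (trans (cong (r *_) (inverse δ δ≢0)) (*-identityʳ r)))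

  multiply : ∀ {r δ n} → ¬ δ ≡ 0# → r ≡ n * inv δ → r * δ ≡ n
  multiply {δ = δ} {n} δ≢0 refl =
    trans (*-assoc n (inv δ) δ) (trans (cong (n *_) (trans (*-comm (inv δ) δ) (inverse δ δ≢0))) (*-identityʳ n))

  x-y≡0⇒x≡y : ∀ {x y} → x - y ≡ 0# → x ≡ y
  x-y≡0⇒x≡y {x} {y} eq = +-injʳ (- y) (trans eq (sym (-‿inverseʳ y)))

  *≢0 : ∀ {x y} → ¬ x ≡ 0# → ¬ y ≡ 0# → ¬ x * y ≡ 0#
  *≢0 {x} {y} x≢0 y≢0 eq = y≢0 (*-injˡ x≢0 (trans eq (sym (zeroʳ x))))

  inv≢0 : ∀ {x} → ¬ x ≡ 0# → ¬ inv x ≡ 0#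
  inv≢0 {x} x≢0 eq = 1≢0 (trans (sym (inverse x x≢0)) (trans (cong (x *_) eq) (zeroʳ x)))

  -- The defining equation is cleared of its denominator, so that it enters polynomial identities
  -- directly.
  record Quotient (W : List E) (r : E) : Set where
    constructor quotient
    field
      {a b c d} : E
      a∈    : a ∈ W
      b∈    : b ∈ W
      c∈    : c ∈ W
      d∈    : d ∈ W
      c-d≢0 : ¬ c - d ≡ 0#
      eq    : r * (c - d) ≡ a - b

  opaque
    differences : List E → List E
    differences W = cartesianProductWith _-_ W W

    quotients : List E → List E
    quotients W = cartesianProductWith (λ n δ → n * inv δ) (differences W) (filter (λ δ → ¬? (δ ≟ 0#)) (differences W))

    ∈-quotients⁺ : ∀ {W r} → Quotient W r → r ∈ quotients W
    ∈-quotients⁺ {W} (quotient a∈ b∈ c∈ d∈ δ≢0 eq) = subst (_∈ quotients W) (sym (divide δ≢0 eq))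
      (∈-cartesianProductWith⁺ (λ n δ → n * inv δ) (∈-cartesianProductWith⁺ _-_ a∈ b∈)
        (∈-filter⁺ (λ δ → ¬? (δ ≟ 0#)) (∈-cartesianProductWith⁺ _-_ c∈ d∈) δ≢0))

    ∈-quotients⁻ : ∀ {W r} → r ∈ quotients W → Quotient W r
    ∈-quotients⁻ {W} r∈ with ∈-cartesianProductWith⁻ (λ n δ → n * inv δ) (differences W) (filter (λ δ → ¬? (δ ≟ 0#)) (differences W)) r∈
    ... | n , δ , n∈ , δ∈ , r≡ with ∈-filter⁻ (λ δ → ¬? (δ ≟ 0#)) {xs = differences W} δ∈
    ...   | δ∈′ , δ≢0 with ∈-cartesianProductWith⁻ _-_ W W n∈ | ∈-cartesianProductWith⁻ _-_ W W δ∈′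
    ...     | a , b , a∈ , b∈ , refl | c , d , c∈ , d∈ , refl = quotient a∈ b∈ c∈ d∈ δ≢0 (multiply δ≢0 r≡)

  0∈quotients : ∀ {W c d} → c ∈ W → d ∈ W → ¬ c ≡ d → 0# ∈ quotients W
  0∈quotients {c = c} {d} c∈ d∈ c≢d = ∈-quotients⁺
    (quotient c∈ c∈ c∈ d∈ (c≢d ∘ x-y≡0⇒x≡y) (trans (zeroˡ (c - d)) (sym (-‿inverseʳ c))))

  -- A coincidence x + r u = x' + r u' with u ≠ u' would exhibit r as (x' - x) / (u - u').
  non-quotient-injective : ∀ {W r} → r ∉ quotients W → ∀ {X U} → X ⊆ W → U ⊆ W → Unique X → Unique U →
                           ∀ Z → (∀ {x u} → x ∈ X → u ∈ U → x + r * u ∈ Z) → length X ℕ.* length U ≤ card Z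
  non-quotient-injective {W} {r} r∉ {X} {U} X⊆ U⊆ X! U! Z into = subst (_≤ card Z) (length-× X U)
    (length≤card (cartesianProduct X U) Z (λ { (x , u) → x + r * u }) (Unique.cartesianProduct⁺ X! U!)
      (λ p∈ → let x∈ , u∈ = ∈-cartesianProduct⁻ X U p∈ in into x∈ u∈) inj)
    where
    inj : ∀ {p q} → p ∈ cartesianProduct X U → q ∈ cartesianProduct X U →
          proj₁ p + r * proj₂ p ≡ proj₁ q + r * proj₂ q → p ≡ q
    inj {x , u} {x′ , u′} p∈ q∈ eq with ∈-cartesianProduct⁻ X U p∈ | ∈-cartesianProduct⁻ X U q∈ | u ≟ u′
    ... | _ | _ | yes refl = cong (_, u) (+-injʳ (r * u) eq)
    ... | x∈ , u∈ | x′∈ , u′∈ | no u≢u′ = contradiction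
          (∈-quotients⁺ (quotient (X⊆ x′∈) (X⊆ x∈) (U⊆ u∈) (U⊆ u′∈) (u≢u′ ∘ x-y≡0⇒x≡y)
            (trans (e₁ r u u′ x) (trans (cong (λ z → (z - r * u′) - x) eq) (e₂ r u′ x x′)))))
          r∉
      where
      e₁ : ∀ r u u′ x → r * (u - u′) ≡ ((x + r * u) - r * u′) - x
      e₁ = solve 4 (λ r u u′ x → r :* (u :- u′) := ((x :+ r :* u) :- r :* u′) :- x) refl
      e₂ : ∀ r u′ x x′ → ((x′ + r * u′) - r * u′) - x ≡ x′ - x
      e₂ = solve 4 (λ r u′ x x′ → ((x′ :+ r :* u′) :- r :* u′) :- x := x′ :- x) refl

  record Subfield (R : List E) : Set where
    field
      0∈   : 0# ∈ R
      1∈   : 1# ∈ R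
      +∈   : ∀ {x y} → x ∈ R → y ∈ R → x + y ∈ R
      -∈   : ∀ {x} → x ∈ R → - x ∈ R
      *∈   : ∀ {x y} → x ∈ R → y ∈ R → x * y ∈ R
      inv∈ : ∀ {x} → x ∈ R → ¬ x ≡ 0# → inv x ∈ R

  -- With G = {s : s + R ⊆ R} and K = {t : t G ⊆ G} one has R ⊆ K ⊆ G ⊆ R; finiteness turns the
  -- inclusions s + R ⊆ R and t G ⊆ G into equalities, which supplies negatives and inverses.
  module Closed (W : List E) (l : E) (l≢0 : ¬ l ≡ 0#) (W≢0 : ∀ {w} → w ∈ W → ¬ w ≡ 0#)
                (0∈R : 0# ∈ quotients W)
                (1+R⊆R : ∀ {r} → r ∈ quotients W → 1# + r ∈ quotients W)
                (lWR⊆R : ∀ {w r} → w ∈ W → r ∈ quotients W → (l * w) * r ∈ quotients W) where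
    private
      R = quotients W

      G : E → Set
      G s = All (λ r → s + r ∈ R) R

      G? : Decidable G
      G? s = all? (λ r → (s + r) ∈? R) R

      G⁺ : ∀ {s} → (∀ {r} → r ∈ R → s + r ∈ R) → G s
      G⁺ = All.tabulate

      G⁻ : ∀ {s r} → G s → r ∈ R → s + r ∈ R
      G⁻ g = All.lookup g

      G⊆R : ∀ {s} → G s → s ∈ R
      G⊆R {s} g = subst (_∈ R) (+-identityʳ s) (G⁻ g 0∈R)

      G+ : ∀ {s t} → G s → G t → G (s + t)
      G+ {s} {t} gs gt = G⁺ (λ {r} r∈ → subst (_∈ R) (sym (+-assoc s t r)) (G⁻ gs (G⁻ gt r∈)))

      G- : ∀ {s} → G s → G (- s)
      G- {s} gs = G⁺ (λ r∈ → let r′ , r′∈ , eq = surjective-on R (s +_) (G⁻ gs) (+-injˡ s) r∈ in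
        subst (_∈ R) (trans (e s r′) (cong (- s +_) eq)) r′∈)
        where
        e : ∀ s r → r ≡ - s + (s + r)
        e = solve 2 (λ s r → r := :- s :+ (s :+ r)) refl

      -- With `m = l w`, multiplication by `m` permutes the finite set `R`. Writing `r = m r'` gives
      -- `m s + r = m (s + r')`, which stays in `R`.
      lW⊆K : ∀ {w s} → w ∈ W → G s → G ((l * w) * s)
      lW⊆K {w} {s} w∈ gs = G⁺ (λ r∈ →
        let r′ , r′∈ , eq = surjective-on R ((l * w) *_) (lWR⊆R w∈) (*-injˡ (*≢0 l≢0 (W≢0 w∈))) r∈ in
        subst (_∈ R) (trans (distribˡ (l * w) s r′) (cong ((l * w) * s +_) eq)) (lWR⊆R w∈ (G⁻ gs r′∈)))

      K : E → Set
      K t = ∀ {s} → G s → G (t * s)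

      -- It suffices to evaluate at 1, which lies in `G` by the hypothesis on `1 + r`.
      K⊆G : ∀ {t} → K t → G t
      K⊆G {t} k = subst G (*-identityʳ t) (k (G⁺ 1+R⊆R))

      K- : ∀ {t} → K t → K (- t)
      K- {t} k {s} gs = subst G (e t s) (G- (k gs))
        where
        e : ∀ t s → - (t * s) ≡ - t * s
        e = solve 2 (λ t s → :- (t :* s) := :- t :* s) refl

      K+ : ∀ {t u} → K t → K u → K (t + u)
      K+ {t} {u} kt ku {s} gs = subst G (sym (distribʳ s t u)) (G+ (kt gs) (ku gs))

      K* : ∀ {t u} → K t → K u → K (t * u)
      K* {t} {u} kt ku {s} gs = subst G (sym (*-assoc t u s)) (kt (ku gs))

      Gs : List E
      Gs = filter G? R

      K-inv : ∀ {t} → ¬ t ≡ 0# → K t → K (inv t)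
      K-inv {t} t≢0 k {s} gs =
        let s′ , s′∈ , eq = surjective-on Gs (t *_) (λ x∈ → let g = k (Gs⁻ x∈) in ∈-filter⁺ G? (G⊆R g) g)
                              (*-injˡ t≢0) (∈-filter⁺ G? (G⊆R gs) gs) in
        subst G (sym (*-injˡ t≢0 (trans (sym (*-assoc t (inv t) s)) (trans (cong (_* s) (inverse t t≢0)) (trans (*-identityˡ s) (sym eq))))))
          (Gs⁻ s′∈)
        where
        Gs⁻ : ∀ {x} → x ∈ Gs → G x
        Gs⁻ = proj₂ ∘ ∈-filter⁻ G? {xs = R}

      -- A quotient is unchanged when `a`, `b`, `c`, `d` are multiplied by `l`; it is then built by
      -- ring operations and one inverse from elements of `l W`, all of which lie in `K`.
      R⊆K : ∀ {r} → r ∈ R → K r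
      R⊆K {r} r∈ {s} gs with ∈-quotients⁻ {W} r∈
      ... | quotient {a} {b} {c} {d} a∈ b∈ c∈ d∈ δ≢0 eq =
            subst (λ z → G (z * s)) (sym r≡) (K* (K+ (lW⊆K a∈) (K- (lW⊆K b∈))) (K-inv δ′≢0 (K+ (lW⊆K c∈) (K- (lW⊆K d∈)))) gs)
        where
        e : ∀ l x y → l * x - l * y ≡ l * (x - y)
        e = solve 3 (λ l x y → l :* x :- l :* y := l :* (x :- y)) refl
        e′ : ∀ r l x → r * (l * x) ≡ l * (r * x)
        e′ = solve 3 (λ r l x → r :* (l :* x) := l :* (r :* x)) refl
        δ′≢0 : ¬ l * c - l * d ≡ 0#
        δ′≢0 p = *≢0 l≢0 δ≢0 (trans (sym (e l c d)) p)
        r≡ : r ≡ (l * a - l * b) * inv (l * c - l * d)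
        r≡ = divide δ′≢0 (trans (cong (r *_) (e l c d)) (trans (e′ r l (c - d)) (trans (cong (l *_) eq) (sym (e l a b)))))

    subfield : Subfield R
    subfield = record
      { 0∈ = 0∈R
      ; 1∈ = subst (_∈ R) (+-identityʳ 1#) (1+R⊆R 0∈R)
      ; +∈ = λ x∈ y∈ → G⊆R (K⊆G (K+ (R⊆K x∈) (R⊆K y∈)))
      ; -∈ = λ x∈ → G⊆R (K⊆G (K- (R⊆K x∈)))
      ; *∈ = λ x∈ y∈ → G⊆R (K⊆G (K* (R⊆K x∈) (R⊆K y∈)))
      ; inv∈ = λ x∈ x≢0 → G⊆R (K⊆G (K-inv x≢0 (R⊆K x∈)))
      }

    lW⊆R : ∀ {w} → w ∈ W → l * w ∈ R
    lW⊆R w∈ = G⊆R (K⊆G (lW⊆K w∈))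

-- Rich lines through the origin

module Popularity (F : DecField) where
  open DecField F
  open DifferenceSolver F
  open Cardinality _≟_
  open Sumsets F
  open Quotients F

  infixl 7 _⊘_
  opaque
    _⊘_ : List E → List E → List E
    X ⊘ Y = cartesianProductWith (λ a b → inv b * a) X Y

    ⊘⁺ : ∀ {X Y x y} → x ∈ X → y ∈ Y → inv y * x ∈ X ⊘ Y
    ⊘⁺ = ∈-cartesianProductWith⁺ (λ a b → inv b * a)

    ⊘⁻ : ∀ X Y {z} → z ∈ X ⊘ Y → ∃ λ x → ∃ λ y → x ∈ X × y ∈ Y × z ≡ inv y * x
    ⊘⁻ X Y = ∈-cartesianProductWith⁻ (λ a b → inv b * a) X Y

  -- The points of `U × B` on the line of slope `m` through 0, recorded by their abscissae.
  hits : List E → E → List E → List E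
  hits B m U = filter (λ u → (m * u) ∈? B) U

  module PopularSlopes {B : List E} {b₀ : E} (B! : Unique B) (B≢0 : ∀ {b} → b ∈ B → ¬ b ≡ 0#) (b₀∈ : b₀ ∈ B) (κ : ℕ) where

    private
      β = length B

    Unpopular : E → Set
    Unpopular m = κ ℕ.* length (hits B m B) < β ℕ.* β

    unpopular? : Decidable Unpopular
    unpopular? m = κ ℕ.* length (hits B m B) ℕ.<? β ℕ.* β

    private
      slope : E × E → E
      slope (w , x) = inv x * w

      module S = Fibres _≟_ slope
      module P = Fibres {A = E × E} _≟_ proj₂

      U : List (E × E)
      U = filter (λ p → unpopular? (slope p)) (cartesianProduct B B)

      U⁻ : ∀ {p} → p ∈ U → p ∈ cartesianProduct B B × Unpopular (slope p)
      U⁻ = ∈-filter⁻ (λ p → unpopular? (slope p)) {xs = cartesianProduct B B}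

      U! : Unique U
      U! = Unique.filter⁺ (λ p → unpopular? (slope p)) (Unique.cartesianProduct⁺ B! B!)

      -- A pair of slope `m` is `(m x, x)`, so the fibre embeds in the hits of `m`. That `m` is
      -- unpopular is known only through a member of the fibre, hence the separate empty case.
      fibre-bound : ∀ m → κ ℕ.* length (S.fibre U m) ≤ β ℕ.* β
      fibre-bound m = go (S.fibre U m) refl
        where
        fib⁻ : ∀ {p} → p ∈ S.fibre U m → p ∈ U × slope p ≡ m
        fib⁻ = ∈-filter⁻ (λ p → slope p ≟ m) {xs = U}
        top : ∀ {w x} → (w , x) ∈ S.fibre U m → m * x ≡ w
        top {w} {x} p∈ = trans (cong (_* x) (sym (proj₂ (fib⁻ p∈))))
          (trans (e (inv x) w x) (trans (cong (_* w) (inverse x (B≢0 (proj₂ (∈-cartesianProduct⁻ B B (proj₁ (U⁻ (proj₁ (fib⁻ p∈))))))))) (*-identityˡ w)))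
          where
          e : ∀ i w x → i * w * x ≡ x * i * w
          e = solve 3 (λ i w x → i :* w :* x := x :* i :* w) refl
        size : length (S.fibre U m) ≤ length (hits B m B)
        size = length-inj (S.fibre U m) (hits B m B) proj₂ (Unique.filter⁺ (λ p → slope p ≟ m) U!)
          (λ p∈ → let w∈ , x∈ = ∈-cartesianProduct⁻ B B (proj₁ (U⁻ (proj₁ (fib⁻ p∈)))) in
                  ∈-filter⁺ (λ u → (m * u) ∈? B) x∈ (subst (_∈ B) (sym (top p∈)) w∈))
          (λ { {w , x} {w′ , _} p∈ q∈ refl → cong (_, x) (trans (sym (top p∈)) (top q∈)) })
        go : ∀ fib → S.fibre U m ≡ fib → κ ℕ.* length fib ≤ β ℕ.* β
        go []        _  = ≤-trans (≤-reflexive (*-zeroʳ κ)) z≤n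
        go (p ∷ fib) eq = ≤-trans (*-monoʳ-≤ κ (subst (λ z → length z ≤ length (hits B m B)) eq size))
          (<⇒≤ (subst Unpopular (proj₂ (fib⁻ p∈)) (proj₂ (U⁻ (proj₁ (fib⁻ p∈))))))
          where
          p∈ : p ∈ S.fibre U m
          p∈ = subst (p ∈_) (sym eq) (here refl)

    -- There are at most `Q` slopes, and an unpopular one carries fewer than `β² / (k Q)` pairs, so
    -- at most `β² / k` pairs are unpopular. Averaging over the second coordinate finds an `x` with
    -- at most `β / k` of them; its inverse becomes the dilation `l`.
    few-unpopular : ∀ k (A : List E) → B ⊆ A → κ ≡ k ℕ.* card (A ⊘ A) →
                    ∃ λ x → x ∈ B × k ℕ.* length (filter (λ w → unpopular? (inv x * w)) B) ≤ β
    few-unpopular k A B⊆ κ≡ = x , x∈ , *-cancelˡ-≤ β {{>-nonZero (∈-length b₀∈)}} (begin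
        β ℕ.* (k ℕ.* length L)          ≡⟨ e β k (length L) ⟩
        k ℕ.* (β ℕ.* length L)          ≤⟨ *-monoʳ-≤ k (*-monoʳ-≤ β L≤) ⟩
        k ℕ.* (β ℕ.* length (P.fibre U x)) ≤⟨ *-monoʳ-≤ k x-small ⟩
        k ℕ.* length U                  ≤⟨ kU≤ ⟩
        β ℕ.* β                         ∎)
      where
      open ≤-Reasoning
      q = card (A ⊘ A)
      e : ∀ a b c → a ℕ.* (b ℕ.* c) ≡ b ℕ.* (a ℕ.* c)
      e = solve-∀
      e′ : ∀ q k u → q ℕ.* (k ℕ.* u) ≡ k ℕ.* q ℕ.* u
      e′ = solve-∀
      kU≤ : k ℕ.* length U ≤ β ℕ.* β
      kU≤ = *-cancelˡ-≤ q {{>-nonZero (card>0 (⊘⁺ (B⊆ b₀∈) (B⊆ b₀∈)))}} (begin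
        q ℕ.* (k ℕ.* length U)     ≡⟨ e′ q k (length U) ⟩
        k ℕ.* q ℕ.* length U       ≡⟨ cong (ℕ._* length U) (sym κ≡) ⟩
        κ ℕ.* length U             ≤⟨ S.fibres-bound U (set (A ⊘ A)) κ (β ℕ.* β) into (λ {m} _ → fibre-bound m) ⟩
        q ℕ.* (β ℕ.* β)            ∎)
        where
        into : ∀ {p} → p ∈ U → slope p ∈ set (A ⊘ A)
        into p∈ = let w∈ , x∈ = ∈-cartesianProduct⁻ B B (proj₁ (U⁻ p∈)) in ∈-set⁺ (⊘⁺ (B⊆ w∈) (B⊆ x∈))
      choice = P.small-fibre U B b₀∈ B!
      x = proj₁ choice
      x∈ = proj₁ (proj₂ choice)
      x-small = proj₂ (proj₂ choice)
      L = filter (λ w → unpopular? (inv x * w)) B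
      L≤ : length L ≤ length (P.fibre U x)
      L≤ = length-inj L (P.fibre U x) (_, x) (Unique.filter⁺ (λ w → unpopular? (inv x * w)) B!)
        (λ w∈ → let w∈B , unpop = ∈-filter⁻ (λ w → unpopular? (inv x * w)) {xs = B} w∈ in
                ∈-filter⁺ (λ p → proj₂ p ≟ x)
                  (∈-filter⁺ (λ p → unpopular? (slope p)) (∈-cartesianProduct⁺ w∈B x∈) unpop) refl)
        (λ { _ _ refl → refl })

    -- The graph on `B` joins `v` and `w` when `l v w` is in `B`, so the degree of `w` is the number
    -- of hits of the slope `l w`. The set `L` of vertices of low degree is removed outright, and
    -- the rest is pruned starting with `Z = L`. At most `2 |L|` further vertices are lost, which
    -- together with `L` gives the factor 3.
    popular-core : ∀ l → ∃ λ W → W ⊆ B × Unique W ×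
                   β ≤ length W ℕ.+ 3 ℕ.* length (filter (λ w → unpopular? (l * w)) B) ×
                   (∀ {w} → w ∈ W → β ℕ.* β ≤ 4 ℕ.* (κ ℕ.* length (hits B (l * w) W)))
    popular-core l = W , W⊆ , W! , size , good
      where
      open ≤-Reasoning
      unpop? : Decidable (λ w → Unpopular (l * w))
      unpop? w = unpopular? (l * w)
      -- Weighting each edge by `κ` makes the integer `β * β` the degree threshold and avoids a
      -- division.
      edge : E → E → ℕ
      edge v w = κ ℕ.* [ ((l * v) * w) ∈? B ]ᵈ
      edge-sym : ∀ v w → edge v w ≡ edge w v
      edge-sym v w = cong (λ z → κ ℕ.* [ z ∈? B ]ᵈ) (e l v w)
        where
        e : ∀ l v w → (l * v) * w ≡ (l * w) * v
        e = solve 3 (λ l v w → (l :* v) :* w := (l :* w) :* v) refl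
      open MinimumDegree edge edge-sym (β ℕ.* β)
      deg≡ : ∀ Z w → deg Z w ≡ κ ℕ.* length (hits B (l * w) Z)
      deg≡ Z w = trans (∑-*ˡ Z κ _) (cong (κ ℕ.*_) (sym (length-filter-∑ (λ u → ((l * w) * u) ∈? B) Z)))
      L = filter unpop? B
      V = filter (¬? ∘ unpop?) B
      deg-split : ∀ w → deg B w ≡ deg V w ℕ.+ deg L w
      deg-split w = trans (∑-filter-split unpop? B (edge w)) (ℕ.+-comm (deg L w) (deg V w))
      V-deg : ∀ {w} → w ∈ V → β ℕ.* β ≤ deg V w ℕ.+ deg L w
      V-deg {w} w∈ = ≤-trans (≮⇒≥ (proj₂ (∈-filter⁻ (¬? ∘ unpop?) {xs = B} w∈)))
        (≤-reflexive (trans (sym (deg≡ B w)) (deg-split w)))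
      pruned = prune (length V) V L ≤-refl V-deg
      D = proj₁ pruned
      W = proj₁ (proj₂ pruned)
      V↭ : V ↭ D ++ W
      V↭ = proj₁ (proj₂ (proj₂ pruned))
      W⊆V : W ⊆ V
      W⊆V w∈ = ∈-resp-↭ (↭-sym V↭) (∈-++⁺ʳ D w∈)
      W⊆ : W ⊆ B
      W⊆ w∈ = proj₁ (∈-filter⁻ (¬? ∘ unpop?) {xs = B} (W⊆V w∈))
      W! : Unique W
      W! = unique-++ʳ D (↭ₛ.Unique-resp-↭ (setoid E) (↭⇒↭ₛ V↭) (Unique.filter⁺ (¬? ∘ unpop?) B!))
      good : ∀ {w} → w ∈ W → β ℕ.* β ≤ 4 ℕ.* (κ ℕ.* length (hits B (l * w) W))
      good {w} w∈ = ≤-trans (proj₁ (proj₂ (proj₂ (proj₂ pruned))) w∈) (≤-reflexive (cong (4 ℕ.*_) (deg≡ W w)))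
      -- Counted from the side of `L`, whose vertices have weighted degree below `β²` by
      -- unpopularity.
      edges : ∑ V (deg L) ≤ length L ℕ.* (β ℕ.* β)
      edges = begin
        ∑ V (deg L)                                ≡⟨ ∑-swap V L edge ⟩
        ∑ L (λ z → ∑ V (λ v → edge v z))           ≤⟨ ∑-mono L (λ {z} _ → ∑-mono V (λ {v} _ → ≤-reflexive (edge-sym v z))) ⟩
        ∑ L (deg V)                                ≤⟨ ∑-mono L (λ {z} z∈ → ≤-trans (m≤m+n (deg V z) (deg L z)) (low z∈)) ⟩
        ∑ L (λ _ → β ℕ.* β)                        ≡⟨ ∑-const L (β ℕ.* β) ⟩
        length L ℕ.* (β ℕ.* β)                     ∎
        where
        low : ∀ {z} → z ∈ L → deg V z ℕ.+ deg L z ≤ β ℕ.* β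
        low {z} z∈ = ≤-trans (≤-reflexive (trans (sym (deg-split z)) (deg≡ B z)))
          (<⇒≤ (proj₂ (∈-filter⁻ unpop? {xs = B} z∈)))
      D≤2L : length D ≤ 2 ℕ.* length L
      D≤2L = *-cancelˡ-≤ (β ℕ.* β) {{m*n≢0 β β {{β≢0}} {{β≢0}}}} (begin
        β ℕ.* β ℕ.* length D               ≤⟨ proj₂ (proj₂ (proj₂ (proj₂ pruned))) ⟩
        2 ℕ.* ∑ V (deg L)                  ≤⟨ *-monoʳ-≤ 2 edges ⟩
        2 ℕ.* (length L ℕ.* (β ℕ.* β))     ≡⟨ e (length L) (β ℕ.* β) ⟩
        β ℕ.* β ℕ.* (2 ℕ.* length L)       ∎)
        where
        β≢0 : NonZero β
        β≢0 = >-nonZero (∈-length b₀∈)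
        e : ∀ L b → 2 ℕ.* (L ℕ.* b) ≡ b ℕ.* (2 ℕ.* L)
        e = solve-∀
      size : β ≤ length W ℕ.+ 3 ℕ.* length L
      size = begin
        β                                            ≡⟨ sym (length-filter-split unpop? B) ⟩
        length L ℕ.+ length V                        ≡⟨ cong (length L ℕ.+_) (trans (↭-length V↭) (length-++ D)) ⟩
        length L ℕ.+ (length D ℕ.+ length W)         ≤⟨ +-monoʳ-≤ (length L) (+-monoˡ-≤ (length W) D≤2L) ⟩
        length L ℕ.+ (2 ℕ.* length L ℕ.+ length W)   ≡⟨ e (length L) (length W) ⟩
        length W ℕ.+ 3 ℕ.* length L                  ∎
        where
        e : ∀ l w → l ℕ.+ (2 ℕ.* l ℕ.+ w) ≡ w ℕ.+ 3 ℕ.* l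
        e = solve-∀

-- Collisions of `x + r u`

module Energies (F : DecField) where
  open DecField F
  open DifferenceSolver F
  open Cardinality _≟_
  open Sumsets F
  open Quotients F

  line : E → E × E → E
  line r (x , u) = x + r * u

  energy : E → List E → ℕ
  energy r W = length (Fibres.collisions _≟_ (line r) (cartesianProduct W W))

  -- Collisions within `X × U` are among those within `W × W`, so one energy bound for `W` serves
  -- whatever parts of it remain after covering.
  spread : ∀ {r W X U} → X ⊆ W → U ⊆ W → Unique X → Unique U →
           ∀ Z → (∀ {x u} → x ∈ X → u ∈ U → x + r * u ∈ Z) →
           (length X ℕ.* length U) ℕ.* (length X ℕ.* length U) ≤ card Z ℕ.* energy r W
  spread {r} {W} {X} {U} X⊆ U⊆ X! U! Z into = begin
    (length X ℕ.* length U) ℕ.* (length X ℕ.* length U)   ≡⟨ cong (λ z → z ℕ.* z) (sym (length-× X U)) ⟩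
    length XU ℕ.* length XU                               ≤⟨ cauchy-schwarz XU (set Z) XU! (λ p∈ → let x∈ , u∈ = ∈-cartesianProduct⁻ X U p∈ in ∈-set⁺ (into x∈ u∈)) ⟩
    card Z ℕ.* length (collisions XU)                     ≤⟨ *-monoʳ-≤ (card Z) (length-inj (collisions XU) (collisions WW) id (Unique.filter⁺ collide? (Unique.cartesianProduct⁺ XU! XU!)) sub (λ _ _ → id)) ⟩
    card Z ℕ.* energy r W                                 ∎
    where
    open ≤-Reasoning
    open Fibres _≟_ (line r)
    XU = cartesianProduct X U
    WW = cartesianProduct W W
    XU! : Unique XU
    XU! = Unique.cartesianProduct⁺ X! U!
    XU⊆ : ∀ {p} → p ∈ XU → p ∈ WW
    XU⊆ p∈ = let x∈ , u∈ = ∈-cartesianProduct⁻ X U p∈ in ∈-cartesianProduct⁺ (X⊆ x∈) (U⊆ u∈)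
    sub : ∀ {q} → q ∈ collisions XU → q ∈ collisions WW
    sub q∈ =
      let pq∈ , eq = ∈-filter⁻ collide? {xs = cartesianProduct XU XU} q∈
          p∈ , q∈′ = ∈-cartesianProduct⁻ XU XU pq∈
      in ∈-filter⁺ collide? (∈-cartesianProduct⁺ (XU⊆ p∈) (XU⊆ q∈′)) eq

  -- For p ≠ q in W × W at most one r gives line r p = line r q.
  low-energy : ∀ {r₀} W R → Unique W → r₀ ∈ R → length W ℕ.* length W ≤ card R →
               ∃ λ r → r ∈ R × energy r W ≤ 2 ℕ.* (length W ℕ.* length W)
  low-energy W R W! r₀∈ W²≤R =
    let r , r∈ , h = min-≤-average (set R) (λ r → energy r W) (∈-set⁺ r₀∈) in
    r , ∈-set⁻ R r∈ , *-cancelˡ-≤ ρ {{>-nonZero (card>0 r₀∈)}} (≤-trans h total)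
    where
    open ≤-Reasoning
    ρ = card R
    WW = cartesianProduct W W
    WW! : Unique WW
    WW! = Unique.cartesianProduct⁺ W! W!
    pairs = cartesianProduct WW WW
    same? : (q : (E × E) × (E × E)) → Dec (proj₁ q ≡ proj₂ q)
    same? (p , q) = ≡-dec _≟_ _≟_ p q
    meet? : (q : (E × E) × (E × E)) → Decidable (λ r → line r (proj₁ q) ≡ line r (proj₂ q))
    meet? (p , q) r = line r p ≟ line r q
    at-most-one : ∀ p q → ¬ p ≡ q → length (filter (meet? (p , q)) (set R)) ≤ 1
    at-most-one p@(x , u) q@(y , v) p≢q = length-inj (filter (meet? (p , q)) (set R)) (tt ∷ []) (λ _ → tt)
      (Unique.filter⁺ (meet? (p , q)) (set-unique R)) (λ _ → here refl)
      (λ r∈ s∈ _ → same (proj₂ (∈-filter⁻ (meet? (p , q)) {xs = set R} r∈)) (proj₂ (∈-filter⁻ (meet? (p , q)) {xs = set R} s∈)))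
      where
      e₁ : ∀ x u v r → (u - v) * r ≡ ((x + r * u) - r * v) - x
      e₁ = solve 4 (λ x u v r → (u :- v) :* r := ((x :+ r :* u) :- r :* v) :- x) refl
      e₂ : ∀ x y v r → ((y + r * v) - r * v) - x ≡ y - x
      e₂ = solve 4 (λ x y v r → ((y :+ r :* v) :- r :* v) :- x := y :- x) refl
      u≢v : ∀ r → x + r * u ≡ y + r * v → ¬ u - v ≡ 0#
      u≢v r eq u-v≡0 with x-y≡0⇒x≡y u-v≡0
      ... | refl = p≢q (cong (_, u) (+-injʳ (r * u) eq))
      slope : ∀ r → x + r * u ≡ y + r * v → (u - v) * r ≡ y - x
      slope r eq = trans (e₁ x u v r) (trans (cong (λ z → (z - r * v) - x) eq) (e₂ x y v r))
      same : ∀ {r s} → x + r * u ≡ y + r * v → x + s * u ≡ y + s * v → r ≡ s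
      same {r} {s} p₁ p₂ = *-injˡ (u≢v r p₁) (trans (slope r p₁) (sym (slope s p₂)))
    per-pair : ∀ q → ∑ (set R) (λ r → [ meet? q r ]ᵈ) ≤ ρ ℕ.* [ same? q ]ᵈ ℕ.+ 1
    per-pair (p , q) with ≡-dec _≟_ _≟_ p q
    ... | yes _  = ≤-trans (≤-trans (≤-reflexive (sym (length-filter-∑ (meet? (p , q)) (set R)))) (length-filter (meet? (p , q)) (set R)))
                     (≤-trans (≤-reflexive (sym (ℕ.*-identityʳ ρ))) (m≤m+n (ρ ℕ.* 1) 1))
    ... | no p≢q = ≤-trans (≤-reflexive (sym (length-filter-∑ (meet? (p , q)) (set R)))) (≤-trans (at-most-one p q p≢q) (m≤n+m 1 (ρ ℕ.* 0)))
    diagonal : ∑ pairs (λ q → [ same? q ]ᵈ) ≤ length WW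
    diagonal = ≤-trans (≤-reflexive (sym (length-filter-∑ same? pairs)))
      (length-inj (filter same? pairs) WW proj₁ (Unique.filter⁺ same? (Unique.cartesianProduct⁺ WW! WW!))
        (λ q∈ → proj₁ (∈-cartesianProduct⁻ WW WW (proj₁ (∈-filter⁻ same? {xs = pairs} q∈))))
        (λ p∈ q∈ eq → cong₂ _,_ eq (trans (sym (diag p∈)) (trans eq (diag q∈)))))
      where
      diag : ∀ {q} → q ∈ filter same? pairs → proj₁ q ≡ proj₂ q
      diag q∈ = proj₂ (∈-filter⁻ same? {xs = pairs} q∈)
    -- The diagonal contributes `ρ |W|²`. The other pairs contribute at most `|W|⁴`, which is no
    -- more than `ρ |W|²` because `|W|² ≤ ρ`.
    total : ∑ (set R) (λ r → energy r W) ≤ ρ ℕ.* (2 ℕ.* (length W ℕ.* length W))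
    total = begin
      ∑ (set R) (λ r → energy r W)                                  ≤⟨ ∑-mono (set R) (λ {r} _ → ≤-reflexive (length-filter-∑ (λ q → meet? q r) pairs)) ⟩
      ∑ (set R) (λ r → ∑ pairs (λ q → [ meet? q r ]ᵈ))              ≡⟨ ∑-swap (set R) pairs (λ r q → [ meet? q r ]ᵈ) ⟩
      ∑ pairs (λ q → ∑ (set R) (λ r → [ meet? q r ]ᵈ))              ≤⟨ ∑-mono pairs (λ {q} _ → per-pair q) ⟩
      ∑ pairs (λ q → ρ ℕ.* [ same? q ]ᵈ ℕ.+ 1)                      ≡⟨ ∑-+ pairs (λ q → ρ ℕ.* [ same? q ]ᵈ) (λ _ → 1) ⟩
      ∑ pairs (λ q → ρ ℕ.* [ same? q ]ᵈ) ℕ.+ ∑ pairs (λ _ → 1)      ≡⟨ cong₂ ℕ._+_ (∑-*ˡ pairs ρ (λ q → [ same? q ]ᵈ)) (trans (∑-const pairs 1) (ℕ.*-identityʳ (length pairs))) ⟩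
      ρ ℕ.* ∑ pairs (λ q → [ same? q ]ᵈ) ℕ.+ length pairs           ≤⟨ +-mono-≤ (*-monoʳ-≤ ρ diagonal) (≤-reflexive (length-× WW WW)) ⟩
      ρ ℕ.* length WW ℕ.+ length WW ℕ.* length WW                   ≤⟨ +-monoʳ-≤ (ρ ℕ.* length WW) (*-monoˡ-≤ (length WW) (≤-trans (≤-reflexive (length-× W W)) W²≤R)) ⟩
      ρ ℕ.* length WW ℕ.+ ρ ℕ.* length WW                           ≡⟨ e ρ (length WW) ⟩
      ρ ℕ.* (2 ℕ.* length WW)                                       ≡⟨ cong (λ z → ρ ℕ.* (2 ℕ.* z)) (length-× W W) ⟩
      ρ ℕ.* (2 ℕ.* (length W ℕ.* length W))                         ∎
      where
      e : ∀ r w → r ℕ.* w ℕ.+ r ℕ.* w ≡ r ℕ.* (2 ℕ.* w)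
      e = solve-∀

-- Arithmetic of the exponents

module Powers where
  open import Data.Nat using (_+_; _*_; _^_; _<?_)
  open import Data.Nat.Properties

  ^-distribʳ-* : ∀ m n o → (n * o) ^ m ≡ n ^ m * o ^ m
  ^-distribʳ-* zero    n o = refl
  ^-distribʳ-* (suc m) n o = trans (cong (n * o *_) (^-distribʳ-* m n o)) (interchange n o (n ^ m) (o ^ m))
    where
    interchange : ∀ a b c d → (a * b) * (c * d) ≡ (a * c) * (b * d)
    interchange = solve-∀

  collect-powers : ∀ m a k Q S → a * ((k * (Q * S)) ^ m * (2 * S) ^ 3) ≡ a * (k ^ m * 2 ^ 3) * (S ^ (m + 3) * Q ^ m)
  collect-powers m a k Q S = begin
    a * ((k * (Q * S)) ^ m * (2 * S) ^ 3)             ≡⟨ cong (a *_) (cong₂ _*_ (trans (^-distribʳ-* m k (Q * S)) (cong (k ^ m *_) (^-distribʳ-* m Q S))) (^-distribʳ-* 3 2 S)) ⟩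
    a * ((k ^ m * (Q ^ m * S ^ m)) * (2 ^ 3 * S ^ 3)) ≡⟨ e a (k ^ m) (Q ^ m) (S ^ m) (2 ^ 3) (S ^ 3) ⟩
    a * (k ^ m * 2 ^ 3) * ((S ^ m * S ^ 3) * Q ^ m)   ≡⟨ cong (λ z → a * (k ^ m * 2 ^ 3) * (z * Q ^ m)) (sym (^-distribˡ-+-* S m 3)) ⟩
    a * (k ^ m * 2 ^ 3) * (S ^ (m + 3) * Q ^ m)       ∎
    where
    open ≡-Reasoning
    e : ∀ a k q s t u → a * ((k * (q * s)) * (t * u)) ≡ a * (k * t) * ((s * u) * q)
    e = solve-∀

  opaque
    -- Here and below `c` measures the richness of slopes and `k` the cost of a cover, while `i`,
    -- `j` and `e` record what is lost in passing to covered parts. The factor `2 ^ 3` comes from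
    -- the bound on `N`; the 4 comes from `plünnecke₂`.
    C-sum : (c k j e : ℕ) → ℕ
    C-sum c k j e = c * j * (e * e) * 4 * (k ^ 3 * 2 ^ 3)

    C-product : (c k i j : ℕ) → ℕ
    C-product c k i j = c * i * (c * j) * (k ^ 3 * 2 ^ 3)

    C-field : (k e : ℕ) → ℕ
    C-field k e = e * e * (e * e) * 2 * (k ^ 4 * 2 ^ 3)

  module Arithmetic (n S Q c k N : ℕ) (N-bound : n * n * N ≤ (2 * S) ^ 3) where
    open ≤-Reasoning

    private
      n² : n ^ 2 ≡ n * n
      n² = cong (n *_) (*-identityʳ n)

      n¹² : n ^ 12 ≡ (n * n) * (n * n) * (n * n) ^ 4
      n¹² = trans (sym (^-*-assoc n 2 6)) (trans (cong (_^ 6) n²) (sym (*-assoc (n * n) (n * n) ((n * n) ^ 4))))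

    -- Each set of centres has at most `k Q S / n²` elements and `N ≤ (2S)³ / n²`; the four factors
    -- `n²` clear the denominators.
    three-centres : ∀ {t₁ t₂ t₃ V} → n * n * t₁ ≤ k * (Q * S) → n * n * t₂ ≤ k * (Q * S) → n * n * t₃ ≤ k * (Q * S) →
                    V ≤ t₁ * t₂ * t₃ * N → (n * n) ^ 4 * V ≤ (k * (Q * S)) ^ 3 * (2 * S) ^ 3
    three-centres {t₁} {t₂} {t₃} {V} h₁ h₂ h₃ hV = begin
      (n * n) ^ 4 * V                                                ≤⟨ *-monoʳ-≤ ((n * n) ^ 4) hV ⟩
      (n * n) ^ 4 * (t₁ * t₂ * t₃ * N)                               ≡⟨ e (n * n) t₁ t₂ t₃ N ⟩
      ((n * n * t₁) * (n * n * t₂) * (n * n * t₃)) * (n * n * N)     ≤⟨ *-mono-≤ (*-mono-≤ (*-mono-≤ h₁ h₂) h₃) N-bound ⟩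
      ((k * (Q * S)) * (k * (Q * S)) * (k * (Q * S))) * (2 * S) ^ 3  ≡⟨ cong (_* (2 * S) ^ 3) (cube (k * (Q * S))) ⟩
      (k * (Q * S)) ^ 3 * (2 * S) ^ 3                                ∎
      where
      e : ∀ m a b c d → (m * (m * (m * (m * 1)))) * (a * b * c * d) ≡ ((m * a) * (m * b) * (m * c)) * (m * d)
      e = solve-∀
      cube : ∀ m → m * m * m ≡ m * (m * (m * 1))
      cube = solve-∀

    four-centres : ∀ {t₁ t₂ t₃ t₄ V} → n * n * t₁ ≤ k * (Q * S) → n * n * t₂ ≤ k * (Q * S) → n * n * t₃ ≤ k * (Q * S) →
                   n * n * t₄ ≤ k * (Q * S) →
                   V ≤ t₁ * t₂ * t₃ * t₄ * N → (n * n) ^ 5 * V ≤ (k * (Q * S)) ^ 4 * (2 * S) ^ 3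
    four-centres {t₁} {t₂} {t₃} {t₄} {V} h₁ h₂ h₃ h₄ hV = begin
      (n * n) ^ 5 * V                                                ≤⟨ *-monoʳ-≤ ((n * n) ^ 5) hV ⟩
      (n * n) ^ 5 * (t₁ * t₂ * t₃ * t₄ * N)                          ≡⟨ e (n * n) t₁ t₂ t₃ t₄ N ⟩
      ((n * n * t₁) * (n * n * t₂) * (n * n * t₃) * (n * n * t₄)) * (n * n * N)
                                                                     ≤⟨ *-mono-≤ (*-mono-≤ (*-mono-≤ (*-mono-≤ h₁ h₂) h₃) h₄) N-bound ⟩
      ((k * (Q * S)) * (k * (Q * S)) * (k * (Q * S)) * (k * (Q * S))) * (2 * S) ^ 3
                                                                     ≡⟨ cong (_* (2 * S) ^ 3) (fourth (k * (Q * S))) ⟩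
      (k * (Q * S)) ^ 4 * (2 * S) ^ 3                                ∎
      where
      e : ∀ m a b c d f → (m * (m * (m * (m * (m * 1))))) * (a * b * c * d * f) ≡ ((m * a) * (m * b) * (m * c) * (m * d)) * (m * f)
      e = solve-∀
      fourth : ∀ m → m * m * m * m ≡ m * (m * (m * (m * 1)))
      fourth = solve-∀

    opaque
      unfolding C-sum C-product C-field

      -- With `u ≫ n²/Q` and `x ≫ n`, the lower bound for `V` is of order `n⁴ / (Q S)`; it meets the
      -- upper bound `S⁶ Q³ / n⁸`.
      case-sum : ∀ {x u V j e} → n * n ≤ c * (Q * (j * u)) → n ≤ e * x → u * (x * x) ≤ 4 * (V * S) →
                 (n * n) ^ 4 * V ≤ (k * (Q * S)) ^ 3 * (2 * S) ^ 3 →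
                 n ^ 12 ≤ C-sum c k j e * (S ^ 7 * Q ^ 4)
      case-sum {x} {u} {V} {j} {e} hu hx hi hV = begin
        n ^ 12                                                            ≡⟨ n¹² ⟩
        (n * n) * (n * n) * (n * n) ^ 4                                   ≤⟨ *-monoˡ-≤ ((n * n) ^ 4) (*-mono-≤ hu (*-mono-≤ hx hx)) ⟩
        (c * (Q * (j * u))) * ((e * x) * (e * x)) * (n * n) ^ 4           ≡⟨ e₂ c Q j u e x ((n * n) ^ 4) ⟩
        (c * j * (e * e) * Q * (n * n) ^ 4) * (u * (x * x))               ≤⟨ *-monoʳ-≤ (c * j * (e * e) * Q * (n * n) ^ 4) hi ⟩
        (c * j * (e * e) * Q * (n * n) ^ 4) * (4 * (V * S))               ≡⟨ e₃ (c * j * (e * e)) Q ((n * n) ^ 4) V S 4 ⟩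
        (c * j * (e * e) * 4 * Q * S) * ((n * n) ^ 4 * V)                 ≤⟨ *-monoʳ-≤ (c * j * (e * e) * 4 * Q * S) hV ⟩
        (c * j * (e * e) * 4 * Q * S) * ((k * (Q * S)) ^ 3 * (2 * S) ^ 3) ≡⟨ trans (collect-powers 3 (c * j * (e * e) * 4 * Q * S) k Q S) (e₄ (c * j * (e * e) * 4) Q S (k ^ 3 * 2 ^ 3) (S ^ 6) (Q ^ 3)) ⟩
        (c * j * (e * e) * 4 * (k ^ 3 * 2 ^ 3)) * (S ^ 7 * Q ^ 4)         ∎
        where
        e₂ : ∀ c Q j u e x m → (c * (Q * (j * u))) * ((e * x) * (e * x)) * m ≡ (c * j * (e * e) * Q * m) * (u * (x * x))
        e₂ = solve-∀
        e₃ : ∀ a Q m V S f → (a * Q * m) * (f * (V * S)) ≡ (a * f * Q * S) * (m * V)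
        e₃ = solve-∀
        e₄ : ∀ a Q S K s q → a * Q * S * K * (s * q) ≡ a * K * (S * s * (Q * q))
        e₄ = solve-∀

      -- Both sets have size `≫ n²/Q`, so `V ≫ n⁴ / Q²` meets `S⁶ Q³ / n⁸`. A factor `S` is
      -- exchanged for a factor `Q`, which is why the theorem has two alternatives.
      case-product : ∀ {x u V i j} → n * n ≤ c * (Q * (i * x)) → n * n ≤ c * (Q * (j * u)) → x * u ≤ V →
                     (n * n) ^ 4 * V ≤ (k * (Q * S)) ^ 3 * (2 * S) ^ 3 →
                     n ^ 12 ≤ C-product c k i j * (S ^ 6 * Q ^ 5)
      case-product {x} {u} {V} {i} {j} hx hu hi hV = begin
        n ^ 12                                                        ≡⟨ n¹² ⟩
        (n * n) * (n * n) * (n * n) ^ 4                               ≤⟨ *-monoˡ-≤ ((n * n) ^ 4) (*-mono-≤ hx hu) ⟩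
        (c * (Q * (i * x))) * (c * (Q * (j * u))) * (n * n) ^ 4       ≡⟨ e₂ c Q i x j u ((n * n) ^ 4) ⟩
        (c * i * (c * j) * Q * Q * (n * n) ^ 4) * (x * u)             ≤⟨ *-monoʳ-≤ (c * i * (c * j) * Q * Q * (n * n) ^ 4) hi ⟩
        (c * i * (c * j) * Q * Q * (n * n) ^ 4) * V                   ≡⟨ *-assoc (c * i * (c * j) * Q * Q) ((n * n) ^ 4) V ⟩
        (c * i * (c * j) * Q * Q) * ((n * n) ^ 4 * V)                 ≤⟨ *-monoʳ-≤ (c * i * (c * j) * Q * Q) hV ⟩
        (c * i * (c * j) * Q * Q) * ((k * (Q * S)) ^ 3 * (2 * S) ^ 3) ≡⟨ trans (collect-powers 3 (c * i * (c * j) * Q * Q) k Q S) (e₄ (c * i * (c * j)) Q (k ^ 3 * 2 ^ 3) (S ^ 6) (Q ^ 3)) ⟩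
        (c * i * (c * j) * (k ^ 3 * 2 ^ 3)) * (S ^ 6 * Q ^ 5)         ∎
        where
        e₂ : ∀ c Q i x j u m → (c * (Q * (i * x))) * (c * (Q * (j * u))) * m ≡ (c * i * (c * j) * Q * Q * m) * (x * u)
        e₂ = solve-∀
        e₄ : ∀ a Q K s q → a * Q * Q * K * (s * q) ≡ a * K * (s * (Q * (Q * q)))
        e₄ = solve-∀

      -- Here `V ≫ n²` meets `S⁷ Q⁴ / n¹⁰`, the fourth cover having added a factor `S Q / n²`.
      case-field : ∀ {x u V w e} → .{{NonZero n}} → n ≤ e * x → n ≤ e * u → w ≤ n → (x * u) * (x * u) ≤ V * (2 * (w * w)) →
                   (n * n) ^ 5 * V ≤ (k * (Q * S)) ^ 4 * (2 * S) ^ 3 →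
                   n ^ 12 ≤ C-field k e * (S ^ 7 * Q ^ 4)
      case-field {x} {u} {V} {w} {e} hx hu hw hi hV = *-cancelʳ-≤ _ _ (n * n) {{m*n≢0 n n}} (begin
        n ^ 12 * (n * n)                                                   ≡⟨ trans (cong (_* (n * n)) n¹²) (e₁ (n * n) ((n * n) ^ 4)) ⟩
        (n * n) ^ 5 * ((n * n) * (n * n))                                  ≤⟨ *-monoʳ-≤ ((n * n) ^ 5) (*-mono-≤ (*-mono-≤ hx hu) (*-mono-≤ hx hu)) ⟩
        (n * n) ^ 5 * ((e * x * (e * u)) * (e * x * (e * u)))              ≡⟨ e₂ ((n * n) ^ 5) e x u ⟩
        (e * e * (e * e) * (n * n) ^ 5) * ((x * u) * (x * u))              ≤⟨ *-monoʳ-≤ (e * e * (e * e) * (n * n) ^ 5) hi ⟩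
        (e * e * (e * e) * (n * n) ^ 5) * (V * (2 * (w * w)))              ≤⟨ *-monoʳ-≤ (e * e * (e * e) * (n * n) ^ 5) (*-monoʳ-≤ V (*-monoʳ-≤ 2 (*-mono-≤ hw hw))) ⟩
        (e * e * (e * e) * (n * n) ^ 5) * (V * (2 * (n * n)))              ≡⟨ e₃ (e * e * (e * e)) ((n * n) ^ 5) V 2 (n * n) ⟩
        (e * e * (e * e) * 2) * ((n * n) ^ 5 * V) * (n * n)                ≤⟨ *-monoˡ-≤ (n * n) (*-monoʳ-≤ (e * e * (e * e) * 2) hV) ⟩
        (e * e * (e * e) * 2) * ((k * (Q * S)) ^ 4 * (2 * S) ^ 3) * (n * n) ≡⟨ cong (_* (n * n)) (collect-powers 4 (e * e * (e * e) * 2) k Q S) ⟩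
        (e * e * (e * e) * 2 * (k ^ 4 * 2 ^ 3)) * (S ^ 7 * Q ^ 4) * (n * n) ∎)
        where
        e₁ : ∀ m p → m * m * p * m ≡ m * p * (m * m)
        e₁ = solve-∀
        e₂ : ∀ m e x u → m * ((e * x * (e * u)) * (e * x * (e * u))) ≡ (e * e * (e * e) * m) * ((x * u) * (x * u))
        e₂ = solve-∀
        e₃ : ∀ a m V t q → (a * m) * (V * (t * q)) ≡ (a * t) * (m * V) * q
        e₃ = solve-∀

open Powers

-- The three cases

module Dichotomy (F : DecField) where
  open DecField F
  open DifferenceSolver F
  open Cardinality _≟_
  open Sumsets F
  open Coverings F
  open Quotients F
  open Popularity F
  open Energies F

  private
    dilate-unique : ∀ {m} → ¬ m ≡ 0# → ∀ {Z} → Unique Z → Unique (map (m *_) Z)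
    dilate-unique m≢0 = Unique.map⁺ (*-injˡ m≢0)

    inv-* : ∀ {m} → ¬ m ≡ 0# → ∀ z → m * (inv m * z) ≡ z
    inv-* {m} m≢0 z = trans (sym (*-assoc m (inv m) z)) (trans (cong (_* z) (inverse m m≢0)) (*-identityˡ z))

    *-inv : ∀ {m} → ¬ m ≡ 0# → ∀ z → inv m * (m * z) ≡ z
    *-inv {m} m≢0 z = *-injˡ m≢0 (inv-* m≢0 (m * z))

  card-⊞ : ∀ X Y → card (X ⊞ Y) ≤ card X ℕ.* card Y
  card-⊞ X Y = subst (card (X ⊞ Y) ≤_) (trans (length-map _ pairs) (length-× (set X) (set Y)))
    (card≤length (X ⊞ Y) (map (λ p → proj₁ p + proj₂ p) pairs) sub)
    where
    pairs = cartesianProduct (set X) (set Y)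
    sub : X ⊞ Y ⊆ map (λ p → proj₁ p + proj₂ p) pairs
    sub z∈ with ⊞⁻ X Y z∈
    ... | x , y , x∈ , y∈ , refl = ∈-map⁺ (λ p → proj₁ p + proj₂ p) (∈-cartesianProduct⁺ (∈-set⁺ x∈) (∈-set⁺ y∈))

  card≤length-self : ∀ X → card X ≤ length X
  card≤length-self X = card≤length X X id

  module Cases
    (A B W : List E) (l : E) (γ : ℕ)
    (A≢0 : ∀ {a} → a ∈ A → ¬ a ≡ 0#) (l≢0 : ¬ l ≡ 0#)
    (B⊆A : B ⊆ A) (W⊆B : W ⊆ B) (W! : Unique W) (n>0 : 0 < card A)
    (sum-bound : card A ℕ.* card A ℕ.* card (B ⊞ (A ⊞ A) ⊞ A) ≤ (2 ℕ.* card (A ⊞ A)) ℕ.^ 3)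
    (dense : card A ≤ 3 ℕ.* length W)
    (rich : ∀ {w} → w ∈ W → card A ℕ.* card A ≤ γ ℕ.* (card (A ⊘ A) ℕ.* length (hits B (l * w) W)))
    where

    n = card A
    S = card (A ⊞ A)
    Q = card (A ⊘ A)
    N = card (B ⊞ (A ⊞ A) ⊞ A)

    open Arithmetic n S Q γ (2 ℕ.* γ) N sum-bound

    private
      R = quotients W

      W⊆A : W ⊆ A
      W⊆A = B⊆A ∘ W⊆B

      lw≢0 : ∀ {w} → w ∈ W → ¬ l * w ≡ 0#
      lw≢0 w∈ = *≢0 l≢0 (A≢0 (W⊆A w∈))

      hits⁻ : ∀ {m u} → u ∈ hits B m W → u ∈ W × m * u ∈ B
      hits⁻ {m} = ∈-filter⁻ (λ u → (m * u) ∈? B) {xs = W}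

      hits! : ∀ m → Unique (hits B m W)
      hits! m = Unique.filter⁺ (λ u → (m * u) ∈? B) W!

      hits>0 : ∀ {w} → w ∈ W → 0 < length (hits B (l * w) W)
      hits>0 {w} w∈ = ℕ.n≢0⇒n>0 (λ eq → <-irrefl refl (begin-strict
        0                                             <⟨ ℕ.*-mono-< n>0 n>0 ⟩
        n ℕ.* n                                       ≤⟨ rich w∈ ⟩
        γ ℕ.* (Q ℕ.* length (hits B (l * w) W))       ≡⟨ cong (λ z → γ ℕ.* (Q ℕ.* z)) eq ⟩
        γ ℕ.* (Q ℕ.* 0)                               ≡⟨ cong (γ ℕ.*_) (*-zeroʳ Q) ⟩
        γ ℕ.* 0                                       ≡⟨ *-zeroʳ γ ⟩
        0                                             ∎))
        where open ≤-Reasoning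

    -- A half cover of a dilate of `Z`, recorded on `Z` itself, with the number of centres bounded
    -- through the richness of the slope.
    record Approx (Near : E → E → Set) (Z : List E) : Set where
      field
        part    : List E
        centres : List E
        part⊆   : part ⊆ Z
        unique  : Unique part
        half    : length Z ≤ 2 ℕ.* length part
        few     : n ℕ.* n ℕ.* length centres ≤ 2 ℕ.* γ ℕ.* (Q ℕ.* S)
        near    : ∀ {z} → z ∈ part → ∃ λ t → t ∈ centres × Near t z

    module _ {w : E} (w∈ : w ∈ W) {Z : List E} (Z! : Unique Z) (Z⊆A : Z ⊆ A) where
      private
        m = l * w
        m≢0 = lw≢0 w∈
        H = hits B m W
        -- This set lies both in `m A` and in `B`. The first inclusion puts `m Z + Y` inside
        -- `m (A + A)`, of size at most `S`; the second lets a cover by translates of `Y` pass for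
        -- one by translates of `B`. Richness gives `|Y| ≫ n²/Q`, hence `≪ S Q / n²` centres.
        Y = map (m *_) H
        mZ! : Unique (map (m *_) Z)
        mZ! = dilate-unique m≢0 Z!
        Y! : Unique Y
        Y! = dilate-unique m≢0 (hits! m)
        Y⊆B : Y ⊆ B
        Y⊆B y∈ with ∈-map⁻ (m *_) y∈
        ... | u , u∈ , refl = proj₂ (hits⁻ u∈)
        Y-inhabited : ∃ λ y → y ∈ Y
        Y-inhabited = nonempty Y (subst (0 <_) (sym (length-map (m *_) H)) (hits>0 w∈))
          where
          nonempty : ∀ (L : List E) → 0 < length L → ∃ λ z → z ∈ L
          nonempty (z ∷ _) _ = z , here refl
        mZ+Y≤S : card (map (m *_) Z ⊞ Y) ≤ S
        mZ+Y≤S = ≤-trans (card-mono sub) (card-map (m *_) (A ⊞ A))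
          where
          sub : map (m *_) Z ⊞ Y ⊆ map (m *_) (A ⊞ A)
          sub p with ⊞⁻ (map (m *_) Z) Y p
          ... | _ , _ , z∈ , y∈ , refl with ∈-map⁻ (m *_) z∈ | ∈-map⁻ (m *_) y∈
          ...   | z , z∈′ , refl | u , u∈ , refl = subst (_∈ map (m *_) (A ⊞ A)) (distribˡ m z u)
                    (∈-map⁺ (m *_) (⊞⁺ (Z⊆A z∈′) (W⊆A (proj₁ (hits⁻ u∈)))))

        pull-back : ∀ {Near Near′ : E → E → Set} → (∀ {t z} → Near t (m * z) → Near′ t z) →
                    HalfCovered Near (map (m *_) Z) (length Y) S → Approx Near′ Z
        pull-back {Near} {Near′} weaken h = record
          { part    = map (inv m *_) (part h)
          ; centres = centres h
          ; part⊆   = part⊆Z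
          ; unique  = dilate-unique (inv≢0 m≢0) (unique h)
          ; half    = subst₂ (λ a b → a ≤ 2 ℕ.* b) (length-map (m *_) Z) (sym (length-map (inv m *_) (part h))) (half h)
          ; few     = begin
              n ℕ.* n ℕ.* t                      ≤⟨ *-monoˡ-≤ t (rich w∈) ⟩
              γ ℕ.* (Q ℕ.* length H) ℕ.* t       ≡⟨ e₁ γ Q (length H) t ⟩
              γ ℕ.* Q ℕ.* (t ℕ.* length H)       ≡⟨ cong (λ z → γ ℕ.* Q ℕ.* (t ℕ.* z)) (sym (length-map (m *_) H)) ⟩
              γ ℕ.* Q ℕ.* (t ℕ.* length Y)       ≤⟨ *-monoʳ-≤ (γ ℕ.* Q) (few h) ⟩
              γ ℕ.* Q ℕ.* (2 ℕ.* S)              ≡⟨ e₂ γ Q S ⟩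
              2 ℕ.* γ ℕ.* (Q ℕ.* S)              ∎
          ; near    = near
          }
          where
          open ≤-Reasoning
          open HalfCovered
          t = length (centres h)
          e₁ : ∀ c q a t → c ℕ.* (q ℕ.* a) ℕ.* t ≡ c ℕ.* q ℕ.* (t ℕ.* a)
          e₁ = solve-∀
          e₂ : ∀ c q s → c ℕ.* q ℕ.* (2 ℕ.* s) ≡ 2 ℕ.* c ℕ.* (q ℕ.* s)
          e₂ = solve-∀
          part⊆Z : map (inv m *_) (part h) ⊆ Z
          part⊆Z z∈ with ∈-map⁻ (inv m *_) z∈
          ... | p , p∈ , refl with ∈-map⁻ (m *_) (part⊆ h p∈)
          ...   | z , z∈′ , refl = subst (_∈ Z) (sym (*-inv m≢0 z)) z∈′
          near : ∀ {z} → z ∈ map (inv m *_) (part h) → ∃ λ t → t ∈ centres h × Near′ t z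
          near z∈ with ∈-map⁻ (inv m *_) z∈
          ... | p , p∈ , refl with covered h p∈
          ...   | t , t∈ , q = t , t∈ , weaken (subst (Near t) (sym (inv-* m≢0 p)) q)

      opaque
        -- Terms entering the identity of `combine` with a plus sign use this reflected form, those
        -- with a minus sign use `approx⁺`. All four errors then lie in `-B`, so a sumset bound
        -- suffices and no difference set occurs.
        approx⁻ : Approx (λ t z → t - (l * w) * z ∈ B) Z
        approx⁻ = pull-back Y⊆B (cover-by-reflections mZ! Y! (proj₂ Y-inhabited) S mZ+Y≤S)

        approx⁺ : Approx (λ t z → (l * w) * z - t ∈ B) Z
        approx⁺ = pull-back Y⊆B (cover-by-translates mZ! Y! (proj₂ Y-inhabited) S mZ+Y≤S)

    open Approx

    -- With s = (a - b) / (c - d), multiplying x + s u by l (c - d) gives l c x - l d x + l a u - l b u.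
    combine : ∀ {s} (q : Quotient W s) (X U T₁ T₂ T₃ T₄ : List E) → let open Quotient q in
              (∀ {x} → x ∈ X → ∃ λ t → t ∈ T₁ × t - (l * c) * x ∈ B) →
              (∀ {u} → u ∈ U → ∃ λ t → t ∈ T₂ × t - (l * a) * u ∈ B) →
              (∀ {x} → x ∈ X → ∃ λ t → t ∈ T₃ × (l * d) * x - t ∈ B) →
              (∀ {u} → u ∈ U → ∃ λ t → t ∈ T₄ × (l * b) * u - t ∈ B) →
              card (X ⊞ map (s *_) U) ≤ length T₁ ℕ.* length T₂ ℕ.* length T₃ ℕ.* length T₄ ℕ.* N
    combine {s} q X U T₁ T₂ T₃ T₄ h₁ h₂ h₃ h₄ = begin
      card V                                         ≤⟨ card-map-inj (δ *_) V (*-injˡ (*≢0 l≢0 c-d≢0)) ⟩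
      card (map (δ *_) V)                            ≤⟨ card-mono sub ⟩
      card (T₁ ⊞ T₂ ⊞ map -_ T₃ ⊞ map -_ T₄ ⊞ map -_ D) ≤⟨ ≤-trans (card-⊞ (T₁ ⊞ T₂ ⊞ map -_ T₃ ⊞ map -_ T₄) (map -_ D))
                                                            (*-mono-≤ (≤-trans (card-⊞ (T₁ ⊞ T₂ ⊞ map -_ T₃) (map -_ T₄))
                                                              (*-mono-≤ (≤-trans (card-⊞ (T₁ ⊞ T₂) (map -_ T₃))
                                                                (*-mono-≤ (≤-trans (card-⊞ T₁ T₂)
                                                                  (*-mono-≤ (card≤length-self T₁) (card≤length-self T₂)))
                                                                  (≤-trans (card-map -_ T₃) (card≤length-self T₃))))
                                                                (≤-trans (card-map -_ T₄) (card≤length-self T₄))))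
                                                              (card-map -_ D)) ⟩
      length T₁ ℕ.* length T₂ ℕ.* length T₃ ℕ.* length T₄ ℕ.* N ∎
      where
      open ≤-Reasoning
      open Quotient q renaming (c to c′)
      δ = l * (c′ - d)
      V = X ⊞ map (s *_) U
      D = B ⊞ (A ⊞ A) ⊞ A
      e₁ : ∀ l c d s x u → l * (c - d) * (x + s * u) ≡ l * (c - d) * x + l * (s * (c - d)) * u
      e₁ = solve 6 (λ l c d s x u → l :* (c :- d) :* (x :+ s :* u) := l :* (c :- d) :* x :+ l :* (s :* (c :- d)) :* u) refl
      e₂ : ∀ l a b c d x u t₁ t₂ t₃ t₄ → l * (c - d) * x + l * (a - b) * u ≡
             (((t₁ + t₂) + - t₃) + - t₄) + - (((t₁ - (l * c) * x) + ((t₂ - (l * a) * u) + ((l * d) * x - t₃))) + ((l * b) * u - t₄))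
      e₂ = solve 11 (λ l a b c d x u t₁ t₂ t₃ t₄ → l :* (c :- d) :* x :+ l :* (a :- b) :* u :=
             (((t₁ :+ t₂) :+ :- t₃) :+ :- t₄) :+ :- (((t₁ :- (l :* c) :* x) :+ ((t₂ :- (l :* a) :* u) :+ ((l :* d) :* x :- t₃))) :+ ((l :* b) :* u :- t₄))) refl
      sub : map (δ *_) V ⊆ T₁ ⊞ T₂ ⊞ map -_ T₃ ⊞ map -_ T₄ ⊞ map -_ D
      sub v∈ with ∈-map⁻ (δ *_) v∈
      ... | v , v∈′ , refl with ⊞⁻ X (map (s *_) U) v∈′
      ...   | x , _ , x∈ , su∈ , refl with ∈-map⁻ (s *_) su∈
      ...     | u , u∈ , refl with h₁ x∈ | h₂ u∈ | h₃ x∈ | h₄ u∈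
      ...       | t₁ , t₁∈ , b₁∈ | t₂ , t₂∈ , b₂∈ | t₃ , t₃∈ , b₃∈ | t₄ , t₄∈ , b₄∈ =
        subst (_∈ T₁ ⊞ T₂ ⊞ map -_ T₃ ⊞ map -_ T₄ ⊞ map -_ D)
          (sym (trans (e₁ l c′ d s x u) (trans (cong (λ z → l * (c′ - d) * x + l * z * u) eq) (e₂ l a b c′ d x u t₁ t₂ t₃ t₄))))
          (⊞⁺ (⊞⁺ (⊞⁺ (⊞⁺ t₁∈ t₂∈) (∈-map⁺ -_ t₃∈)) (∈-map⁺ -_ t₄∈))
              (∈-map⁺ -_ (⊞⁺ (⊞⁺ b₁∈ (⊞⁺ (B⊆A b₂∈) (B⊆A b₃∈))) (B⊆A b₄∈))))

    private
      -- The single centre 0 stands in for a cover where the variable is already restricted to hits,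
      -- so the corresponding factor in `combine` is 1.
      exact : ∀ {m U} → (∀ {u} → u ∈ U → m * u ∈ B) → ∀ {u} → u ∈ U → ∃ λ t → t ∈ 0# ∷ [] × m * u - t ∈ B
      exact {m} h {u} u∈ = 0# , here refl , subst (_∈ B) (e (m * u)) (h u∈)
        where
        e : ∀ z → z ≡ z - 0#
        e z = sym (trans (cong (z +_) (-0#≈0#)) (+-identityʳ z))
          where open Algebra.Properties.Ring ring using (-0#≈0#)

      one-at-3 : ∀ a b c d → a ℕ.* b ℕ.* 1 ℕ.* c ℕ.* d ≡ a ℕ.* b ℕ.* c ℕ.* d
      one-at-3 = solve-∀

      one-at-4 : ∀ a b c d → a ℕ.* b ℕ.* c ℕ.* 1 ℕ.* d ≡ a ℕ.* b ℕ.* c ℕ.* d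
      one-at-4 = solve-∀

      scale : ∀ {h u} j → n ℕ.* n ≤ γ ℕ.* (Q ℕ.* h) → h ≤ j ℕ.* u → n ℕ.* n ≤ γ ℕ.* (Q ℕ.* (j ℕ.* u))
      scale j p q = ≤-trans p (*-monoʳ-≤ γ (*-monoʳ-≤ Q q))

      halves : ∀ {a b d} → a ≤ 2 ℕ.* b → b ≤ 2 ℕ.* d → a ≤ 4 ℕ.* d
      halves {d = d} p q = ≤-trans p (≤-trans (*-monoʳ-≤ 2 q) (≤-reflexive (sym (ℕ.*-assoc 2 2 d))))

      twelfth : ∀ {x} → length W ≤ 4 ℕ.* x → n ≤ 12 ℕ.* x
      twelfth {x} p = ≤-trans dense (≤-trans (*-monoʳ-≤ 3 p) (≤-reflexive (sym (ℕ.*-assoc 3 4 x))))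

      half>0 : ∀ {a b} → 0 < a → a ≤ 2 ℕ.* b → 0 < b
      half>0 {b = zero}  pos le = ≤-trans pos le
      half>0 {b = suc _} _   _  = s≤s z≤n

    -- Injectivity concerns `x + u + s u`, while `combine` controls only `X + s U`. On a subset `X'`
    -- of `X`, `plünnecke₂` separates the two summands: `|X'||U| ≤ |X' + U + s U| ≤ 4 |X + U||X + s
    -- U||X'| / |X|²`, and `X + U` lies in `A + A`. The term with `b` is the one left uncovered.
    1+s∉R⇒ : ∀ {s} → s ∈ R → 1# + s ∉ R →
             n ℕ.^ 12 ≤ C-sum γ (2 ℕ.* γ) 2 12 ℕ.* (S ℕ.^ 7 ℕ.* Q ℕ.^ 4)
    -- `U` is half of a set of hits, which gives 2; `X` comes from `W` by two halvings and
    -- `n ≤ 3 |W|`, which gives 12.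
    1+s∉R⇒ {s} s∈ r∉ = case-sum {length X} {length U} {V} {2} {12} (scale {_} {length U} 2 (rich b∈) (half PU)) (twelfth {length X} (halves {length W} {length (part PX₁)} {length X} (half PX₁) (half PX))) spread-out
      (three-centres {length (centres PX₁)} {length (centres PU)} {length (centres PX)} {V} (few PX₁) (few PU) (few PX)
        (≤-trans (combine q X U (centres PX₁) (centres PU) (centres PX) (0# ∷ []) (near PX₁ ∘ part⊆ PX) (near PU) (near PX)
            (exact (proj₂ ∘ hits⁻ ∘ part⊆ PU)))
          (≤-reflexive (one-at-4 (length (centres PX₁)) (length (centres PU)) (length (centres PX)) N))))
      where
      q = ∈-quotients⁻ {W} s∈
      open Quotient q renaming (c to c′)
      PX₁ = approx⁻ c∈ W! W⊆A
      PX  = approx⁺ d∈ (unique PX₁) (W⊆A ∘ part⊆ PX₁)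
      X   = part PX
      PU  = approx⁻ a∈ (hits! (l * b)) (W⊆A ∘ proj₁ ∘ hits⁻)
      U   = part PU
      X⊆W : X ⊆ W
      X⊆W = part⊆ PX₁ ∘ part⊆ PX
      U⊆W : U ⊆ W
      U⊆W = proj₁ ∘ hits⁻ ∘ part⊆ PU
      V = card (X ⊞ map (s *_) U)
      W>0 : 0 < length W
      W>0 = ∈-length a∈
      inhabited′ : ∀ (L : List E) → 0 < length L → ∃ λ z → z ∈ L
      inhabited′ (z ∷ _) _ = z , here refl
      x₀ = inhabited′ X (half>0 (half>0 W>0 (half PX₁)) (half PX))
      u₀ = inhabited′ U (half>0 (hits>0 b∈) (half PU))
      spread-out : length U ℕ.* (length X ℕ.* length X) ≤ 4 ℕ.* (V ℕ.* S)
      spread-out =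
        let X′ , X′⊆X , X′>0 , h = plünnecke₂ X (map (s *_) U) U (proj₂ x₀) (∈-map⁺ (s *_) (proj₂ u₀)) (proj₂ u₀) in
        *-cancelʳ-≤ (length U ℕ.* (length X ℕ.* length X)) (4 ℕ.* (V ℕ.* S)) (card X′) {{>-nonZero X′>0}} (begin
          length U ℕ.* (length X ℕ.* length X) ℕ.* card X′            ≡⟨ e (length U) (length X) (card X′) ⟩
          card X′ ℕ.* length U ℕ.* (length X ℕ.* length X)            ≤⟨ *-monoˡ-≤ (length X ℕ.* length X) (inj X′ X′⊆X) ⟩
          card (X′ ⊞ U ⊞ map (s *_) U) ℕ.* (length X ℕ.* length X)    ≡⟨ cong (λ z → card (X′ ⊞ U ⊞ map (s *_) U) ℕ.* (z ℕ.* z)) (sym (card-unique (unique PX))) ⟩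
          card (X′ ⊞ U ⊞ map (s *_) U) ℕ.* (card X ℕ.* card X)        ≤⟨ h ⟩
          4 ℕ.* (V ℕ.* card (X ⊞ U)) ℕ.* card X′                      ≤⟨ *-monoˡ-≤ (card X′) (*-monoʳ-≤ 4 (*-monoʳ-≤ V (card-mono (⊞-mono {X} {A} {U} {A} (W⊆A ∘ X⊆W) (W⊆A ∘ U⊆W))))) ⟩
          4 ℕ.* (V ℕ.* S) ℕ.* card X′                                 ∎)
        where
        open ≤-Reasoning
        e : ∀ u x z → u ℕ.* (x ℕ.* x) ℕ.* z ≡ z ℕ.* u ℕ.* (x ℕ.* x)
        e = solve-∀
        inj : ∀ X′ → X′ ⊆ X → card X′ ℕ.* length U ≤ card (X′ ⊞ U ⊞ map (s *_) U)
        inj X′ X′⊆X = non-quotient-injective r∉ {set X′} (X⊆W ∘ X′⊆X ∘ ∈-set⁻ X′) U⊆W (set-unique X′) (unique PU) _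
          (λ {x} {u} x∈ u∈ → subst (_∈ X′ ⊞ U ⊞ map (s *_) U)
            (trans (+-assoc x u (s * u)) (cong (x +_) (sym (trans (distribʳ u 1# s) (cong (_+ s * u) (*-identityˡ u))))))
            (⊞⁺ (⊞⁺ (∈-set⁻ X′ x∈) u∈) (∈-map⁺ (s *_) u∈)))

    -- Since `x + (m s) u = x + s (m u)`, the set `Y = m U` takes the place of `U` in `combine`.
    -- Taking `U` among the hits of `m` puts `Y` inside `A`, where it can be covered. The term with
    -- `d` is left uncovered by taking `X` among the hits of `l d`.
    ms∉R⇒ : ∀ {w s} → w ∈ W → s ∈ R → (l * w) * s ∉ R →
            n ℕ.^ 12 ≤ C-product γ (2 ℕ.* γ) 2 4 ℕ.* (S ℕ.^ 6 ℕ.* Q ℕ.^ 5)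
    -- `X` results from one halving of a set of hits and `Y` from two, whence 2 and 4.
    ms∉R⇒ {w} {s} w∈ s∈ r∉ = case-product {length X} {length U} {V} {2} {4} (scale {_} {length X} 2 (rich d∈) (half PX))
      (scale {length H} {length U} 4 (rich w∈) (subst₂ (λ y z → y ≤ 4 ℕ.* z) (length-map (m *_) H) (sym (length-map (inv m *_) Y))
        (halves {length (map (m *_) H)} {length (part PY₁)} {length Y} (half PY₁) (half PY))))
      spread-out
      (three-centres {length (centres PX)} {length (centres PY₁)} {length (centres PY)} {V} (few PX) (few PY₁) (few PY)
        (≤-trans (combine q X Y (centres PX) (centres PY₁) (0# ∷ []) (centres PY) (near PX) (near PY₁ ∘ part⊆ PY)
            (exact (proj₂ ∘ hits⁻ ∘ part⊆ PX)) (near PY))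
          (≤-reflexive (one-at-3 (length (centres PX)) (length (centres PY₁)) (length (centres PY)) N))))
      where
      q = ∈-quotients⁻ {W} s∈
      open Quotient q renaming (c to c′)
      m = l * w
      m≢0 = lw≢0 w∈
      H = hits B m W
      PX  = approx⁻ c∈ (hits! (l * d)) (W⊆A ∘ proj₁ ∘ hits⁻)
      X   = part PX
      mH⊆A : map (m *_) H ⊆ A
      mH⊆A y∈ with ∈-map⁻ (m *_) y∈
      ... | u , u∈ , refl = B⊆A (proj₂ (hits⁻ u∈))
      PY₁ = approx⁻ a∈ (dilate-unique m≢0 (hits! m)) mH⊆A
      PY  = approx⁺ b∈ (unique PY₁) (mH⊆A ∘ part⊆ PY₁)
      Y   = part PY
      U   = map (inv m *_) Y
      U⊆W : U ⊆ W
      U⊆W u∈ with ∈-map⁻ (inv m *_) u∈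
      ... | y , y∈ , refl with ∈-map⁻ (m *_) (part⊆ PY₁ (part⊆ PY y∈))
      ...   | u , u∈′ , refl = subst (_∈ W) (sym (*-inv m≢0 u)) (proj₁ (hits⁻ u∈′))
      V = card (X ⊞ map (s *_) Y)
      spread-out : length X ℕ.* length U ≤ V
      spread-out = non-quotient-injective r∉ (proj₁ ∘ hits⁻ ∘ part⊆ PX) U⊆W (unique PX)
        (dilate-unique (inv≢0 m≢0) (unique PY)) _ into
        where
        e : ∀ m s u → (m * s) * u ≡ s * (m * u)
        e = solve 3 (λ m s u → (m :* s) :* u := s :* (m :* u)) refl
        into : ∀ {x u} → x ∈ X → u ∈ U → x + (m * s) * u ∈ X ⊞ map (s *_) Y
        into {x} x∈ u∈ with ∈-map⁻ (inv m *_) u∈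
        ... | y , y∈ , refl = ⊞⁺ x∈ (subst (_∈ map (s *_) Y)
              (sym (trans (e m s (inv m * y)) (cong (s *_) (inv-* m≢0 y)))) (∈-map⁺ (s *_) y∈))

    -- Nearly injective means `|X + s U| ≥ (|X||U|)² / (2 |W|²)`, which has order `n²` only if `X`
    -- and `U` are both dense in `W`. Hence neither is restricted to hits, and all four terms are
    -- covered.
    low-energy⇒ : ∀ {s} → s ∈ R → energy s W ≤ 2 ℕ.* (length W ℕ.* length W) →
                  n ℕ.^ 12 ≤ C-field (2 ℕ.* γ) 12 ℕ.* (S ℕ.^ 7 ℕ.* Q ℕ.^ 4)
    low-energy⇒ {s} s∈ low = case-field {length X} {length U} {V} {length W} {12} {{>-nonZero n>0}}
      (twelfth {length X} (halves {length W} {length (part PX₁)} {length X} (half PX₁) (half PX)))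
      (twelfth {length U} (halves {length W} {length (part PU₁)} {length U} (half PU₁) (half PU)))
      (≤-trans (≤-reflexive (sym (card-unique W!))) (card-mono W⊆A))
      (≤-trans (spread (part⊆ PX₁ ∘ part⊆ PX) (part⊆ PU₁ ∘ part⊆ PU) (unique PX) (unique PU) (X ⊞ map (s *_) U)
                 (λ x∈ u∈ → ⊞⁺ x∈ (∈-map⁺ (s *_) u∈)))
               (*-monoʳ-≤ V low))
      (four-centres {length (centres PX₁)} {length (centres PU₁)} {length (centres PX)} {length (centres PU)} {V}
        (few PX₁) (few PU₁) (few PX) (few PU)
        (combine q X U (centres PX₁) (centres PU₁) (centres PX) (centres PU) (near PX₁ ∘ part⊆ PX) (near PU₁ ∘ part⊆ PU) (near PX) (near PU)))
      where
      q = ∈-quotients⁻ {W} s∈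
      open Quotient q renaming (c to c′)
      PX₁ = approx⁻ c∈ W! W⊆A
      PX  = approx⁺ d∈ (unique PX₁) (W⊆A ∘ part⊆ PX₁)
      X   = part PX
      PU₁ = approx⁻ a∈ W! W⊆A
      PU  = approx⁺ b∈ (unique PU₁) (W⊆A ∘ part⊆ PU₁)
      U   = part PU
      V   = card (X ⊞ map (s *_) U)

-- Constants, and the choice among the cases

opaque
  -- The product of 4 from `n² ≤ 4 β²`, 4 from the degree kept by pruning and 12 from the popularity
  -- threshold `κ = 12 Q`.
  γ : ℕ
  γ = 192

  γ-def : ∀ q h → 4 ℕ.* (4 ℕ.* (12 ℕ.* q ℕ.* h)) ≡ γ ℕ.* (q ℕ.* h)
  γ-def = solve-∀

-- The summand `2 ^ 12` absorbs the sets of at most two elements.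
C₁ C₂ C₃ constant : ℕ
C₁       = C-sum γ (2 ℕ.* γ) 2 12
C₂       = C-product γ (2 ℕ.* γ) 2 4
C₃       = C-field (2 ℕ.* γ) 12
constant = C₁ ℕ.+ (C₂ ℕ.+ (C₃ ℕ.+ 2 ℕ.^ 12))

C₁≤ : C₁ ≤ constant
C₁≤ = m≤m+n C₁ _

C₂≤ : C₂ ≤ constant
C₂≤ = ≤-trans (m≤m+n C₂ _) (m≤n+m _ C₁)

C₃≤ : C₃ ≤ constant
C₃≤ = ≤-trans (m≤m+n C₃ _) (≤-trans (m≤n+m _ C₂) (m≤n+m _ C₁))

2¹²≤ : 2 ℕ.^ 12 ≤ constant
2¹²≤ = ≤-trans (m≤n+m (2 ℕ.^ 12) C₃) (≤-trans (m≤n+m _ C₂) (m≤n+m _ C₁))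

module SumProduct (F : DecField) where
  open DecField F
  open Cardinality _≟_
  open Sumsets F
  open Quotients F
  open Popularity F
  open Energies F
  open Dichotomy F

  module _ (A : List E) {a₀ : E} (A≢0 : ∀ {a} → a ∈ A → ¬ a ≡ 0#) (a₀∈ : a₀ ∈ A)
           (subfields : ∀ R l W → Subfield R → ¬ l ≡ 0# → W ⊆ A → Unique W → (∀ {w} → w ∈ W → l * w ∈ R) →
                        length W ℕ.* length W ≤ card R ⊎ 8 ℕ.* length W ≤ card A) where
    private
      n = card A
      S = card (A ⊞ A)
      Q = card (A ⊘ A)

      n>0 : 0 < n
      n>0 = card>0 a₀∈

      Conclusion : Set
      Conclusion = n ℕ.^ 12 ≤ constant ℕ.* (S ℕ.^ 7 ℕ.* Q ℕ.^ 4) ⊎ n ℕ.^ 12 ≤ constant ℕ.* (S ℕ.^ 6 ℕ.* Q ℕ.^ 5)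

      record Core : Set where
        field
          {B W}     : List E
          {l}       : E
          l≢0       : ¬ l ≡ 0#
          B⊆A       : B ⊆ A
          W⊆B       : W ⊆ B
          W!        : Unique W
          sum-bound : n ℕ.* n ℕ.* card (B ⊞ (A ⊞ A) ⊞ A) ≤ (2 ℕ.* S) ℕ.^ 3
          size      : 3 ℕ.* n ≤ 8 ℕ.* length W
          rich      : ∀ {w} → w ∈ W → n ℕ.* n ≤ γ ℕ.* (Q ℕ.* length (hits B (l * w) W))

      -- Here the popularity parameter 12 is decisive: the loss is at most `3 β / 12`, so
      -- `|W| ≥ 3 β / 4 ≥ 3 n / 8`, safely more than `n / 8`.
      size-arith : ∀ n β w L → n ≤ 2 ℕ.* β → 12 ℕ.* L ≤ β → β ≤ w ℕ.+ 3 ℕ.* L → 3 ℕ.* n ≤ 8 ℕ.* w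
      size-arith n β w L h₁ h₂ h₃ = ≤-trans (*-monoʳ-≤ 3 h₁) (ℕ.+-cancelʳ-≤ (2 ℕ.* β) _ _ (begin
        3 ℕ.* (2 ℕ.* β) ℕ.+ 2 ℕ.* β      ≡⟨ e₁ β ⟩
        8 ℕ.* β                          ≤⟨ *-monoʳ-≤ 8 h₃ ⟩
        8 ℕ.* (w ℕ.+ 3 ℕ.* L)            ≡⟨ e₂ w L ⟩
        8 ℕ.* w ℕ.+ 2 ℕ.* (12 ℕ.* L)     ≤⟨ +-monoʳ-≤ (8 ℕ.* w) (*-monoʳ-≤ 2 h₂) ⟩
        8 ℕ.* w ℕ.+ 2 ℕ.* β              ∎))
        where
        open ≤-Reasoning
        e₁ : ∀ β → 3 ℕ.* (2 ℕ.* β) ℕ.+ 2 ℕ.* β ≡ 8 ℕ.* β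
        e₁ = solve-∀
        e₂ : ∀ w L → 8 ℕ.* (w ℕ.+ 3 ℕ.* L) ≡ 8 ℕ.* w ℕ.+ 2 ℕ.* (12 ℕ.* L)
        e₂ = solve-∀

      rich-arith : ∀ n β κ q h → κ ≡ 12 ℕ.* q → n ≤ 2 ℕ.* β → β ℕ.* β ≤ 4 ℕ.* (κ ℕ.* h) → n ℕ.* n ≤ γ ℕ.* (q ℕ.* h)
      rich-arith n β κ q h refl h₁ h₂ = begin
        n ℕ.* n                                ≤⟨ *-mono-≤ h₁ h₁ ⟩
        2 ℕ.* β ℕ.* (2 ℕ.* β)                  ≡⟨ e β ⟩
        4 ℕ.* (β ℕ.* β)                        ≤⟨ *-monoʳ-≤ 4 h₂ ⟩
        4 ℕ.* (4 ℕ.* (12 ℕ.* q ℕ.* h))         ≡⟨ γ-def q h ⟩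
        γ ℕ.* (q ℕ.* h)                        ∎
        where
        open ≤-Reasoning
        e : ∀ β → 2 ℕ.* β ℕ.* (2 ℕ.* β) ≡ 4 ℕ.* (β ℕ.* β)
        e = solve-∀

      cube-arith : ∀ n N N′ M b → 0 < n → n ℕ.^ 3 ℕ.* N′ ≤ M ℕ.* b → b ≤ n → N ≤ N′ → n ℕ.* n ℕ.* N ≤ M
      cube-arith n N N′ M b n>0 h b≤n N≤ = *-cancelʳ-≤ (n ℕ.* n ℕ.* N) M n {{>-nonZero n>0}} (begin
        n ℕ.* n ℕ.* N ℕ.* n        ≡⟨ e n N ⟩
        n ℕ.^ 3 ℕ.* N              ≤⟨ *-monoʳ-≤ (n ℕ.^ 3) N≤ ⟩
        n ℕ.^ 3 ℕ.* N′             ≤⟨ h ⟩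
        M ℕ.* b                    ≤⟨ *-monoʳ-≤ M b≤n ⟩
        M ℕ.* n                    ∎)
        where
        open ≤-Reasoning
        e : ∀ n N → n ℕ.* n ℕ.* N ℕ.* n ≡ n ℕ.* (n ℕ.* (n ℕ.* 1)) ℕ.* N
        e = solve-∀

      pos-of-double : ∀ b → n ≤ 2 ℕ.* b → 0 < b
      pos-of-double zero    h = ≤-trans n>0 h
      pos-of-double (suc _) _ = s≤s z≤n

      module _ (B₀ : List E) (B₀⊆A : B₀ ⊆ A) (n≤2B : n ≤ 2 ℕ.* card B₀)
               (B₀-bound : n ℕ.^ 3 ℕ.* card (B₀ ⊞ (A ⊞ A) ⊞ A) ≤ (2 ℕ.* S) ℕ.^ 3 ℕ.* card B₀) where
        B₁ = set B₀
        κ  = 12 ℕ.* Q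

        B₁⊆A : B₁ ⊆ A
        B₁⊆A = B₀⊆A ∘ ∈-set⁻ B₀

        module P {b} (b∈ : b ∈ B₀) where
          open PopularSlopes {B₁} (set-unique B₀) (A≢0 ∘ B₁⊆A) (∈-set⁺ b∈) κ public

        rare : ∀ {b} → b ∈ B₀ → E → List E
        rare b∈ x = filter (λ w → P.unpopular? b∈ (inv x * w)) B₁

        choose-W : ∀ {b} (b∈ : b ∈ B₀) x → x ∈ B₁ →
                   12 ℕ.* length (rare b∈ x) ≤ length B₁ →
                   (∃ λ W → W ⊆ B₁ × Unique W ×
                     length B₁ ≤ length W ℕ.+ 3 ℕ.* length (rare b∈ x) ×
                     (∀ {w} → w ∈ W → length B₁ ℕ.* length B₁ ≤ 4 ℕ.* (κ ℕ.* length (hits B₁ (inv x * w) W)))) → Core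
        choose-W b∈ x x∈ few (W , W⊆ , W! , W-size , W-rich) = record
          { l≢0 = inv≢0 (A≢0 (B₁⊆A x∈))
          ; B⊆A = B₁⊆A
          ; W⊆B = W⊆
          ; W!  = W!
          ; sum-bound = cube-arith n (card (B₁ ⊞ (A ⊞ A) ⊞ A)) (card (B₀ ⊞ (A ⊞ A) ⊞ A)) ((2 ℕ.* S) ℕ.^ 3) (card B₀) n>0
                          B₀-bound (card-mono B₀⊆A)
                          (card-mono (⊞-mono {B₁ ⊞ (A ⊞ A)} {B₀ ⊞ (A ⊞ A)} {A} {A} (⊞-mono {B₁} {B₀} {A ⊞ A} {A ⊞ A} (∈-set⁻ B₀) id) id))
          ; size = size-arith n (length B₁) (length W) (length (rare b∈ x)) n≤2B few W-size
          ; rich = λ {w} w∈ → rich-arith n (length B₁) κ Q (length (hits B₁ (inv x * w) W)) refl n≤2B (W-rich w∈)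
          }

        choose-x : ∀ {b} (b∈ : b ∈ B₀) →
                   (∃ λ x → x ∈ B₁ × 12 ℕ.* length (rare b∈ x) ≤ length B₁) → Core
        choose-x b∈ (x , x∈ , few) = choose-W b∈ x x∈ few (P.popular-core b∈ (inv x))

        dense⇒core : Core
        dense⇒core =
          let b , b∈ = inhabited B₀ (pos-of-double (card B₀) n≤2B) in
          choose-x b∈ (P.few-unpopular b∈ 12 A B₁⊆A refl)

      from-dense : (∃ λ B → B ⊆ A × n ≤ 2 ℕ.* card B × n ℕ.^ 3 ℕ.* card (B ⊞ (A ⊞ A) ⊞ A) ≤ (2 ℕ.* S) ℕ.^ 3 ℕ.* card B) → Core
      from-dense (B₀ , B₀⊆A , n≤2B , bound) = dense⇒core B₀ B₀⊆A n≤2B bound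

      opaque
        core : Core
        core = from-dense (plünnecke-dense A)

      open Core core

      R = quotients W

      dense : n ≤ 3 ℕ.* length W
      dense = *-cancelˡ-≤ 3 (begin
        3 ℕ.* n                        ≤⟨ size ⟩
        8 ℕ.* length W                 ≤⟨ *-monoˡ-≤ (length W) (ℕ.n≤1+n 8) ⟩
        9 ℕ.* length W                 ≡⟨ ℕ.*-assoc 3 3 (length W) ⟩
        3 ℕ.* (3 ℕ.* length W)         ∎)
        where open ≤-Reasoning

      module K = Cases A B W l γ A≢0 l≢0 B⊆A W⊆B W! n>0 sum-bound dense rich

      weaken : ∀ {C m} → C ≤ constant → n ℕ.^ 12 ≤ C ℕ.* m → n ℕ.^ 12 ≤ constant ℕ.* m
      weaken {C} {m} C≤ h = ≤-trans h (*-monoˡ-≤ m C≤)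

      S7Q4 S6Q5 : ℕ
      S7Q4 = S ℕ.^ 7 ℕ.* Q ℕ.^ 4
      S6Q5 = S ℕ.^ 6 ℕ.* Q ℕ.^ 5

      closed : 0# ∈ R → (∀ {s} → s ∈ R → 1# + s ∈ R) → (∀ {w s} → w ∈ W → s ∈ R → (l * w) * s ∈ R) → Conclusion
      closed 0∈R 1+R⊆R WR⊆R = finish (subfields R l W subfield l≢0 (B⊆A ∘ W⊆B) W! lW⊆R)
        where
        open Closed W l l≢0 (A≢0 ∘ B⊆A ∘ W⊆B) 0∈R 1+R⊆R WR⊆R
        3n≰n : ∀ {m} → 0 < m → ¬ 3 ℕ.* m ≤ m
        3n≰n {m} m>0 h = <-irrefl refl (≤-trans (ℕ.m<m+n m (≤-trans m>0 (m≤m+n m (m ℕ.+ 0)))) h)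
        finish : length W ℕ.* length W ≤ card R ⊎ 8 ℕ.* length W ≤ n → Conclusion
        -- The alternative `8 |W| ≤ n` contradicts `3 n ≤ 8 |W|`.
        finish (inj₂ h) = contradiction (≤-trans size h) (3n≰n n>0)
        finish (inj₁ h) = let s , s∈ , low = low-energy W R W! 0∈R h in
          inj₁ (weaken {C₃} {S7Q4} C₃≤ (K.low-energy⇒ s∈ low))

      two-elements : 0# ∈ R → Conclusion
      two-elements 0∈R = additive (any? (λ s → ¬? ((1# + s) ∈? R)) R)
        where
        Escape : E → Set
        Escape w = Any (λ s → (l * w) * s ∉ R) R
        escape? : Decidable Escape
        escape? w = any? (λ s → ¬? (((l * w) * s) ∈? R)) R
        multiplicative : (∀ {s} → s ∈ R → 1# + s ∈ R) → Dec (Any Escape W) → Conclusion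
        multiplicative 1+R⊆R (yes p) =
          let w , w∈ , q = find p
              s , s∈ , ∉R = find q
          in inj₂ (weaken {C₂} {S6Q5} C₂≤ (K.ms∉R⇒ w∈ s∈ ∉R))
        multiplicative 1+R⊆R (no ¬p) = closed 0∈R 1+R⊆R
          (λ {w} {s} w∈ s∈ → decidable-stable (((l * w) * s) ∈? R) (λ ∉R → ¬p (lose w∈ (lose s∈ ∉R))))
        additive : Dec (Any (λ s → 1# + s ∉ R) R) → Conclusion
        additive (yes p) = let s , s∈ , ∉R = find p in inj₁ (weaken {C₁} {S7Q4} C₁≤ (K.1+s∉R⇒ s∈ ∉R))
        additive (no ¬p) = multiplicative
          (λ {s} s∈ → decidable-stable ((1# + s) ∈? R) (λ ∉R → ¬p (lose s∈ ∉R)))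
          (any? escape? W)

      small : n ≤ 2 → Conclusion
      small n≤2 = inj₁ (begin
        n ℕ.^ 12                  ≤⟨ ℕ.^-monoˡ-≤ 12 n≤2 ⟩
        2 ℕ.^ 12                  ≤⟨ 2¹²≤ ⟩
        constant                  ≡⟨ sym (ℕ.*-identityʳ constant) ⟩
        constant ℕ.* 1            ≤⟨ *-monoʳ-≤ constant pos ⟩
        constant ℕ.* S7Q4         ∎)
        where
        open ≤-Reasoning
        pow-pos : ∀ {m} k → 0 < m → 0 < m ℕ.^ k
        pow-pos zero    _ = s≤s z≤n
        pow-pos (suc k) h = ℕ.*-mono-< h (pow-pos k h)
        pos : 1 ≤ S7Q4
        pos = ℕ.*-mono-< (pow-pos 7 (card>0 (⊞⁺ a₀∈ a₀∈))) (pow-pos 4 (card>0 (⊘⁺ a₀∈ a₀∈)))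

      few-elements : ∀ w → w ≤ 1 → 3 ℕ.* n ≤ 8 ℕ.* w → n ≤ 2
      few-elements w w≤1 h = ℕ.≮⇒≥ (λ n>2 → ℕ.<⇒≱ (ℕ.n<1+n 8) (≤-trans (*-monoʳ-≤ 3 n>2) (≤-trans h (*-monoʳ-≤ 8 w≤1))))

      -- Two distinct elements of `W` are what makes `R` nonempty; with fewer, `3 n ≤ 8 |W|` leaves
      -- `n ≤ 2`.
      by-size : ∀ W′ → W ≡ W′ → Conclusion
      by-size []             eq = small (few-elements (length W) (subst (λ z → length z ≤ 1) (sym eq) z≤n) size)
      by-size (_ ∷ [])       eq = small (few-elements (length W) (subst (λ z → length z ≤ 1) (sym eq) (s≤s z≤n)) size)
      by-size (c ∷ d ∷ _)    eq = two-elements (0∈quotients (subst (c ∈_) (sym eq) (here refl))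
        (subst (d ∈_) (sym eq) (there (here refl))) (distinct (subst Unique eq W!)))
        where
        distinct : ∀ {c d} {L : List E} → Unique (c ∷ d ∷ L) → ¬ c ≡ d
        distinct ((c≢d ∷ _) ∷ _) = c≢d

    sum-product : n ℕ.^ 12 ≤ constant ℕ.* (S ℕ.^ 7 ℕ.* Q ℕ.^ 4) ⊎ n ℕ.^ 12 ≤ constant ℕ.* (S ℕ.^ 6 ℕ.* Q ℕ.^ 5)
    sum-product = by-size W refl

-- Transfer to an arbitrary finite field

lookup-distinct : ∀ {A : Set} {_≈_ : A → A → Set} → (∀ {x y} → x ≈ y → y ≈ x) →
                  ∀ {xs} → AllPairs (λ x y → ¬ (x ≈ y)) xs → ∀ i j → lookup xs i ≈ lookup xs j → i ≡ j
lookup-distinct ≈-sym (x∉ ∷ d) fzero    fzero    eq = refl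
lookup-distinct ≈-sym (x∉ ∷ d) fzero    (fsuc j) eq = contradiction eq (All.lookup x∉ (∈-lookup j))
lookup-distinct ≈-sym (x∉ ∷ d) (fsuc i) fzero    eq = contradiction (≈-sym eq) (All.lookup x∉ (∈-lookup i))
lookup-distinct ≈-sym (x∉ ∷ d) (fsuc i) (fsuc j) eq = cong fsuc (lookup-distinct ≈-sym d i j eq)

module Enumerated (𝔽 : FiniteField) where
  open FiniteField 𝔽 hiding (isEquivalence)
    renaming (setoid to ≈-setoid; _+_ to _+′_; _*_ to _*′_; -_ to -′_; 0# to 0′; 1# to 1′; refl to ≈-refl; sym to ≈-sym; trans to ≈-trans; card to card′)

  -- Each class of the field's equality occurs exactly once in `elems`, so positions in that list
  -- represent the classes and have propositional, decidable equality.
  E : Set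
  E = Fin (length elems)

  el : E → Carrier
  el = lookup elems

  opaque
    ix : Carrier → E
    ix x = index (complete x)

    el-ix : ∀ x → el (ix x) ≈ x
    el-ix x = ≈-sym (lookup-index (complete x))

  ix-cong : ∀ {x y} → x ≈ y → ix x ≡ ix y
  ix-cong {x} {y} eq = lookup-distinct ≈-sym distinct _ _ (≈-trans (el-ix x) (≈-trans eq (≈-sym (el-ix y))))

  ix-el : ∀ i → ix (el i) ≡ i
  ix-el i = lookup-distinct ≈-sym distinct _ _ (el-ix (el i))

  ix-injective : ∀ {x y} → ix x ≡ ix y → x ≈ y
  ix-injective {x} {y} eq = ≈-trans (≈-sym (el-ix x)) (≈-trans (reflexive (cong el eq)) (el-ix y))

  private
    law : ∀ {x y} i → x ≈ el i → y ≈ x → ix y ≡ i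
    law i p q = trans (ix-cong (≈-trans q p)) (ix-el i)

  enumerated : DecField
  enumerated = record
    { E = E
    ; _+_ = λ i j → ix (el i +′ el j)
    ; _*_ = λ i j → ix (el i *′ el j)
    ; -_ = λ i → ix (-′ el i)
    ; 0# = ix 0′
    ; 1# = ix 1′
    ; isCommutativeRing = record
      { isRing = record
        { +-isAbelianGroup = record
          { isGroup = record
            { isMonoid = record
              { isSemigroup = record
                { isMagma = record { isEquivalence = isEquivalence ; ∙-cong = cong₂ _ }
                ; assoc = λ i j k → ix-cong (≈-trans (+-congʳ (el-ix _)) (≈-trans (+-assoc (el i) (el j) (el k)) (+-congˡ (≈-sym (el-ix _)))))
                }
              ; identity = (λ i → law i (+-identityˡ (el i)) (+-congʳ (el-ix 0′)))
                         , (λ i → law i (+-identityʳ (el i)) (+-congˡ (el-ix 0′)))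
              }
            ; inverse = (λ i → ix-cong (≈-trans (+-congʳ (el-ix _)) (-‿inverseˡ (el i))))
                      , (λ i → ix-cong (≈-trans (+-congˡ (el-ix _)) (-‿inverseʳ (el i))))
            ; ⁻¹-cong = cong (λ i → ix (-′ el i))
            }
          ; comm = λ i j → ix-cong (+-comm (el i) (el j))
          }
        ; *-cong = cong₂ _
        ; *-assoc = λ i j k → ix-cong (≈-trans (*-congʳ (el-ix _)) (≈-trans (*-assoc (el i) (el j) (el k)) (*-congˡ (≈-sym (el-ix _)))))
        ; *-identity = (λ i → law i (*-identityˡ (el i)) (*-congʳ (el-ix 1′)))
                     , (λ i → law i (*-identityʳ (el i)) (*-congˡ (el-ix 1′)))
        ; distrib = (λ i j k → ix-cong (≈-trans (*-congˡ (el-ix _)) (≈-trans (distribˡ (el i) (el j) (el k)) (+-cong (≈-sym (el-ix _)) (≈-sym (el-ix _))))))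
                  , (λ i j k → ix-cong (≈-trans (*-congʳ (el-ix _)) (≈-trans (distribʳ (el i) (el j) (el k)) (+-cong (≈-sym (el-ix _)) (≈-sym (el-ix _))))))
        }
      ; *-comm = λ i j → ix-cong (*-comm (el i) (el j))
      }
    ; inv = λ i → ix ((el i) ⁻¹)
    ; inverse = λ i i≢0 → ix-cong (≈-trans (*-congˡ (el-ix _)) (inverseʳ (el i) (λ eq → i≢0 (trans (sym (ix-el i)) (ix-cong eq)))))
    ; 1≢0 = λ eq → nontrivial (ix-injective eq)
    ; _≟_ = Fin._≟_
    }

  open DecField enumerated using (inv) renaming (_*_ to _⊗_; 0# to 𝟘; inverse to ⊗-inverse; *-identityˡ to ⊗-identityˡ; *-comm to ⊗-comm; *-assoc to ⊗-assoc; _≟_ to _≟ᴱ_)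
  open Cardinality _≟ᴱ_
  open Sumsets enumerated
  open Popularity enumerated
  open Quotients enumerated

  -- Congruence of the inverse is not among the axioms, but follows from uniqueness of inverses away
  -- from 0.
  ⁻¹-cong-nonzero : ∀ {x y} → ¬ (x ≈ 0′) → x ≈ y → x ⁻¹ ≈ y ⁻¹
  ⁻¹-cong-nonzero {x} {y} x≉0 x≈y = begin
    x ⁻¹                     ≈⟨ *-identityʳ (x ⁻¹) ⟨
    x ⁻¹ *′ 1′               ≈⟨ *-congˡ (inverseʳ y (λ y≈0 → x≉0 (≈-trans x≈y y≈0))) ⟨
    x ⁻¹ *′ (y *′ y ⁻¹)      ≈⟨ *-assoc (x ⁻¹) y (y ⁻¹) ⟨
    (x ⁻¹ *′ y) *′ y ⁻¹      ≈⟨ *-congʳ (*-congˡ x≈y) ⟨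
    (x ⁻¹ *′ x) *′ y ⁻¹      ≈⟨ *-congʳ (≈-trans (*-comm (x ⁻¹) x) (inverseʳ x x≉0)) ⟩
    1′ *′ y ⁻¹               ≈⟨ *-identityˡ (y ⁻¹) ⟩
    y ⁻¹                     ∎
    where open import Relation.Binary.Reasoning.Setoid ≈-setoid

  unique-ix : ∀ {xs} → AllPairs (λ x y → ¬ (x ≈ y)) xs → Unique (map ix xs)
  unique-ix d = AllPairs.map⁺ (AllPairs.map (λ x≉y eq → x≉y (ix-injective eq)) d)

  card≤countF : ∀ {P : Pred Carrier 0ℓ} (P? : ∀ x → Dec (P x)) (Z : List E) →
                (∀ {z} → z ∈ Z → P (el z)) → card Z ≤ countF P?
  card≤countF P? Z h = subst (card Z ≤_) (length-map ix (filter P? elems))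
    (card≤length Z (map ix (filter P? elems))
      (λ {z} z∈ → subst (_∈ map ix (filter P? elems)) (ix-el z) (∈-map⁺ ix (∈-filter⁺ P? {xs = elems} (∈-lookup z) (h z∈)))))

  module _ (A : List Carrier) (A-distinct : FinSubset A) (A≉0 : All (λ a → ¬ (a ≈ 0′)) A) where

    A′ : List E
    A′ = map ix A

    card-A′ : card A′ ≡ length A
    card-A′ = trans (card-unique (unique-ix A-distinct)) (length-map ix A)

    A′≢0 : ∀ {a} → a ∈ A′ → ¬ a ≡ 𝟘
    A′≢0 a∈ with ∈-map⁻ ix a∈
    ... | x , x∈ , refl = λ eq → All.lookup A≉0 x∈ (ix-injective eq)

    sums≤ : card (A′ ⊞ A′) ≤ sumSetSize A
    sums≤ = card≤countF _ (A′ ⊞ A′) member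
      where
      member : ∀ {z} → z ∈ A′ ⊞ A′ → InSumSet A (el z)
      member z∈ with ⊞⁻ A′ A′ z∈
      ... | _ , _ , a∈ , b∈ , refl with ∈-map⁻ ix a∈ | ∈-map⁻ ix b∈
      ...   | a , a∈A , refl | b , b∈A , refl =
              lose a∈A (lose b∈A (≈-trans (el-ix _) (+-cong (el-ix a) (el-ix b))))

    ratios≤ : card (A′ ⊘ A′) ≤ ratioSetSize A
    ratios≤ = card≤countF _ (A′ ⊘ A′) member
      where
      member : ∀ {z} → z ∈ A′ ⊘ A′ → InRatioSet A (el z)
      member z∈ with ⊘⁻ A′ A′ z∈
      ... | _ , _ , a∈ , b∈ , refl with ∈-map⁻ ix a∈ | ∈-map⁻ ix b∈
      ...   | a , a∈A , refl | b , b∈A , refl =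
              lose a∈A (lose b∈A (≈-trans (el-ix _) (≈-trans (*-cong (≈-trans (el-ix _)
                (≈-sym (⁻¹-cong-nonzero (All.lookup A≉0 b∈A) (≈-sym (el-ix b))))) (el-ix a)) (*-comm (b ⁻¹) a))))

    module _ (R : List E) (sub : Subfield R) where
      open Subfield sub

      G : Pred Carrier 0ℓ
      G x = ix x ∈ R

      G? : ∀ x → Dec (G x)
      G? x = ix x ∈? R

      isSubfield : IsSubfield G
      isSubfield = record
        { resp = λ eq → subst (_∈ R) (ix-cong eq)
        ; has0 = 0∈
        ; has1 = 1∈
        ; +-closed = λ {x} {y} p q → subst (_∈ R) (ix-cong (+-cong (el-ix x) (el-ix y))) (+∈ p q)
        ; neg-closed = λ {x} p → subst (_∈ R) (ix-cong (-‿cong (el-ix x))) (-∈ p)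
        ; *-closed = λ {x} {y} p q → subst (_∈ R) (ix-cong (*-cong (el-ix x) (el-ix y))) (*∈ p q)
        ; inv-closed = λ {x} p x≉0 → subst (_∈ R) (ix-cong (≈-sym (⁻¹-cong-nonzero x≉0 (≈-sym (el-ix x)))))
                         (inv∈ p (λ eq → x≉0 (ix-injective eq)))
        }

      subfieldSize≤ : subfieldSize G? ≤ card R
      subfieldSize≤ = subst (_≤ card R) (length-map ix (filter G? elems))
        (length≤card (map ix (filter G? elems)) R id (unique-ix (AllPairs.filter⁺ G? distinct)) into (λ _ _ → id))
        where
        into : ∀ {z} → z ∈ map ix (filter G? elems) → z ∈ R
        into z∈ with ∈-map⁻ ix z∈
        ... | x , x∈ , refl = proj₂ (∈-filter⁻ G? {xs = elems} x∈)

      -- That `l w` lies in `R` places `w` in the dilate of `R` by the inverse of `l`, so this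
      -- inverse is the `c` at which the hypothesis on subfields is used.
      dilate≥ : ∀ l W → ¬ l ≡ 𝟘 → W ⊆ A′ → Unique W → (∀ {w} → w ∈ W → l ⊗ w ∈ R) →
                length W ≤ dilateInterSize G? (el (inv l)) A
      dilate≥ l W l≢0 W⊆ W! lW⊆R = subst (length W ≤_) (length-map ix (filter in? A))
        (length-inj W (map ix (filter in? A)) id W! into (λ _ _ → id))
        where
        in? : Decidable (InDilate G (el (inv l)))
        in? x = any? (λ g → G? g ×-dec (x ≟ (el (inv l) *′ g))) elems
        into : ∀ {w} → w ∈ W → w ∈ map ix (filter in? A)
        into w∈ with ∈-map⁻ ix (W⊆ w∈)
        ... | a , a∈ , refl = ∈-map⁺ ix (∈-filter⁺ in? a∈ (lose (∈-lookup {xs = elems} (l ⊗ ix a))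
              (subst (_∈ R) (sym (ix-el (l ⊗ ix a))) (lW⊆R w∈) , ix-injective cancel)))
          where
          cancel : ix a ≡ inv l ⊗ (l ⊗ ix a)
          cancel = sym (trans (sym (⊗-assoc (inv l) l (ix a)))
            (trans (cong (_⊗ ix a) (trans (⊗-comm (inv l) l) (⊗-inverse l l≢0))) (⊗-identityˡ (ix a))))

    module _ (hyp : (G : Pred Carrier 0ℓ) → (G? : ∀ x → Dec (G x)) → IsSubfield G → (c : Carrier) →
                    (dilateInterSize G? c A ℕ.^ 2 ≤ subfieldSize G?) ⊎ (8 ℕ.* dilateInterSize G? c A ≤ card′ A)) where

      subfields : ∀ R l W → Subfield R → ¬ l ≡ 𝟘 → W ⊆ A′ → Unique W → (∀ {w} → w ∈ W → l ⊗ w ∈ R) →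
                  length W ℕ.* length W ≤ card R ⊎ 8 ℕ.* length W ≤ card A′
      subfields R l W sub l≢0 W⊆ W! lW⊆R = convert (hyp (G R sub) (G? R sub) (isSubfield R sub) (el (inv l)))
        where
        D = dilateInterSize (G? R sub) (el (inv l)) A
        W≤D : length W ≤ D
        W≤D = dilate≥ R sub l W l≢0 W⊆ W! lW⊆R
        convert : (D ℕ.^ 2 ≤ subfieldSize (G? R sub)) ⊎ (8 ℕ.* D ≤ card′ A) →
                  length W ℕ.* length W ≤ card R ⊎ 8 ℕ.* length W ≤ card A′
        convert (inj₁ p) = inj₁ (≤-trans (*-mono-≤ W≤D (≤-trans W≤D (≤-reflexive (sym (ℕ.*-identityʳ D))))) (≤-trans p (subfieldSize≤ R sub)))
        convert (inj₂ p) = inj₂ (≤-trans (*-monoʳ-≤ 8 W≤D) (≤-trans p (≤-reflexive (sym card-A′))))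

      private
        s = sumSetSize A
        t = ratioSetSize A

        transfer : ∀ {n s₀ t₀} i j → n ≡ length A → s₀ ≤ s → t₀ ≤ t →
                   n ℕ.^ 12 ≤ constant ℕ.* (s₀ ℕ.^ i ℕ.* t₀ ℕ.^ j) → length A ℕ.^ 12 ≤ constant ℕ.* (s ℕ.^ i ℕ.* t ℕ.^ j)
        transfer i j refl s≤ t≤ h = ≤-trans h (*-monoʳ-≤ constant (*-mono-≤ (ℕ.^-monoˡ-≤ i s≤) (ℕ.^-monoˡ-≤ j t≤)))

        Bound : ℕ → ℕ → Set
        Bound i j = length A ℕ.^ 12 ≤ constant ℕ.* (s ℕ.^ i ℕ.* t ℕ.^ j)

        max-bound : ∀ i j → Bound i j → length A ℕ.^ 12 ≤ constant ℕ.* ((s ℕ.⊔ t) ℕ.^ (i ℕ.+ j))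
        max-bound i j h = ≤-trans h (*-monoʳ-≤ constant (≤-trans
          (*-mono-≤ (ℕ.^-monoˡ-≤ i (ℕ.m≤m⊔n s t)) (ℕ.^-monoˡ-≤ j (ℕ.m≤n⊔m s t)))
          (≤-reflexive (sym (ℕ.^-distribˡ-+-* (s ℕ.⊔ t) i j)))))

      dichotomy : ∀ {a} → a ∈ A → Bound 7 4 ⊎ Bound 6 5
      dichotomy a∈ with SumProduct.sum-product enumerated A′ A′≢0 (∈-map⁺ ix a∈) subfields
      ... | inj₁ h = inj₁ (transfer 7 4 card-A′ sums≤ ratios≤ h)
      ... | inj₂ h = inj₂ (transfer 6 5 card-A′ sums≤ ratios≤ h)

      max-of : Bound 7 4 ⊎ Bound 6 5 → length A ℕ.^ 12 ≤ constant ℕ.* ((s ℕ.⊔ t) ℕ.^ 11)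
      max-of (inj₁ h) = max-bound 7 4 h
      max-of (inj₂ h) = max-bound 6 5 h

      bounds : ∀ {a} → a ∈ A → (Bound 7 4 ⊎ Bound 6 5) × (length A ℕ.^ 12 ≤ constant ℕ.* ((s ℕ.⊔ t) ℕ.^ 11))
      bounds a∈ = let d = dichotomy a∈ in d , max-of d

constant-nonZero : NonZero constant
constant-nonZero = >-nonZero (≤-trans (s≤s z≤n) 2¹²≤)

open import Data.Nat using (_*_; _^_; _⊔_)
open FiniteField using (Carrier; FinSubset; IsSubfield; dilateInterSize; subfieldSize; card; sumSetSize; ratioSetSize)

theorem2 : Σ ℕ λ C → NonZero C ×
    ((F : FiniteField) →
    (A : List (Carrier F)) → FinSubset F A →
    All (λ a → ¬ (FiniteField._≈_ F a (FiniteField.0# F))) A →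
    ((G : Pred (Carrier F) 0ℓ) → (G? : ∀ x → Dec (G x)) → IsSubfield F G → (c : Carrier F) →
    (dilateInterSize F G? c A ^ 2 ≤ subfieldSize F G?)
    ⊎ (8 * dilateInterSize F G? c A ≤ card F A)) →
    ((card F A ^ 12 ≤ C * (sumSetSize F A ^ 7 * ratioSetSize F A ^ 4))
    ⊎ (card F A ^ 12 ≤ C * (sumSetSize F A ^ 6 * ratioSetSize F A ^ 5)))
    × (card F A ^ 12 ≤ C * ((sumSetSize F A ⊔ ratioSetSize F A) ^ 11)))
theorem2 = constant , constant-nonZero , λ where
  -- The general argument starts from an element of `A`; for the empty set the left sides vanish.
  F []        _ _   _   → inj₁ z≤n , z≤n
  F A@(_ ∷ _) d A≉0 hyp → Enumerated.bounds F A d A≉0 hyp (here refl)
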